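{- Let $n\geq 12$ be an even integer. Among all binary trees on $n$ vertices, the distance between centroid and subtree core is maximized by a crg tree; that is, there is a crg tree $T^*$ on $n$ vertices such that $d_T(C_d(T),S_c(T))\leq d_{T^*}(C_d(T^*),S_c(T^*))$ for every binary tree $T$ on $n$ vertices.
   Context: All graphs are finite, simple, connected and undirected. A pendant vertex is a vertex of degree $1$. A binary tree is a tree in which every non-pendant vertex has degree $3$ (so its number of vertices is even). Centroid and subtree core: a subtree of $T$ is a (nonempty) connected subgraph of $T$. A branch at $v\in V(T)$ is a maximal subtree of $T$ containing $v$ as a pendant vertex; the weight of $v$ is the maximum number of edges in a branch at $v$; the centroid $C_d(T)$ is the set of vertices of minimum weight. $f_T(v)$ is the number of subtrees of $T$ containing $v$; the subtree core $S_c(T)$ is the set of vertices $v$ for which $f_T(v)$ is maximum. For $X,Y\subseteq V(T)$, $d_T(X,Y)=\min\{d_T(x,y):x\in X,y\in Y\}$. The eccentricity of $v$ is $\max_u d_T(u,v)$. Rooted binary trees: a rooted binary tree is a rooted tree whose root has degree $2$ and in which every other vertex has degree $1$ or $3$; the single-vertex rooted tree is also allowed. The height (level) of a vertex is its distance to the root. A rooted binary tree is ordered if the vertices of each level $l\ge 1$ are linearly ordered so that two vertices at level $l+1$ with different parents are ordered as their parents are at level $l$. A rooted binary tree is rgood if (i) the heights of any two of its pendant vertices differ by at most $1$, and (ii) it can be ordered so that the parents of the pendant vertices at the highest level form a final segment in the ordering of the vertices at the next-to-highest level. For each odd $l$ there is, up to isomorphism, exactly one rgood binary tree on $l$ vertices,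 denoted $T_{rg}^l$. Crg trees: a binary caterpillar is a binary tree having a path such that every vertex not on the path is adjacent to a vertex of the path. For even $n\ge 4$ and odd $l$ with $3\le l<n$, the crg tree $T_{rg}^{n,l}$ is the tree on $n$ vertices obtained by identifying the root of $T_{rg}^l$ with a vertex of maximum eccentricity of a binary caterpillar on $n-l+1$ vertices. -}

module Defs where

open import Level using (0ℓ)
open import Data.Bool using (true; false)
open import Data.Nat using (ℕ; zero; suc; _+_; _∸_; _≤_; _<_; z≤n; s≤s; NonZero; _≟_; _≤?_)
open import Data.Nat.Properties using (≤-totalOrder)
open import Data.Nat.Divisibility using (_∣_; _∤_)
open import Data.Fin using (Fin; zero; suc; inject₁; fromℕ)
import Data.Fin as Fin
import Data.Fin.Properties as Fin
open import Data.Fin.Subset using (Subset; _∈_; _⊆_; ∣_∣; Nonempty)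
open import Data.Fin.Subset.Properties using (_∈?_; _⊆?_; nonempty?)
open import Data.Vec using (Vec; []; _∷_; lookup)
open import Data.List using (List; []; _∷_; map; filter; length; allFin; cartesianProduct; cartesianProductWith)
open import Data.List.Extrema ≤-totalOrder using (max; argmin; argmax; f[argmin]≤f[xs]; f[xs]≤f[argmax])
import Data.List.Membership.Propositional as List
open import Data.List.Membership.Propositional.Properties using (∈-cartesianProduct⁺; ∈-cartesianProductWith⁺; ∈-allFin)
open import Data.List.Relation.Unary.All as All using (All)
open import Data.List.Relation.Unary.Any using (here; there)
open import Data.Product using (Σ-syntax; ∃; ∃-syntax; ∃₂; _×_; _,_; proj₁; proj₂)
open import Data.Sum using (_⊎_; inj₁; inj₂)
open import Function using (_⇔_; _on_)
open import Function.Definitions using (Injective)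
open import Relation.Binary using (Rel; Decidable; Symmetric; Irreflexive; IsStrictTotalOrder)
open import Relation.Binary.PropositionalEquality using (_≡_; _≢_; refl)
open import Relation.Nullary using (¬_; Dec; yes; no; contradiction)
open import Relation.Nullary.Decidable using (map′; _×-dec_; _⊎-dec_; _→-dec_)
open import Relation.Unary using (Pred)
import Relation.Unary as U

Least : Pred ℕ 0ℓ → Set
Least P = ∃[ k ] (P k × (∀ j → P j → k ≤ j))

least : {P : Pred ℕ 0ℓ} → U.Decidable P → ∀ k → P k → Least P
least P? zero p = zero , p , λ _ _ → z≤n
least {P} P? (suc k) p with P? zero
... | yes p₀ = zero , p₀ , λ _ _ → z≤n
... | no ¬p₀ with least (λ i → P? (suc i)) k p
...   | m , pm , m-min = suc m , pm , above
  where
  above : ∀ j → P j → suc m ≤ j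
  above zero    pj = contradiction pj ¬p₀
  above (suc j) pj = s≤s (m-min j pj)

count : ∀ {n} {P : Pred (Fin n) 0ℓ} → U.Decidable P → ℕ
count {n} P? = length (filter P? (allFin n))

data Walk {n : ℕ} (R : Rel (Fin n) 0ℓ) : ℕ → Rel (Fin n) 0ℓ where
  []  : ∀ {u} → Walk R zero u u
  _∷_ : ∀ {k u v w} → R u v → Walk R k v w → Walk R (suc k) u w

Joined : ∀ {n} → Rel (Fin n) 0ℓ → Rel (Fin n) 0ℓ
Joined R u v = ∃[ k ] Walk R k u v

module _ {n : ℕ} {R : Rel (Fin n) 0ℓ} where

  _++ʷ_ : ∀ {j k u v w} → Walk R j u v → Walk R k v w → Walk R (j + k) u w
  []      ++ʷ q = q
  (e ∷ p) ++ʷ q = e ∷ (p ++ʷ q)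

  module _ (R? : Decidable R) where

    walk? : ∀ k → Decidable (Walk R k)
    walk? zero    u v = map′ (λ { refl → [] }) (λ { [] → refl }) (u Fin.≟ v)
    walk? (suc k) u w =
      map′ (λ { (v , e , p) → e ∷ p }) (λ { (e ∷ p) → _ , e , p })
           (Fin.any? λ v → R? u v ×-dec walk? k v w)

    -- Decidability of Joined by the Floyd–Warshall recursion: Via xs is
    -- reachability through intermediate vertices from xs.
    private
      Via : List (Fin n) → Rel (Fin n) 0ℓ
      Via []       u v = u ≡ v ⊎ R u v
      Via (x ∷ xs) u v = Via xs u v ⊎ (Via xs u x × Via xs x v)

      via? : ∀ xs → Decidable (Via xs)
      via? []       u v = (u Fin.≟ v) ⊎-dec R? u v
      via? (x ∷ xs) u v = via? xs u v ⊎-dec (via? xs u x ×-dec via? xs x v)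

      via⇒joined : ∀ xs {u v} → Via xs u v → Joined R u v
      via⇒joined []       (inj₁ refl)    = 0 , []
      via⇒joined []       (inj₂ e)       = 1 , e ∷ []
      via⇒joined (x ∷ xs) (inj₁ p)       = via⇒joined xs p
      via⇒joined (x ∷ xs) (inj₂ (p , q)) =
        _ , (proj₂ (via⇒joined xs p) ++ʷ proj₂ (via⇒joined xs q))

      base : ∀ xs {u v} → u ≡ v ⊎ R u v → Via xs u v
      base []       e = e
      base (x ∷ xs) e = inj₁ (base xs e)

      via-trans : ∀ xs {u w v} → w List.∈ xs → Via xs u w → Via xs w v → Via xs u v
      via-trans (x ∷ xs) (here refl) (inj₁ p)       (inj₁ q)       = inj₂ (p , q)
      via-trans (x ∷ xs) (here refl) (inj₁ p)       (inj₂ (_ , q)) = inj₂ (p , q)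
      via-trans (x ∷ xs) (here refl) (inj₂ (p , _)) (inj₁ q)       = inj₂ (p , q)
      via-trans (x ∷ xs) (here refl) (inj₂ (p , _)) (inj₂ (_ , q)) = inj₂ (p , q)
      via-trans (x ∷ xs) (there i) (inj₁ p)       (inj₁ q)       = inj₁ (via-trans xs i p q)
      via-trans (x ∷ xs) (there i) (inj₁ p)       (inj₂ (q , r)) = inj₂ (via-trans xs i p q , r)
      via-trans (x ∷ xs) (there i) (inj₂ (p , q)) (inj₁ r)       = inj₂ (p , via-trans xs i q r)
      via-trans (x ∷ xs) (there i) (inj₂ (p , _)) (inj₂ (_ , r)) = inj₂ (p , r)

      joined⇒via : ∀ {k u v} → Walk R k u v → Via (allFin n) u v
      joined⇒via []      = base (allFin n) (inj₁ refl)
      joined⇒via (e ∷ p) =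
        via-trans (allFin n) (∈-allFin _) (base (allFin n) (inj₂ e)) (joined⇒via p)

    joined? : Decidable (Joined R)
    joined? u v =
      map′ (via⇒joined (allFin n)) (λ p → joined⇒via (proj₂ p)) (via? (allFin n) u v)

-- Graphs are connected by convention, so a tree is a graph without cycles.
record Graph (n : ℕ) : Set₁ where
  infix 4 _~_ _~?_
  field
    nonZero   : NonZero n
    _~_       : Rel (Fin n) 0ℓ
    _~?_      : Decidable _~_
    symmetric : Symmetric _~_
    loopless  : Irreflexive _≡_ _~_
    connected : ∀ u v → Joined _~_ u v

  degree : Fin n → ℕ
  degree v = count (v ~?_)

  Pendant : Pred (Fin n) 0ℓ
  Pendant v = degree v ≡ 1

  shortest : ∀ u v → Least (λ k → Walk _~_ k u v)
  shortest u v = least (λ k → walk? _~?_ k u v) (proj₁ joined) (proj₂ joined)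
    where joined = connected u v

  dist : Fin n → Fin n → ℕ
  dist u v = proj₁ (shortest u v)

  ecc : Fin n → ℕ
  ecc v = max 0 (map (dist v) (allFin n))

  MaxEccentricity : Pred (Fin n) 0ℓ
  MaxEccentricity v = ∀ u → ecc u ≤ ecc v

  setDist : {X Y : Pred (Fin n) 0ℓ} → U.Decidable X → U.Decidable Y → ∃ X → ∃ Y → ℕ
  setDist {X} {Y} X? Y? (x₀ , x₀∈X) (y₀ , y₀∈Y) =
    proj₁ (least attained? (dist x₀ y₀) (x₀ , y₀ , x₀∈X , y₀∈Y , refl))
    where
    Attained : Pred ℕ 0ℓ
    Attained k = ∃₂ λ x y → X x × Y y × dist x y ≡ k
    attained? : U.Decidable Attained
    attained? k = Fin.any? λ x → Fin.any? λ y → X? x ×-dec (Y? y ×-dec (dist x y ≟ k))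

  IsPath : ∀ {k} → (Fin (suc k) → Fin n) → Set
  IsPath {k} p = Injective _≡_ _≡_ p × (∀ (i : Fin k) → p (inject₁ i) ~ p (suc i))

  IsCycle : ∀ {k} → (Fin (suc k) → Fin n) → Set
  IsCycle {k} p = 2 ≤ k × IsPath p × p (fromℕ k) ~ p zero

  IsTree : Set
  IsTree = ∀ {k} (p : Fin (suc k) → Fin n) → ¬ IsCycle p

  IsBinaryTree : Set
  IsBinaryTree = IsTree × (∀ v → ¬ Pendant v → degree v ≡ 3)

  IsBinaryCaterpillar : Set
  IsBinaryCaterpillar = IsBinaryTree ×
    (∃₂ λ k (p : Fin (suc k) → Fin n) → IsPath p ×
      (∀ v → (∀ i → p i ≢ v) → ∃[ i ] (v ~ p i)))

-- Candidate subgraphs, as a vertex set with an adjacency matrix, so that each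
-- subgraph has exactly one representation and counting in allSubs is exact.

Edges : ℕ → Set
Edges n = Vec (Subset n) n

Adj : ∀ {n} → Edges n → Rel (Fin n) 0ℓ
Adj E u v = v ∈ lookup E u

adj? : ∀ {n} (E : Edges n) → Decidable (Adj E)
adj? E u v = v ∈? lookup E u

Sub : ℕ → Set
Sub n = Subset n × Edges n

_⊑_ : ∀ {n} → Rel (Sub n) 0ℓ
(V , E) ⊑ (V′ , E′) = V ⊆ V′ × (∀ u → lookup E u ⊆ lookup E′ u)

_⊑?_ : ∀ {n} → Decidable (_⊑_ {n})
(V , E) ⊑? (V′ , E′) = (V ⊆? V′) ×-dec Fin.all? (λ u → lookup E u ⊆? lookup E′ u)

edgeCount : ∀ {n} → Sub n → ℕ
edgeCount {n} (V , E) =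
  length (filter (λ (u , v) → (u Fin.<? v) ×-dec adj? E u v)
                 (cartesianProduct (allFin n) (allFin n)))

vecs : ∀ {A : Set} → List A → ∀ n → List (Vec A n)
vecs xs zero    = [] ∷ []
vecs xs (suc n) = cartesianProductWith _∷_ xs (vecs xs n)

allSubs : ∀ n → List (Sub n)
allSubs n = cartesianProduct subsets (vecs subsets n)
  where subsets = vecs (true ∷ false ∷ []) n

∈-vecs : ∀ {A : Set} {xs : List A} → (∀ x → x List.∈ xs) →
         ∀ {n} (ys : Vec A n) → ys List.∈ vecs xs n
∈-vecs all []       = here refl
∈-vecs all (y ∷ ys) = ∈-cartesianProductWith⁺ _∷_ (all y) (∈-vecs all ys)

∈-allSubs : ∀ {n} (S : Sub n) → S List.∈ allSubs n
∈-allSubs (V , E) = ∈-cartesianProduct⁺ (∈-subsets V) (∈-vecs ∈-subsets E)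
  where
  ∈-bools : ∀ b → b List.∈ (true ∷ false ∷ [])
  ∈-bools true  = here refl
  ∈-bools false = there (here refl)
  ∈-subsets : ∀ {n} (p : Subset n) → p List.∈ vecs (true ∷ false ∷ []) n
  ∈-subsets = ∈-vecs ∈-bools

allSubs? : ∀ {n} {P : Pred (Sub n) 0ℓ} → U.Decidable P → Dec (∀ S → P S)
allSubs? {n} P? =
  map′ (λ ps S → All.lookup ps (∈-allSubs S)) (λ p → All.universal p (allSubs n))
       (All.all? P? (allSubs n))

module _ {n : ℕ} (G : Graph n) where
  open Graph G

  IsSubgraph : Pred (Sub n) 0ℓ
  IsSubgraph (V , E) = ∀ u v → Adj E u v → Adj E v u × u ∈ V × u ~ v

  -- In a tree every connected subgraph is a tree.
  IsSubtree : Pred (Sub n) 0ℓ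
  IsSubtree (V , E) = IsSubgraph (V , E) × Nonempty V ×
    (∀ u v → u ∈ V → v ∈ V → Joined (Adj E) u v)

  isSubtree? : U.Decidable IsSubtree
  isSubtree? (V , E) =
    Fin.all? (λ u → Fin.all? λ v →
      adj? E u v →-dec (adj? E v u ×-dec ((u ∈? V) ×-dec (u ~? v))))
    ×-dec nonempty? V
    ×-dec Fin.all? (λ u → Fin.all? λ v →
      (u ∈? V) →-dec ((v ∈? V) →-dec joined? (adj? E) u v))

  HasPendant : Fin n → Pred (Sub n) 0ℓ
  HasPendant v (V , E) = IsSubtree (V , E) × v ∈ V × ∣ lookup E v ∣ ≡ 1

  hasPendant? : ∀ v → U.Decidable (HasPendant v)
  hasPendant? v (V , E) = isSubtree? (V , E) ×-dec ((v ∈? V) ×-dec (∣ lookup E v ∣ ≟ 1))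

  IsBranch : Fin n → Pred (Sub n) 0ℓ
  IsBranch v B = HasPendant v B × (∀ S → HasPendant v S → B ⊑ S → S ⊑ B)

  isBranch? : ∀ v → U.Decidable (IsBranch v)
  isBranch? v B = hasPendant? v B ×-dec
    allSubs? (λ S → hasPendant? v S →-dec ((B ⊑? S) →-dec (S ⊑? B)))

  -- The 0 is the value only when v has no branch, i.e. when n ≡ 1.
  weight : Fin n → ℕ
  weight v = max 0 (map edgeCount (filter (isBranch? v) (allSubs n)))

  subtreesThrough : Fin n → ℕ
  subtreesThrough v =
    length (filter (λ (V , E) → isSubtree? (V , E) ×-dec (v ∈? V)) (allSubs n))

  Centroid : Pred (Fin n) 0ℓ
  Centroid v = ∀ u → weight v ≤ weight u

  SubtreeCore : Pred (Fin n) 0ℓ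
  SubtreeCore v = ∀ u → subtreesThrough u ≤ subtreesThrough v

  centroid? : U.Decidable Centroid
  centroid? v = Fin.all? λ u → weight v ≤? weight u

  subtreeCore? : U.Decidable SubtreeCore
  subtreeCore? v = Fin.all? λ u → subtreesThrough u ≤? subtreesThrough v

  private
    someVertex : ∀ {m} → NonZero m → Fin m
    someVertex {suc m} _ = zero

  centroid-nonempty : ∃ Centroid
  centroid-nonempty = argmin weight v₀ (allFin n) ,
    λ u → All.lookup (f[argmin]≤f[xs] v₀ (allFin n)) (∈-allFin u)
    where v₀ = someVertex nonZero

  subtreeCore-nonempty : ∃ SubtreeCore
  subtreeCore-nonempty = argmax subtreesThrough v₀ (allFin n) ,
    λ u → All.lookup (f[xs]≤f[argmax] v₀ (allFin n)) (∈-allFin u)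
    where v₀ = someVertex nonZero

  centroidCoreDist : ℕ
  centroidCoreDist = setDist centroid? subtreeCore? centroid-nonempty subtreeCore-nonempty

module _ {n : ℕ} (G : Graph n) (root : Fin n) where
  open Graph G

  IsRootedBinaryTree : Set
  IsRootedBinaryTree = IsTree ×
    (n ≡ 1 ⊎ (degree root ≡ 2 × (∀ v → v ≢ root → degree v ≡ 1 ⊎ degree v ≡ 3)))

  height : Fin n → ℕ
  height v = dist root v

  Level : ℕ → Set
  Level h = Σ[ v ∈ Fin n ] height v ≡ h

  IsParentOf : Rel (Fin n) 0ℓ
  IsParentOf u v = u ~ v × height v ≡ suc (height u)

  -- Only comparisons between vertices of the same level ≥ 1 matter.
  IsOrdering : Rel (Fin n) 0ℓ → Set
  IsOrdering _≺_ =
    (∀ h → 1 ≤ h → IsStrictTotalOrder {A = Level h} (_≡_ on proj₁) (_≺_ on proj₁)) ×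
    (∀ {u w x y} → 1 ≤ height u → height u ≡ height w → u ≢ w →
      IsParentOf u x → IsParentOf w y → (u ≺ w) ⇔ (x ≺ y))

  TopPendant : Pred (Fin n) 0ℓ
  TopPendant v = Pendant v × (∀ u → height u ≤ height v)

  ParentOfTopPendant : Pred (Fin n) 0ℓ
  ParentOfTopPendant u = ∃[ v ] (TopPendant v × IsParentOf u v)

  IsRGood : Set₁
  IsRGood = IsRootedBinaryTree ×
    (∀ u v → Pendant u → Pendant v → height u ≤ suc (height v)) ×
    (Σ[ _≺_ ∈ Rel (Fin n) 0ℓ ] (IsOrdering _≺_ ×
      (∀ u w → ParentOfTopPendant u → height u ≡ height w → u ≺ w → ParentOfTopPendant w)))

-- T arises, up to isomorphism, from the disjoint union of A and B by
-- identifying a with b.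
record IsIdentification {m k n : ℕ} (A : Graph m) (a : Fin m) (B : Graph k) (b : Fin k)
                        (T : Graph n) : Set where
  private
    module A = Graph A
    module B = Graph B
    module T = Graph T
  field
    ι           : Fin m → Fin n
    κ           : Fin k → Fin n
    ι-injective : Injective _≡_ _≡_ ι
    κ-injective : Injective _≡_ _≡_ κ
    covers      : ∀ x → (∃[ u ] ι u ≡ x) ⊎ (∃[ v ] κ v ≡ x)
    glued       : ∀ u v → (ι u ≡ κ v) ⇔ (u ≡ a × v ≡ b)
    adjacency   : ∀ x y → (x T.~ y) ⇔
                    ((∃₂ λ u v → ι u ≡ x × ι v ≡ y × u A.~ v) ⊎
                     (∃₂ λ u v → κ u ≡ x × κ v ≡ y × u B.~ v))

IsCrgWith : ∀ {n} → ℕ → Graph n → Set₁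
IsCrgWith {n} l T =
  2 ∣ n × 4 ≤ n × 2 ∤ l × 3 ≤ l × l < n ×
  (Σ[ R ∈ Graph l ] Σ[ r ∈ Fin l ] Σ[ C ∈ Graph (suc (n ∸ l)) ] Σ[ c ∈ Fin (suc (n ∸ l)) ]
    (IsRGood R r × Graph.IsBinaryCaterpillar C × Graph.MaxEccentricity C c ×
     IsIdentification R r C c T))

IsCrg : ∀ {n} → Graph n → Set₁
IsCrg T = ∃[ l ] IsCrgWith l T

-- For adjacent x and y, comparing the numbers of subtrees through x and through y amounts to
-- comparing the numbers a and b of root-containing subtrees of the two sides of the edge xy,
-- since they are a (1 + b) and b (1 + a); comparing weights amounts to comparing the orders of
-- the sides.  Let x₀ … x_d be a shortest walk from the centroid to the subtree core, and let A and
-- B be the sides of x_d and x_{d-1} of its last edge.  Then a > b, and because each vertex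
-- between x₀ and x_d has a further branch, the side of x₁ of the first edge has at least
-- |A| + 2 (d - 1) vertices, fewer than half of all.  Now take the crg tree with l = |A|.  An rgood
-- tree has the most, and a caterpillar rooted at an end the fewest, root-containing subtrees
-- among the rooted binary trees of its order, so the core of the crg tree lies in its rgood part;
-- and its first d - 1 spine vertices are on the lighter side, so the centroid is at distance at least d
-- from that part.
--
-- Counting the empty subtree as well, the root-containing subtrees satisfy g (leaf) = 2 and
-- g (node s t) = 1 + g (s) g (t).  Maximality of the rgood trees is proved for the values themselves:
-- if the values of the grandchildren are rearranged so that the large ones come together
-- or the largest moves up, the product for two rgood trees does not decrease, and this leads to
-- the two children of the rgood tree with the total number of pendant vertices.
module Submission where

open import Defs
open import Level using (0ℓ)
open import Data.Bool using (true; false)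
open import Data.Empty using (⊥)
open import Data.Nat using (ℕ; zero; suc; pred; _+_; _*_; _∸_; _^_; _⊓_; ⌊_/2⌋; _≤_; _<_; z≤n; s≤s; z<s; _≟_; _≤?_; _<?_; >-nonZero)
open import Data.Nat.Properties hiding (_≟_; _≤?_; _<?_)
open import Data.Nat.Divisibility using (_∣_; _∤_; divides)
open import Data.Nat.Induction using (<-rec)
open import Data.Nat.Tactic.RingSolver using (solve-∀)
open import Data.Fin using (Fin; zero; suc; inject₁; fromℕ; fromℕ<; toℕ)
import Data.Fin as Fin
import Data.Fin.Properties as Fin
open import Data.Fin.Properties using (toℕ-fromℕ<; toℕ-injective; toℕ-inject₁; toℕ<n)
open import Data.Fin.Relation.Unary.Top using (View; view; ‵fromℕ; ‵inj₁)
open import Data.Fin.Subset using (Subset; _∪_; ⁅_⁆; ∣_∣) renaming (_∈_ to _∈ˢ_; _⊆_ to _⊆ˢ_; ⊥ to ∅)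
open import Data.Fin.Subset.Properties
  using (∉⊥; x∈⁅x⁆; x∈⁅y⁆⇒x≡y; ⊆-antisym; x∈p∪q⁻; x∈p∪q⁺; nonempty?; Empty-unique; ∣⊥∣≡0; ∣⁅x⁆∣≡1; p⊂q⇒∣p∣<∣q∣)
  renaming (_∈?_ to _∈ˢ?_)
open import Data.Vec as Vec using (tabulate; lookup)
open import Data.Vec.Properties using (lookup∘tabulate; tabulate∘lookup; tabulate-cong; lookup⇒[]=; []=⇒lookup; ∷-injective)
open import Data.List using (List; []; _∷_; _++_; length; filter; allFin; map; cartesianProduct; cartesianProductWith)
open import Data.List.Properties using (length-++; length-map; length-tabulate; map-++)
open import Data.List.Extrema ≤-totalOrder using (argmax; f[xs]≤f[argmax]; max≤v⁺; v≤max⁺)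
open import Data.List.Membership.Propositional using (_∈_; _∉_)
open import Data.List.Membership.DecPropositional using () renaming (_∈?_ to member?)
open import Data.List.Membership.Propositional.Properties
  using (∈-∃++; ∈-++⁺ˡ; ∈-++⁺ʳ; ∈-++⁻; ∈-filter⁺; ∈-filter⁻; ∈-allFin; ∈-map⁺; ∈-map⁻;
         ∈-cartesianProduct⁺; ∈-cartesianProductWith⁺; ∈-cartesianProductWith⁻)
open import Data.List.Relation.Unary.Any as Any using (here; there)
open import Data.List.Relation.Unary.All as All using ([]; _∷_)
open import Data.List.Relation.Unary.All.Properties using (¬Any⇒All¬)
open import Data.List.Relation.Unary.AllPairs using ([]; _∷_)
open import Data.List.Relation.Unary.Linked as Linked using (Linked; [-]; _∷_)
open import Data.List.Relation.Unary.Unique.Propositional using (Unique)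
open import Data.List.Relation.Unary.Unique.Propositional.Properties
  using (Unique[x∷xs]⇒x∉xs; map⁺; map⁻; ++⁺; filter⁺; allFin⁺; cartesianProduct⁺; cartesianProductWith⁺)
open import Data.Product using (Σ; Σ-syntax; ∃; ∃₂; _×_; _,_; proj₁; proj₂)
open import Data.Sum as Sum using (_⊎_; inj₁; inj₂; [_,_]′; swap)
open import Function using (_∘_; id; mk⇔)
open import Relation.Binary using (Rel; Symmetric; tri<; tri≈; tri>) renaming (Decidable to Decidable₂)
import Relation.Binary.Construct.Flip.EqAndOrd as Flip
import Relation.Binary.Construct.On as On
open import Relation.Binary.PropositionalEquality
open import Relation.Nullary using (¬_; Dec; does; yes; no; contradiction)
open import Relation.Nullary.Decidable using (_×-dec_; _⊎-dec_; ¬?; dec-true)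
open import Relation.Unary using (Pred; Decidable)

-- Binary trees with extremal numbers of root-containing subtrees

-- The distance in a crg tree is never computed: a lower bound for one candidate per binary tree is
-- enough, because the best of the finitely many candidates is then optimal. The main obstacle is
-- the maximality of the rgood trees. Their shape depends on the binary form b = 2 ^ h + r of the
-- number b of pendant vertices, and adding two such numbers produces carries. The argument
-- therefore works with the values `full h r` and separates three regimes: equal base heights
-- (`full-merge`), heights one apart (`merge-adjacent`), and a smaller tree that is dominated by the
-- children of the larger one (`merge-distant`). Only the last needs an induction on the total
-- number of pendant vertices. A power of two has two representations, which `full-unique` makes
-- interchangeable. The other obstacle is that weights and subtree counts are defined by enumerating
-- vertex sets with adjacency matrices. `Branch` assigns a `BinTree` to each side of an edge; once
-- the enumerations are evaluated, only `size` and `rootSubs` matter.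

data BinTree : Set where
  leaf : BinTree
  node : BinTree → BinTree → BinTree

size : BinTree → ℕ
size leaf       = 1
size (node l r) = suc (size l + size r)

inner : BinTree → ℕ
inner leaf       = 0
inner (node l r) = suc (inner l + inner r)

-- The number of subtrees containing the root, the empty one included.
rootSubs : BinTree → ℕ
rootSubs leaf       = 2
rootSubs (node l r) = suc (rootSubs l * rootSubs r)

size≡ : ∀ t → size t ≡ suc (inner t + inner t)
size≡ leaf       = refl
size≡ (node l r) rewrite size≡ l | size≡ r = lemma (inner l) (inner r)
  where
  lemma : ∀ a b → 1 + (1 + (a + a) + (1 + (b + b))) ≡ 1 + (1 + (a + b) + (1 + (a + b)))
  lemma = solve-∀

double-injective : ∀ {a b} → a + a ≡ b + b → a ≡ b
double-injective {a} {b} e = *-cancelˡ-≡ a b 2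
  (trans (cong (a +_) (+-identityʳ a)) (trans e (cong (b +_) (sym (+-identityʳ b)))))

2≤rootSubs : ∀ t → 2 ≤ rootSubs t
2≤rootSubs leaf       = ≤-refl
2≤rootSubs (node l r) = s≤s (*-mono-≤ (≤-trans (s≤s z≤n) (2≤rootSubs l)) (≤-trans (s≤s z≤n) (2≤rootSubs r)))

rootSubs-left : ∀ l r → rootSubs l < rootSubs (node l r)
rootSubs-left l r = s≤s (m≤m*n (rootSubs l) (rootSubs r) {{>-nonZero (≤-trans (s≤s z≤n) (2≤rootSubs r))}})

rootSubs-right : ∀ l r → rootSubs r < rootSubs (node l r)
rootSubs-right l r = s≤s (m≤n*m (rootSubs r) (rootSubs l) {{>-nonZero (≤-trans (s≤s z≤n) (2≤rootSubs l))}})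

cat : ℕ → BinTree
cat zero    = leaf
cat (suc j) = node leaf (cat j)

size-cat : ∀ j → size (cat j) ≡ suc (j + j)
size-cat zero    = refl
size-cat (suc j) rewrite size-cat j | +-suc j j = refl

-- The factor 2 in `merge` is the leaf child of the new root. Spine vertices move one at a time to
-- the other caterpillar: in (1 + 2 x) y = y + 2 x y the summand y, being at least 2, pays for the
-- vertex moved.
cat-minimal : ∀ t → rootSubs (cat (inner t)) ≤ rootSubs t
cat-minimal leaf       = ≤-refl
cat-minimal (node l r) = s≤s (≤-trans (merge (inner l) (inner r)) (*-mono-≤ (cat-minimal l) (cat-minimal r)))
  where
  open ≤-Reasoning
  regroup : ∀ x y → 2 * (1 + 2 * x) + y ≡ 2 + 2 * (2 * x) + y
  regroup = solve-∀
  merge : ∀ a b → 2 * rootSubs (cat (a + b)) ≤ rootSubs (cat a) * rootSubs (cat b)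
  merge zero    b = ≤-refl
  merge (suc a) b = begin
    2 * (1 + 2 * rootSubs (cat (a + b)))             ≡⟨ *-distribˡ-+ 2 1 (2 * rootSubs (cat (a + b))) ⟩
    2 + 2 * (2 * rootSubs (cat (a + b)))             ≤⟨ +-mono-≤ (2≤rootSubs (cat b)) (*-monoʳ-≤ 2 (merge a b)) ⟩
    rootSubs (cat b) + 2 * (rootSubs (cat a) * rootSubs (cat b)) ≡⟨ cong (rootSubs (cat b) +_) (sym (*-assoc 2 (rootSubs (cat a)) (rootSubs (cat b)))) ⟩
    (1 + 2 * rootSubs (cat a)) * rootSubs (cat b)    ∎

-- The root subtree count of the rgood tree with 2 ^ h + r pendant vertices,
-- 0 ≤ r ≤ 2 ^ h; the pendant vertices at height h + 1 fill one child first.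
full : ℕ → ℕ → ℕ
full zero    zero    = 2
full zero    (suc _) = 5
full (suc h) r       = suc (full h (r ⊓ 2 ^ h) * full h (r ∸ 2 ^ h))

2^suc : ∀ h → 2 ^ suc h ≡ 2 ^ h + 2 ^ h
2^suc h = cong (2 ^ h +_) (+-identityʳ (2 ^ h))

≤-double : ∀ h {r} → r ≤ 2 ^ h → r ≤ 2 ^ suc h
≤-double h r≤ = ≤-trans r≤ (^-monoʳ-≤ 2 (n≤1+n h))

0<2^ : ∀ h → 0 < 2 ^ h
0<2^ h = m^n>0 2 h

full-low : ∀ h {r} → r ≤ 2 ^ h → full (suc h) r ≡ suc (full h r * full h 0)
full-low h {r} r≤ rewrite m≤n⇒m⊓n≡m r≤ | m≤n⇒m∸n≡0 r≤ = refl

full-high : ∀ h r → full (suc h) (2 ^ h + r) ≡ suc (full h (2 ^ h) * full h r)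
full-high h r rewrite m≥n⇒m⊓n≡n (m≤m+n (2 ^ h) r) | m+n∸m≡n (2 ^ h) r = refl

-- Both sides describe the perfect tree with 2 ^ (h + 1) pendant vertices: a completed last level
-- may be counted as the base level of the next height.
full-carry : ∀ h → full h (2 ^ h) ≡ full (suc h) 0
full-carry zero    = refl
full-carry (suc h) = begin
  full (suc h) (2 ^ suc h)       ≡⟨ cong (full (suc h)) (2^suc h) ⟩
  full (suc h) (2 ^ h + 2 ^ h)   ≡⟨ full-high h (2 ^ h) ⟩
  suc (full h (2 ^ h) * full h (2 ^ h)) ≡⟨ cong (λ x → suc (x * x)) (full-carry h) ⟩
  suc (full (suc h) 0 * full (suc h) 0) ≡⟨ sym (full-low (suc h) z≤n) ⟩
  full (suc (suc h)) 0           ∎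
  where open ≡-Reasoning

full-mono : ∀ h {r s} → r ≤ s → full h r ≤ full h s
full-mono zero    {zero}  {zero}  _ = ≤-refl
full-mono zero    {zero}  {suc _} _ = s≤s (s≤s z≤n)
full-mono zero    {suc _} {suc _} _ = ≤-refl
full-mono (suc h) r≤s = s≤s (*-mono-≤ (full-mono h (⊓-monoˡ-≤ (2 ^ h) r≤s)) (full-mono h (∸-monoˡ-≤ (2 ^ h) r≤s)))

0<full : ∀ h r → 0 < full h r
0<full zero    zero    = s≤s z≤n
0<full zero    (suc r) = s≤s z≤n
0<full (suc h) r       = s≤s z≤n

-- If x y ≤ x′ y′ with x, y ≤ x′ then x + y ≤ x′ + y′, because
-- x′ (x′ + y′) − x′ (x + y) ≥ (x′ − x) (x′ − y).
sum-≤ : ∀ {x y x′ y′} → 0 < x′ → x ≤ x′ → y ≤ x′ → x * y ≤ x′ * y′ → x + y ≤ x′ + y′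
sum-≤ {x} {y} {x′} {y′} 0<x′ x≤ y≤ xy≤ with m≤n⇒∃[o]m+o≡n x≤ | m≤n⇒∃[o]m+o≡n y≤
... | a , x+a≡ | b , y+b≡ = *-cancelˡ-≤ x′ {{>-nonZero 0<x′}} (begin
  x′ * (x + y)            ≡⟨ expand ⟩
  x * (y + b) + (x + a) * y ≤⟨ m≤m+n _ (a * b) ⟩
  x * (y + b) + (x + a) * y + a * b ≡⟨ ring x y a b ⟩
  (x + a) * (y + b) + x * y ≡⟨ cong₂ (λ p q → p * q + x * y) x+a≡ y+b≡ ⟩
  x′ * x′ + x * y         ≤⟨ +-monoʳ-≤ (x′ * x′) xy≤ ⟩
  x′ * x′ + x′ * y′       ≡⟨ sym (*-distribˡ-+ x′ x′ y′) ⟩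
  x′ * (x′ + y′)          ∎)
  where
  open ≤-Reasoning
  ring : ∀ x y a b → x * (y + b) + (x + a) * y + a * b ≡ (x + a) * (y + b) + x * y
  ring = solve-∀
  expand : x′ * (x + y) ≡ x * (y + b) + (x + a) * y
  expand = trans (*-distribˡ-+ x′ x y)
    (cong₂ _+_ (trans (*-comm x′ x) (cong (x *_) (sym y+b≡))) (cong (_* y) (sym x+a≡)))

-- The factors are two siblings, one with children of values x and y, the other of value z.
-- Exchanging y with its uncle z changes the product by exactly y - z.
uncle : ∀ x {y z} → z ≤ y → suc (x * y) * z ≤ suc (x * z) * y
uncle x {y} {z} z≤y = begin
  z + x * y * z   ≤⟨ +-monoˡ-≤ _ z≤y ⟩
  y + x * y * z   ≡⟨ ring x y z ⟩
  y + x * z * y   ∎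
  where
  open ≤-Reasoning
  ring : ∀ x y z → y + x * y * z ≡ y + x * z * y
  ring = solve-∀

-- Each of two siblings has a child of the smallest value p; bringing these two together gains
-- exactly (s - p) (t - p).
cousins-low : ∀ {p s t} → p ≤ s → p ≤ t → suc (s * p) * suc (t * p) ≤ suc (p * p) * suc (s * t)
cousins-low {p} p≤s p≤t with m≤n⇒∃[o]m+o≡n p≤s | m≤n⇒∃[o]m+o≡n p≤t
... | a , refl | b , refl = begin
  suc ((p + a) * p) * suc ((p + b) * p)         ≤⟨ m≤m+n _ (a * b) ⟩
  suc ((p + a) * p) * suc ((p + b) * p) + a * b ≡⟨ ring p a b ⟩
  suc (p * p) * suc ((p + a) * (p + b))         ∎
  where
  open ≤-Reasoning
  ring : ∀ p a b → (1 + (p + a) * p) * (1 + (p + b) * p) + a * b ≡ (1 + p * p) * (1 + (p + a) * (p + b))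
  ring = solve-∀

-- The mirror image of `cousins-low`, with p the largest value and gain (p - s) (p - t).
cousins-high : ∀ {p s t} → s ≤ p → t ≤ p → suc (p * s) * suc (p * t) ≤ suc (p * p) * suc (s * t)
cousins-high {p} {s} {t} s≤p t≤p with m≤n⇒∃[o]m+o≡n s≤p | m≤n⇒∃[o]m+o≡n t≤p
... | a , s+a≡p | b , t+b≡p = begin
  suc (p * s) * suc (p * t)                                  ≡⟨ ring₁ p s t ⟩
  1 + p * p * (s * t) + (p * t + p * s)                      ≡⟨ cong (1 + p * p * (s * t) +_) (cong₂ (λ q q′ → q * t + q′ * s) (sym s+a≡p) (sym t+b≡p)) ⟩
  1 + p * p * (s * t) + ((s + a) * t + (t + b) * s)          ≤⟨ +-monoʳ-≤ (1 + p * p * (s * t)) (m≤m+n _ (a * b)) ⟩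
  1 + p * p * (s * t) + ((s + a) * t + (t + b) * s + a * b)  ≡⟨ cong (1 + p * p * (s * t) +_) (ring₂ s t a b) ⟩
  1 + p * p * (s * t) + ((s + a) * (t + b) + s * t)          ≡⟨ cong (1 + p * p * (s * t) +_) (cong₂ (λ q q′ → q * q′ + s * t) s+a≡p t+b≡p) ⟩
  1 + p * p * (s * t) + (p * p + s * t)                      ≡⟨ ring₃ p s t ⟩
  suc (p * p) * suc (s * t)                                  ∎
  where
  open ≤-Reasoning
  ring₁ : ∀ p s t → (1 + p * s) * (1 + p * t) ≡ 1 + p * p * (s * t) + (p * t + p * s)
  ring₁ = solve-∀
  ring₂ : ∀ s t a b → (s + a) * t + (t + b) * s + a * b ≡ (s + a) * (t + b) + s * t
  ring₂ = solve-∀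
  ring₃ : ∀ p s t → 1 + p * p * (s * t) + (p * p + s * t) ≡ (1 + p * p) * (1 + s * t)
  ring₃ = solve-∀

-- With q = p + d the product is increasing in x y, in x + y and in x; `sum-≤` takes care of the
-- sum. The dominant value x′ is placed beside the larger cousin q.
cousins-mixed : ∀ {p q x y x′ y′} → p ≤ q → 0 < x′ → x ≤ x′ → y ≤ x′ → x * y ≤ x′ * y′ →
                suc (q * x) * suc (y * p) ≤ suc (q * x′) * suc (y′ * p)
cousins-mixed {p} {x = x} {y} {x′} {y′} p≤q 0<x′ x≤ y≤ xy≤ with m≤n⇒∃[o]m+o≡n p≤q
... | d , refl = begin
  suc ((p + d) * x) * suc (y * p)                          ≡⟨ ring p d x y ⟩
  1 + (p + d) * p * (x * y) + (p * (x + y) + d * x)        ≤⟨ s≤s (+-mono-≤ (*-monoʳ-≤ ((p + d) * p) xy≤) (+-mono-≤ (*-monoʳ-≤ p (sum-≤ 0<x′ x≤ y≤ xy≤)) (*-monoʳ-≤ d x≤))) ⟩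
  1 + (p + d) * p * (x′ * y′) + (p * (x′ + y′) + d * x′)   ≡⟨ sym (ring p d x′ y′) ⟩
  suc ((p + d) * x′) * suc (y′ * p)                        ∎
  where
  open ≤-Reasoning
  ring : ∀ p d x y → (1 + (p + d) * x) * (1 + y * p) ≡ 1 + (p + d) * p * (x * y) + (p * (x + y) + d * x)
  ring = solve-∀

-- Expanded, the product is y + p (x y), so it grows with the product x y and with the value y on
-- the upper place.
promote : ∀ x {y} x′ {y′} p → x * y ≤ x′ * y′ → y ≤ y′ → suc (x * p) * y ≤ suc (x′ * p) * y′
promote x {y} x′ {y′} p xy≤ y≤ = begin
  y + x * p * y       ≡⟨ ring x y p ⟩
  y + p * (x * y)     ≤⟨ +-mono-≤ y≤ (*-monoʳ-≤ p xy≤) ⟩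
  y′ + p * (x′ * y′)  ≡⟨ sym (ring x′ y′ p) ⟩
  y′ + x′ * p * y′    ∎
  where
  open ≤-Reasoning
  ring : ∀ x y p → y + x * p * y ≡ y + p * (x * y)
  ring = solve-∀

-- Over base height h + 1, the deepest level either stays below the first child or fills its 2 ^ h
-- places and leaves s for the second child. The cases overlap at r = 2 ^ h.
data Split (h r : ℕ) : Set where
  low  : r ≤ 2 ^ h → Split h r
  high : ∀ s → s ≤ 2 ^ h → r ≡ 2 ^ h + s → Split h r

split : ∀ h {r} → r ≤ 2 ^ suc h → Split h r
split h {r} r≤ with r ≤? 2 ^ h
... | yes r≤q = low r≤q
... | no  r≰q = high (r ∸ 2 ^ h)
  (m≤n+o⇒m∸n≤o r (2 ^ h) (≤-trans r≤ (≤-reflexive (2^suc h))))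
  (sym (m+[n∸m]≡n (<⇒≤ (≰⇒> r≰q))))

2^-double : ∀ h {s t} → s ≤ 2 ^ h → t ≤ 2 ^ h → s + t ≤ 2 ^ suc h
2^-double h s≤ t≤ = ≤-trans (+-mono-≤ s≤ t≤) (≤-reflexive (sym (2^suc h)))

-- Strictness absorbs the `suc` in `full`, so this is really a comparison of two products, as
-- `balance` states. The four grandchildren are rearranged: the perfect ones of equal height come
-- together, or, in `high-low`, stay in place, and the two partial ones are merged by induction on
-- h.
full-merge : ∀ h {s t} → s ≤ 2 ^ h → t ≤ 2 ^ h → full h s * full h t < full (suc h) (s + t)

private
  balance : ∀ h {s t} → s ≤ 2 ^ h → t ≤ 2 ^ h →
            full h s * full h t ≤ full h ((s + t) ⊓ 2 ^ h) * full h ((s + t) ∸ 2 ^ h)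
  balance h s≤ t≤ = ≤-pred (full-merge h s≤ t≤)

  high-low : ∀ h {s t} → s ≤ 2 ^ h → t ≤ 2 ^ h →
             full (suc h) (2 ^ h + s) * full (suc h) t < full (suc (suc h)) (2 ^ h + s + t)
  high-low h {s} {t} s≤ t≤ = s≤s (begin
    full (suc h) (2 ^ h + s) * full (suc h) t
      ≡⟨ cong₂ _*_ (full-high h s) (full-low h t≤) ⟩
    suc (full h q * full h s) * suc (full h t * full h 0)
      ≤⟨ cousins-mixed {full h 0} {full h q} {full h s} {full h t} {full h u} {full h v}
           (full-mono h z≤n) (0<full h u) (full-mono h s≤u) (full-mono h t≤u) (balance h s≤ t≤) ⟩
    suc (full h q * full h u) * suc (full h v * full h 0)
      ≡⟨ cong₂ _*_ (sym (full-high h u)) (sym (full-low h v≤)) ⟩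
    full (suc h) (q + u) * full (suc h) v
      ≡⟨ cong₂ (λ a b → full (suc h) a * full (suc h) b) left right ⟩
    full (suc h) ((q + s + t) ⊓ 2 ^ suc h) * full (suc h) ((q + s + t) ∸ 2 ^ suc h) ∎)
    where
    open ≤-Reasoning
    q = 2 ^ h
    u = (s + t) ⊓ q
    v = (s + t) ∸ q
    s≤u : s ≤ u
    s≤u = ⊓-glb (m≤m+n s t) s≤
    t≤u : t ≤ u
    t≤u = ⊓-glb (m≤n+m t s) t≤
    v≤ : v ≤ q
    v≤ = m≤n+o⇒m∸n≤o (s + t) q (+-mono-≤ s≤ t≤)
    left : q + u ≡ (q + s + t) ⊓ 2 ^ suc h
    left = trans (+-distribˡ-⊓ q (s + t) q) (cong₂ _⊓_ (sym (+-assoc q s t)) (sym (2^suc h)))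
    right : v ≡ (q + s + t) ∸ 2 ^ suc h
    right = trans (sym ([m+n]∸[m+o]≡n∸o q (s + t) q)) (cong₂ _∸_ (sym (+-assoc q s t)) (sym (2^suc h)))

full-merge zero {zero}        {zero}        _ _ = ≤-refl
full-merge zero {zero}        {suc zero}    _ _ = ≤-refl
full-merge zero {suc zero}    {zero}        _ _ = ≤-refl
full-merge zero {suc zero}    {suc zero}    _ _ = ≤-refl
full-merge zero {suc (suc _)} (s≤s ()) _
full-merge zero {_} {suc (suc _)} _ (s≤s ())
full-merge (suc h) {s} {t} s≤ t≤ with split h s≤ | split h t≤
... | low s≤q | low t≤q = s≤s (begin
  full (suc h) s * full (suc h) t
    ≡⟨ cong₂ _*_ (full-low h s≤q) (full-low h t≤q) ⟩
  suc (full h s * full h 0) * suc (full h t * full h 0)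
    ≤⟨ cousins-low (full-mono h z≤n) (full-mono h z≤n) ⟩
  suc (full h 0 * full h 0) * suc (full h s * full h t)
    ≤⟨ *-mono-≤ (≤-reflexive (sym (full-low h z≤n))) (full-merge h s≤q t≤q) ⟩
  full (suc h) 0 * full (suc h) (s + t)
    ≡⟨ *-comm (full (suc h) 0) _ ⟩
  full (suc h) (s + t) * full (suc h) 0
    ≡⟨ cong pred (sym (full-low (suc h) (2^-double h s≤q t≤q))) ⟩
  full (suc h) ((s + t) ⊓ 2 ^ suc h) * full (suc h) ((s + t) ∸ 2 ^ suc h) ∎)
  where
  open ≤-Reasoning
... | high s′ s′≤ refl | low t≤q = high-low h s′≤ t≤q
... | low s≤q | high t′ t′≤ refl =
  subst₂ _<_ (*-comm (full (suc h) t) (full (suc h) s)) (cong (full (suc (suc h))) (+-comm t s)) (high-low h t′≤ s≤q)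
... | high s′ s′≤ refl | high t′ t′≤ refl = begin-strict
  full (suc h) (q + s′) * full (suc h) (q + t′)
    ≡⟨ cong₂ _*_ (full-high h s′) (full-high h t′) ⟩
  suc (full h q * full h s′) * suc (full h q * full h t′)
    ≤⟨ cousins-high (full-mono h s′≤) (full-mono h t′≤) ⟩
  suc (full h q * full h q) * suc (full h s′ * full h t′)
    ≤⟨ *-mono-≤ (≤-reflexive (trans (sym (full-high h q)) (cong (full (suc h)) (sym (2^suc h))))) (full-merge h s′≤ t′≤) ⟩
  full (suc h) (2 ^ suc h) * full (suc h) (s′ + t′)
    <⟨ n<1+n _ ⟩
  suc (full (suc h) (2 ^ suc h) * full (suc h) (s′ + t′))
    ≡⟨ sym (full-high (suc h) (s′ + t′)) ⟩
  full (suc (suc h)) (2 ^ suc h + (s′ + t′))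
    ≡⟨ cong (full (suc (suc h))) (trans (cong (_+ (s′ + t′)) (2^suc h)) (ring q s′ t′)) ⟩
  full (suc (suc h)) (q + s′ + (q + t′)) ∎
  where
  open ≤-Reasoning
  q = 2 ^ h
  ring : ∀ q a b → q + q + (a + b) ≡ q + a + (q + b)
  ring = solve-∀

private
  -- From r ≤ 2 ^ h the total is at most 2 ^ (h + 1). A second representation of greater height thus
  -- has height exactly h + 1 and no rest, which is the case of `full-carry`.
  carry : ∀ h h′ {r r′} → r ≤ 2 ^ h → h < h′ → 2 ^ h + r ≡ 2 ^ h′ + r′ → full h r ≡ full h′ r′
  carry h h′ {r} {r′} r≤ h<h′ e with m≤n⇒m<n∨m≡n h<h′
  ... | inj₁ 1+h<h′ = contradiction (≤-trans (^-monoʳ-< 2 (s≤s (s≤s z≤n)) 1+h<h′)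
          (≤-trans (m≤m+n (2 ^ h′) r′) (≤-trans (≤-reflexive (sym e)) (2^-double h ≤-refl r≤)))) (<-irrefl refl)
  ... | inj₂ refl = trans (cong (full h) r≡) (trans (full-carry h) (cong (full (suc h)) (sym r′≡0)))
    where
    r≡q+r′ : r ≡ 2 ^ h + r′
    r≡q+r′ = +-cancelˡ-≡ (2 ^ h) r (2 ^ h + r′)
      (trans e (trans (cong (_+ r′) (2^suc h)) (+-assoc (2 ^ h) (2 ^ h) r′)))
    r′≡0 : r′ ≡ 0
    r′≡0 = n≤0⇒n≡0 (+-cancelˡ-≤ (2 ^ h) r′ 0
      (≤-trans (≤-reflexive (sym r≡q+r′)) (≤-trans r≤ (≤-reflexive (sym (+-identityʳ (2 ^ h)))))))
    r≡ : r ≡ 2 ^ h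
    r≡ = trans r≡q+r′ (trans (cong (2 ^ h +_) r′≡0) (+-identityʳ (2 ^ h)))

-- The value belongs to the number of pendant vertices, not to its representation; each case below
-- may choose the representation that suits it.
full-unique : ∀ h h′ {r r′} → r ≤ 2 ^ h → r′ ≤ 2 ^ h′ → 2 ^ h + r ≡ 2 ^ h′ + r′ → full h r ≡ full h′ r′
full-unique h h′ {r} {r′} r≤ r′≤ e with <-cmp h h′
... | tri≈ _ refl _ = cong (full h) (+-cancelˡ-≡ (2 ^ h) r r′ e)
... | tri< h<h′ _ _ = carry h h′ r≤ h<h′ e
... | tri> _ _ h′<h = sym (carry h′ h r′≤ h′<h (sym e))

leading-bit : ∀ m → ∃₂ λ h r → r < 2 ^ h × suc m ≡ 2 ^ h + r
leading-bit zero = 0 , 0 , s≤s z≤n , refl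
leading-bit (suc m) with leading-bit m
... | h , r , r< , e with m≤n⇒m<n∨m≡n r<
...   | inj₁ 1+r< = h , suc r , 1+r< , trans (cong suc e) (sym (+-suc (2 ^ h) r))
...   | inj₂ 1+r≡ = suc h , 0 , 0<2^ (suc h) ,
  trans (cong suc e) (trans (sym (+-suc (2 ^ h) r)) (trans (cong (2 ^ h +_) 1+r≡) (trans (sym (2^suc h)) (sym (+-identityʳ _)))))

full-0-mono : ∀ {h h′} → h ≤ h′ → full h 0 ≤ full h′ 0
full-0-mono {h} {h′} h≤ with m≤n⇒∃[o]m+o≡n h≤
... | d , refl = go h d
  where
  go : ∀ h d → full h 0 ≤ full (h + d) 0
  go h zero    = ≤-reflexive (cong (λ x → full x 0) (sym (+-identityʳ h)))
  go h (suc d) = ≤-trans (go h d) (≤-trans (full-mono (h + d) z≤n)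
    (≤-reflexive (trans (full-carry (h + d)) (cong (λ x → full x 0) (sym (+-suc h d))))))

-- If j < i, completing the last level gives the perfect tree of height j + 1 ≤ i; if j = i, then t
-- = 0.
full-≤ : ∀ j i {t} → t ≤ 2 ^ j → 2 ^ j + t ≤ 2 ^ i → full j t ≤ full i 0
full-≤ j i {t} t≤ b≤ with <-cmp j i
... | tri< j<i _ _ = ≤-trans (full-mono j t≤) (≤-trans (≤-reflexive (full-carry j)) (full-0-mono j<i))
... | tri≈ _ refl _ = full-mono j (+-cancelˡ-≤ (2 ^ j) t 0 (≤-trans b≤ (≤-reflexive (sym (+-identityʳ (2 ^ j))))))
... | tri> _ _ i<j = contradiction (≤-trans (^-monoʳ-< 2 (s≤s (s≤s z≤n)) i<j) (≤-trans (m≤m+n (2 ^ j) t) b≤)) (<-irrefl refl)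

-- Joining rgood trees of different base heights

module _ {h r : ℕ} (r≤ : r ≤ 2 ^ h) where

  retarget : ∀ {v} x y → y ≤ 2 ^ x → 2 ^ x + y ≡ 2 ^ h + r → v < full x y → v < full h r
  retarget x y y≤ e = subst (_ <_) (full-unique x h y≤ r≤ e)

  open ≤-Reasoning

  -- With q = 2 ^ i the total is 3 q + s + t, and three subtrees of base height i are to be
  -- arranged. If s ≥ q, the perfect grandchild changes places with the smaller tree by `uncle`.
  -- Otherwise `promote` redistributes s and t, and whether s + t exceeds q decides if the base
  -- height becomes i + 2 or stays at i + 1.
  merge-adjacent : ∀ i {s t} → s ≤ 2 ^ suc i → t ≤ 2 ^ i → (2 ^ suc i + s) + (2 ^ i + t) ≡ 2 ^ h + r →
                   full (suc i) s * full i t < full h r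
  merge-adjacent i {s} {t} s≤ t≤ e with split i s≤
  ... | high s′ s′≤ refl = retarget (2 + i) (s′ + t) (≤-double (suc i) (2^-double i s′≤ t≤))
      (trans (trans (cong (_+ (s′ + t)) (2^suc (suc i))) (trans (cong (λ x → x + x + (s′ + t)) (2^suc i))
        (trans (ring q s′ t) (cong (λ x → x + (q + s′) + (q + t)) (sym (2^suc i)))))) e) (begin-strict
    full (suc i) (q + s′) * full i t        ≡⟨ cong (_* full i t) (trans (full-high i s′) (cong suc (*-comm (full i q) _))) ⟩
    suc (full i s′ * full i q) * full i t   ≤⟨ uncle (full i s′) (full-mono i t≤) ⟩
    suc (full i s′ * full i t) * full i q   ≤⟨ *-mono-≤ (full-merge i s′≤ t≤) (≤-reflexive (full-carry i)) ⟩
    full (suc i) (s′ + t) * full (suc i) 0  <⟨ n<1+n _ ⟩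
    suc (full (suc i) (s′ + t) * full (suc i) 0) ≡⟨ sym (full-low (suc i) (2^-double i s′≤ t≤)) ⟩
    full (2 + i) (s′ + t)                   ∎)
    where
    q = 2 ^ i
    ring : ∀ q s t → q + q + (q + q) + (s + t) ≡ q + q + (q + s) + (q + t)
    ring = solve-∀
  ... | low s≤q with split i (2^-double i s≤q t≤)
  ...   | low st≤q = retarget (suc i) (q + (s + t)) (2^-double i ≤-refl st≤q)
      (trans (trans (cong (_+ (q + (s + t))) (2^suc i)) (trans (ring q s t) (cong (λ x → x + s + (q + t)) (sym (2^suc i))))) e) (begin-strict
    full (suc i) s * full i t               ≡⟨ cong (_* full i t) (full-low i s≤q) ⟩
    suc (full i s * full i 0) * full i t    ≤⟨ promote (full i s) (full i 0) (full i 0) st-merge (full-mono i (m≤n+m t s)) ⟩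
    suc (full i 0 * full i 0) * full i (s + t) ≡⟨ cong (_* full i (s + t)) (trans (sym (full-low i z≤n)) (sym (full-carry i))) ⟩
    full i q * full i (s + t)               <⟨ n<1+n _ ⟩
    suc (full i q * full i (s + t))         ≡⟨ sym (full-high i (s + t)) ⟩
    full (suc i) (q + (s + t))              ∎)
    where
    q = 2 ^ i
    st-merge : full i s * full i t ≤ full i 0 * full i (s + t)
    st-merge = ≤-trans (≤-pred (≤-trans (full-merge i s≤q t≤) (≤-reflexive (full-low i st≤q)))) (≤-reflexive (*-comm (full i (s + t)) _))
    ring : ∀ q s t → q + q + (q + (s + t)) ≡ q + q + s + (q + t)
    ring = solve-∀
  ...   | high w w≤ st≡ = retarget (2 + i) w (≤-double (suc i) (≤-double i w≤))
      (trans (trans (cong (_+ w) (2^suc (suc i))) (trans (cong (λ x → x + x + w) (2^suc i)) (trans (ring₁ q w)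
        (trans (cong (λ x → q + q + q + x) (sym st≡)) (trans (ring₂ q s t) (cong (λ x → x + s + (q + t)) (sym (2^suc i)))))))) e) (begin-strict
    full (suc i) s * full i t               ≡⟨ cong (_* full i t) (full-low i s≤q) ⟩
    suc (full i s * full i 0) * full i t    ≤⟨ promote (full i s) (full i w) (full i 0) st-merge (full-mono i t≤) ⟩
    suc (full i w * full i 0) * full i q    ≡⟨ cong₂ _*_ (sym (full-low i w≤)) (full-carry i) ⟩
    full (suc i) w * full (suc i) 0         <⟨ n<1+n _ ⟩
    suc (full (suc i) w * full (suc i) 0)   ≡⟨ sym (full-low (suc i) (≤-double i w≤)) ⟩
    full (2 + i) w                          ∎)
    where
    q = 2 ^ i
    st-merge : full i s * full i t ≤ full i w * full i q
    st-merge = ≤-trans (≤-pred (≤-trans (full-merge i s≤q t≤) (≤-reflexive (trans (cong (full (suc i)) st≡) (full-high i w)))))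
      (≤-reflexive (*-comm (full i q) (full i w)))
    ring₁ : ∀ q w → q + q + (q + q) + w ≡ q + q + q + (q + w)
    ring₁ = solve-∀
    ring₂ : ∀ q s t → q + q + q + (s + t) ≡ q + q + s + (q + t)
    ring₂ = solve-∀

-- All representations of the two sizes and of the total are allowed, because the parts met in the
-- induction need not come in normal form.
Merges : ℕ → Set
Merges k = ∀ i j h {s t r} → s ≤ 2 ^ i → t ≤ 2 ^ j → r ≤ 2 ^ h →
  (2 ^ i + s) + (2 ^ j + t) ≡ k → 2 ^ h + r ≡ k → full i s * full j t < full h r

module _ {h r : ℕ} (r≤ : r ≤ 2 ^ h) where

  open ≤-Reasoning

  -- The smaller tree has at most 2 ^ i pendant vertices, hence at most the value of either child of
  -- the larger one. By `uncle` it changes places with the child whose deepest level is filled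
  -- first. Its new sibling and it form a pair with fewer pendant vertices in all, to which the
  -- induction hypothesis applies; what remains is a join of base heights at most one apart.
  merge-distant : (∀ {k} → k < 2 ^ h + r → Merges k) →
                  ∀ i j {s t} → s ≤ 2 ^ suc i → t ≤ 2 ^ j → 2 ^ j + t ≤ 2 ^ i →
                  (2 ^ suc i + s) + (2 ^ j + t) ≡ 2 ^ h + r → full (suc i) s * full j t < full h r
  merge-distant rec i j {s} {t} s≤ t≤ b≤q e with split i s≤
  ... | low s≤q = retarget r≤ (suc i) (b + s) (2^-double i b≤q s≤q)
      (trans (trans (+-comm (2 ^ suc i) (b + s)) (trans (ring b s (2 ^ suc i)) refl)) e) (begin-strict
    full (suc i) s * full j t               ≡⟨ cong (_* full j t) (trans (full-low i s≤q) (cong suc (*-comm (full i s) _))) ⟩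
    suc (full i 0 * full i s) * full j t    ≤⟨ uncle (full i 0) (≤-trans (full-≤ j i t≤ b≤q) (full-mono i z≤n)) ⟩
    suc (full i 0 * full j t) * full i s    ≤⟨ *-monoˡ-≤ (full i s) (rec smaller i j i z≤n t≤ b≤q (cong (_+ b) (+-identityʳ q)) refl) ⟩
    full i b * full i s                     <⟨ full-merge i b≤q s≤q ⟩
    full (suc i) (b + s)                    ∎)
    where
    q = 2 ^ i
    b = 2 ^ j + t
    ring : ∀ b s p → b + s + p ≡ p + s + b
    ring = solve-∀
    smaller : q + b < 2 ^ h + r
    smaller = begin-strict
      q + b                  <⟨ +-monoˡ-< b (≤-trans (+-mono-≤ (0<2^ i) (≤-refl {q})) (≤-reflexive (sym (2^suc i)))) ⟩
      2 ^ suc i + b          ≤⟨ +-monoˡ-≤ b (m≤m+n (2 ^ suc i) s) ⟩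
      2 ^ suc i + s + b      ≡⟨ e ⟩
      2 ^ h + r              ∎
  ... | high s′ s′≤ refl = final (split i (2^-double i s′≤ b≤q))
    where
    q = 2 ^ i
    b = 2 ^ j + t
    smaller : q + s′ + b < 2 ^ h + r
    smaller = begin-strict
      q + s′ + b             <⟨ +-monoˡ-< b (+-monoˡ-≤ (q + s′) (0<2^ (suc i))) ⟩
      2 ^ suc i + (q + s′) + b ≡⟨ e ⟩
      2 ^ h + r              ∎
    exchange : full (suc i) (q + s′) * full j t ≤ suc (full i s′ * full j t) * full i q
    exchange = begin
      full (suc i) (q + s′) * full j t      ≡⟨ cong (_* full j t) (trans (full-high i s′) (cong suc (*-comm (full i q) _))) ⟩
      suc (full i s′ * full i q) * full j t ≤⟨ uncle (full i s′) (≤-trans (full-≤ j i t≤ b≤q) (full-mono i z≤n)) ⟩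
      suc (full i s′ * full j t) * full i q ∎
    final : Split i (s′ + b) → full (suc i) (q + s′) * full j t < full h r
    final (low sb≤) = retarget r≤ (suc i) (q + (s′ + b)) (2^-double i ≤-refl sb≤)
        (trans (ring (2 ^ suc i) q s′ b) e) (begin-strict
      full (suc i) (q + s′) * full j t      ≤⟨ exchange ⟩
      suc (full i s′ * full j t) * full i q ≤⟨ *-monoˡ-≤ (full i q) (rec smaller i j i s′≤ t≤ sb≤ refl (sym (+-assoc q s′ b))) ⟩
      full i (s′ + b) * full i q            ≡⟨ *-comm (full i (s′ + b)) (full i q) ⟩
      full i q * full i (s′ + b)            <⟨ n<1+n _ ⟩
      suc (full i q * full i (s′ + b))      ≡⟨ sym (full-high i (s′ + b)) ⟩
      full (suc i) (q + (s′ + b))           ∎)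
      where
      ring : ∀ p q s b → p + (q + (s + b)) ≡ p + (q + s) + b
      ring = solve-∀
    final (high w w≤ sb≡) = retarget r≤ (2 + i) w (≤-double (suc i) (≤-double i w≤))
        (trans (trans (cong (_+ w) (2^suc (suc i))) (trans (+-assoc p p w)
          (trans (cong (λ x → p + x) (trans (cong (_+ w) (2^suc i)) (trans (+-assoc q q w) (cong (q +_) (sym sb≡)))))
            (ring p q s′ b)))) e) (begin-strict
      full (suc i) (q + s′) * full j t      ≤⟨ exchange ⟩
      suc (full i s′ * full j t) * full i q ≤⟨ *-mono-≤ (rec smaller i j (suc i) s′≤ t≤ (≤-double i w≤) refl
                                                 (trans (cong (_+ w) (2^suc i)) (trans (+-assoc q q w) (trans (cong (q +_) (sym sb≡)) (sym (+-assoc q s′ b))))))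
                                                 (≤-reflexive (full-carry i)) ⟩
      full (suc i) w * full (suc i) 0       <⟨ n<1+n _ ⟩
      suc (full (suc i) w * full (suc i) 0) ≡⟨ sym (full-low (suc i) (≤-double i w≤)) ⟩
      full (2 + i) w                        ∎)
      where
      p = 2 ^ suc i
      ring : ∀ p q s b → p + (q + (s + b)) ≡ p + (q + s) + b
      ring = solve-∀

  -- The number b of pendant vertices of the smaller tree is compared with 2 ^ i and 2 ^ (i + 1),
  -- where i + 1 is the base height of the larger tree. Above 2 ^ i it can be rewritten with base
  -- height i or i + 1, which leaves the two cases of nearby heights.
  merge-ordered : (∀ {k} → k < 2 ^ h + r → Merges k) →
                  ∀ i j {s t} → s < 2 ^ i → t ≤ 2 ^ j → 2 ^ j + t ≤ 2 ^ i + s →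
                  (2 ^ i + s) + (2 ^ j + t) ≡ 2 ^ h + r → full i s * full j t < full h r
  merge-ordered rec zero j {zero} {t} s< t≤ b≤ e =
    -- Both trees are single vertices, and 2 * 2 < 5.
    subst (λ x → 2 * x < full h r) (sym (full-unique j 0 t≤ z≤n b≡1))
      (retarget r≤ 0 1 ≤-refl (trans (cong suc (sym b≡1)) e) ≤-refl)
    where
    b≡1 : 2 ^ j + t ≡ 1
    b≡1 = ≤-antisym b≤ (≤-trans (0<2^ j) (m≤m+n _ t))
  merge-ordered rec zero j {suc s} (s≤s ()) _ _ _
  merge-ordered rec (suc i) j {s} {t} s< t≤ b≤ e with ≤-total (2 ^ j + t) (2 ^ i) | ≤-total (2 ^ j + t) (2 ^ suc i)
  ... | inj₁ b≤q | _ = merge-distant rec i j (<⇒≤ s<) t≤ b≤q e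
  ... | inj₂ q≤b | inj₁ b≤2q = subst (λ x → full (suc i) s * x < full h r) (sym (full-unique j i t≤ t′≤ b≡))
          (merge-adjacent r≤ i (<⇒≤ s<) t′≤ (trans (cong (2 ^ suc i + s +_) (sym b≡)) e))
    where
    t′ = 2 ^ j + t ∸ 2 ^ i
    b≡ : 2 ^ j + t ≡ 2 ^ i + t′
    b≡ = sym (m+[n∸m]≡n q≤b)
    t′≤ : t′ ≤ 2 ^ i
    t′≤ = m≤n+o⇒m∸n≤o (2 ^ j + t) (2 ^ i) (≤-trans b≤2q (≤-reflexive (2^suc i)))
  ... | inj₂ _ | inj₂ 2q≤b = subst (λ x → full (suc i) s * x < full h r) (sym (full-unique j (suc i) t≤ t′≤ b≡))
          (retarget r≤ (2 + i) (s + t′) (2^-double (suc i) (<⇒≤ s<) t′≤)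
            (trans (cong (_+ (s + t′)) (2^suc (suc i))) (trans (ring p s t′) (trans (cong (p + s +_) (sym b≡)) e)))
            (full-merge (suc i) (<⇒≤ s<) t′≤))
    where
    p = 2 ^ suc i
    t′ = 2 ^ j + t ∸ p
    b≡ : 2 ^ j + t ≡ p + t′
    b≡ = sym (m+[n∸m]≡n 2q≤b)
    t′≤ : t′ ≤ p
    t′≤ = m≤n+o⇒m∸n≤o (2 ^ j + t) p (≤-trans b≤ (+-monoʳ-≤ p (<⇒≤ s<)))
    ring : ∀ p s t → p + p + (s + t) ≡ p + s + (p + t)
    ring = solve-∀

merges : ∀ k → Merges k
merges = <-rec Merges step
  where
  normal : ∀ i {s} → s ≤ 2 ^ i → ∃₂ λ i′ s′ → s′ < 2 ^ i′ × 2 ^ i + s ≡ 2 ^ i′ + s′ × full i s ≡ full i′ s′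
  normal i {s} s≤ with leading-bit (pred (2 ^ i + s))
  ... | i′ , s′ , s′< , e = i′ , s′ , s′< , e′ , full-unique i i′ s≤ (<⇒≤ s′<) e′
    where
    e′ : 2 ^ i + s ≡ 2 ^ i′ + s′
    e′ = trans (sym (suc-pred (2 ^ i + s) {{>-nonZero (≤-trans (0<2^ i) (m≤m+n _ s))}})) e

  step : ∀ k → (∀ {k′} → k′ < k → Merges k′) → Merges k
  step k rec i j h {s} {t} {r} s≤ t≤ r≤ a+b≡ refl with ≤-total (2 ^ j + t) (2 ^ i + s)
  ... | inj₁ b≤a = let i′ , s′ , s′< , a≡ , f≡ = normal i s≤ in
    subst (λ x → x * full j t < full h r) (sym f≡)
      (merge-ordered r≤ rec i′ j s′< t≤ (≤-trans b≤a (≤-reflexive a≡)) (trans (cong (_+ (2 ^ j + t)) (sym a≡)) a+b≡))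
  ... | inj₂ a≤b = let j′ , t′ , t′< , b≡ , f≡ = normal j t≤ in
    subst (_< full h r) (trans (cong (_* full i s) (sym f≡)) (*-comm (full j t) (full i s)))
      (merge-ordered r≤ rec j′ i t′< s≤ (≤-trans a≤b (≤-reflexive b≡))
        (trans (cong (_+ (2 ^ i + s)) (sym b≡)) (trans (+-comm (2 ^ j + t) (2 ^ i + s)) a+b≡)))

full-maximal : ∀ t h {r} → r ≤ 2 ^ h → suc (inner t) ≡ 2 ^ h + r → rootSubs t ≤ full h r
full-maximal leaf       h r≤ e = ≤-reflexive (full-unique 0 h z≤n r≤ e)
full-maximal (node t u) h r≤ e =
  let i , s , s< , t≡ = leading-bit (inner t)
      j , w , w< , u≡ = leading-bit (inner u)
  in ≤-trans (s≤s (*-mono-≤ (full-maximal t i (<⇒≤ s<) t≡) (full-maximal u j (<⇒≤ w<) u≡)))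
       (merges _ i j h (<⇒≤ s<) (<⇒≤ w<) r≤
         (trans (cong₂ _+_ (sym t≡) (sym u≡)) (cong suc (+-suc (inner t) (inner u)))) (sym e))

-- Heap h t: every pendant vertex of t has height h or h + 1, and the children
-- at height h + 1 fill the tree from one side.
data Perfect : ℕ → BinTree → Set where
  leaf : Perfect 0 leaf
  node : ∀ {h l r} → Perfect h l → Perfect h r → Perfect (suc h) (node l r)

data Heap : ℕ → BinTree → Set where
  leaf   : Heap 0 leaf
  cherry : Heap 0 (node leaf leaf)
  fill-left   : ∀ {h l r} → Heap h l → Perfect h r → Heap (suc h) (node l r)
  fill-right : ∀ {h l r} → Perfect (suc h) l → Heap h r → Heap (suc h) (node l r)

Perfect-inner : ∀ {h t} → Perfect h t → suc (inner t) ≡ 2 ^ h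
Perfect-inner leaf = refl
Perfect-inner (node {h} {l} {r} pl pr) =
  trans (cong suc (sym (+-suc (inner l) (inner r)))) (trans (cong₂ _+_ (Perfect-inner pl) (Perfect-inner pr)) (sym (2^suc h)))

Perfect-rootSubs : ∀ {h t} → Perfect h t → rootSubs t ≡ full h 0
Perfect-rootSubs leaf = refl
Perfect-rootSubs (node {h} pl pr) =
  trans (cong₂ (λ x y → suc (x * y)) (Perfect-rootSubs pl) (Perfect-rootSubs pr)) (sym (full-low h z≤n))

Heap-full : ∀ {h t} → Heap h t → ∃ λ r → r ≤ 2 ^ h × suc (inner t) ≡ 2 ^ h + r × rootSubs t ≡ full h r
Heap-full leaf   = 0 , z≤n , refl , refl
Heap-full cherry = 1 , ≤-refl , refl , refl
Heap-full (fill-left {h} {l} {r} hl pr) with Heap-full hl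
... | s , s≤ , l≡ , f≡ = s , ≤-double h s≤ ,
  trans (cong suc (sym (+-suc (inner l) (inner r)))) (trans (cong₂ _+_ l≡ (Perfect-inner pr))
    (trans (ring (2 ^ h) s) (cong (_+ s) (sym (2^suc h))))) ,
  trans (cong₂ (λ x y → suc (x * y)) f≡ (Perfect-rootSubs pr)) (sym (full-low h s≤))
  where
  ring : ∀ q s → q + s + q ≡ q + q + s
  ring = solve-∀
Heap-full (fill-right {h} {l} {r} pl hr) with Heap-full hr
... | s , s≤ , r≡ , f≡ = 2 ^ h + s , 2^-double h ≤-refl s≤ ,
  trans (cong suc (sym (+-suc (inner l) (inner r)))) (cong₂ _+_ (Perfect-inner pl) r≡) ,
  trans (cong₂ (λ x y → suc (x * y)) (trans (Perfect-rootSubs pl) (sym (full-carry h))) f≡) (sym (full-high h s))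

Heap-maximal : ∀ {h t} → Heap h t → ∀ u → inner u ≡ inner t → rootSubs u ≤ rootSubs t
Heap-maximal {h} ht u e with Heap-full ht
... | r , r≤ , t≡ , f≡ = ≤-trans (full-maximal u h r≤ (trans (cong suc e) t≡)) (≤-reflexive (sym f≡))

-- Branches of a binary tree

module _ {A : Set} where

  unique-length-≤ : ∀ {xs ys : List A} → Unique xs → (∀ {x} → x ∈ xs → x ∈ ys) → length xs ≤ length ys
  unique-length-≤ {[]}     _            _  = z≤n
  unique-length-≤ {x ∷ xs} u@(_ ∷ xs!) ⊆ with ∈-∃++ (⊆ (here refl))
  ... | as , bs , refl = ≤-trans (s≤s (unique-length-≤ xs! ⊆′)) (≤-reflexive (sym eq))
    where
    ⊆′ : ∀ {y} → y ∈ xs → y ∈ as ++ bs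
    ⊆′ {y} y∈xs with ∈-++⁻ as (⊆ (there y∈xs))
    ... | inj₁ y∈as         = ∈-++⁺ˡ y∈as
    ... | inj₂ (here refl)  = contradiction y∈xs (Unique[x∷xs]⇒x∉xs u)
    ... | inj₂ (there y∈bs) = ∈-++⁺ʳ as y∈bs
    eq : length (as ++ x ∷ bs) ≡ suc (length (as ++ bs))
    eq = trans (length-++ as) (trans (+-suc (length as) (length bs)) (cong suc (sym (length-++ as))))

  unique-length-≡ : ∀ {xs ys : List A} → Unique xs → Unique ys →
                    (∀ {x} → x ∈ xs → x ∈ ys) → (∀ {x} → x ∈ ys → x ∈ xs) → length xs ≡ length ys
  unique-length-≡ xs! ys! ⊆ ⊇ = ≤-antisym (unique-length-≤ xs! ⊆) (unique-length-≤ ys! ⊇)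

  unique-∷ : ∀ {x : A} {xs} → x ∉ xs → Unique xs → Unique (x ∷ xs)
  unique-∷ x∉ xs! = ¬Any⇒All¬ _ x∉ ∷ xs!

  filter-split : ∀ {P Q R : Pred A 0ℓ} (P? : Decidable P) (Q? : Decidable Q) (R? : Decidable R) →
    (∀ {x} → P x → Q x ⊎ R x) → (∀ {x} → Q x → P x) → (∀ {x} → R x → P x) → (∀ {x} → Q x → ¬ R x) →
    ∀ xs → length (filter P? xs) ≡ length (filter Q? xs) + length (filter R? xs)
  filter-split P? Q? R? P⇒ Q⇒ R⇒ QR = go
    where
    go : ∀ xs → length (filter P? xs) ≡ length (filter Q? xs) + length (filter R? xs)
    go []       = refl
    go (x ∷ xs) with P? x | Q? x | R? x
    ... | _      | yes q | yes r = contradiction r (QR q)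
    ... | yes _  | yes _ | no _  = cong suc (go xs)
    ... | yes _  | no _  | yes _ = trans (cong suc (go xs)) (sym (+-suc _ _))
    ... | yes p  | no ¬q | no ¬r = contradiction (P⇒ p) [ ¬q , ¬r ]′
    ... | no ¬p  | yes q | no _  = contradiction (Q⇒ q) ¬p
    ... | no ¬p  | no _  | yes r = contradiction (R⇒ r) ¬p
    ... | no _   | no _  | no _  = go xs

  position : ∀ {z : A} {xs} → z ∈ xs → ℕ
  position (here _)  = 0
  position (there m) = suc (position m)

  -- The initial part of a list up to a given occurrence, indexed by `Fin` as `IsPath` and `IsCycle`
  -- require; it turns a repeated vertex of a trail into a cycle.
  segment : ∀ {z : A} {xs} (m : z ∈ xs) → Fin (suc (position m)) → A
  segment {xs = x ∷ _} m         zero    = x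
  segment              (there m) (suc i) = segment m i

  segment-∈ : ∀ {z : A} {xs} (m : z ∈ xs) i → segment m i ∈ xs
  segment-∈ (here _)  zero    = here refl
  segment-∈ (there m) zero    = here refl
  segment-∈ (there m) (suc i) = there (segment-∈ m i)

  segment-last : ∀ {z : A} {xs} (m : z ∈ xs) → segment m (fromℕ (position m)) ≡ z
  segment-last (here refl) = refl
  segment-last (there m)   = segment-last m

  segment-injective : ∀ {z : A} {xs} → Unique xs → (m : z ∈ xs) → ∀ {i j} → segment m i ≡ segment m j → i ≡ j
  segment-injective _  m         {zero}  {zero}  _ = refl
  segment-injective u (there m) {zero}  {suc j} e =
    contradiction (subst (_∈ _) (sym e) (segment-∈ m j)) (Unique[x∷xs]⇒x∉xs u)
  segment-injective u (there m) {suc i} {zero}  e =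
    contradiction (subst (_∈ _) e (segment-∈ m i)) (Unique[x∷xs]⇒x∉xs u)
  segment-injective (_ ∷ xs!) (there m) {suc i} {suc j} e = cong suc (segment-injective xs! m e)

  segment-linked : ∀ {R : A → A → Set} {z xs} → Linked R xs → (m : z ∈ xs) →
                   ∀ i → R (segment m (inject₁ i)) (segment m (suc i))
  segment-linked (r ∷ _)  (there (here _))  zero    = r
  segment-linked (r ∷ _)  (there (there m)) zero    = r
  segment-linked (_ ∷ rs) (there m)         (suc i) = segment-linked rs m i

-- The side of v of the edge v p, rooted at v, has the given shape. Only neighbourhoods are
-- recorded; that no vertex occurs twice is derived from acyclicity by means of `Trail`.
data Branch {n} (G : Graph n) (p v : Fin n) : BinTree → Set where
  leaf : Graph._~_ G v p → (∀ w → Graph._~_ G v w → w ≡ p) → Branch G p v leaf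
  node : ∀ {a b l r} → Graph._~_ G v p → a ≢ p → b ≢ p → a ≢ b →
         (∀ w → Graph._~_ G v w → w ≡ p ⊎ w ≡ a ⊎ w ≡ b) →
         Branch G v a l → Branch G v b r → Branch G p v (node l r)

module _ {n} {G : Graph n} where
  open Graph G

  root~ : ∀ {p v t} → Branch G p v t → v ~ p
  root~ (leaf e _)             = e
  root~ (node e _ _ _ _ _ _)   = e

  verts : ∀ {p v t} → Branch G p v t → List (Fin n)
  verts {v = v} (leaf _ _)             = v ∷ []
  verts {v = v} (node _ _ _ _ _ bl br) = v ∷ verts bl ++ verts br

  length-verts : ∀ {p v t} (b : Branch G p v t) → length (verts b) ≡ size t
  length-verts (leaf _ _) = refl
  length-verts (node _ _ _ _ _ bl br) =
    cong suc (trans (length-++ (verts bl)) (cong₂ _+_ (length-verts bl) (length-verts br)))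

  root∈ : ∀ {p v t} (b : Branch G p v t) → v ∈ verts b
  root∈ (leaf _ _)             = here refl
  root∈ (node _ _ _ _ _ _ _)   = here refl

  verts-closed : ∀ {p v t} (b : Branch G p v t) {x y} → x ∈ verts b → x ~ y → y ∈ verts b ⊎ (x ≡ v × y ≡ p)
  verts-closed (leaf _ nb) (here refl) e = inj₂ (refl , nb _ e)
  verts-closed b@(node _ _ _ _ nb bl br) (here refl) e with nb _ e
  ... | inj₁ y≡p        = inj₂ (refl , y≡p)
  ... | inj₂ (inj₁ refl) = inj₁ (there (∈-++⁺ˡ (root∈ bl)))
  ... | inj₂ (inj₂ refl) = inj₁ (there (∈-++⁺ʳ (verts bl) (root∈ br)))
  verts-closed b@(node _ _ _ _ nb bl br) (there x∈) e with ∈-++⁻ (verts bl) x∈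
  ... | inj₁ x∈l with verts-closed bl x∈l e
  ...   | inj₁ y∈         = inj₁ (there (∈-++⁺ˡ y∈))
  ...   | inj₂ (_ , refl) = inj₁ (here refl)
  verts-closed b@(node _ _ _ _ nb bl br) (there x∈) e | inj₂ x∈r with verts-closed br x∈r e
  ...   | inj₁ y∈         = inj₁ (there (∈-++⁺ʳ (verts bl) y∈))
  ...   | inj₂ (_ , refl) = inj₁ (here refl)

  -- The only edge leaving either list ends at the root of the other, so the union is closed under
  -- adjacency, and the graph is connected.
  verts-cover : ∀ {p v t u} (b : Branch G p v t) (b′ : Branch G v p u) x → x ∈ verts b ⊎ x ∈ verts b′
  verts-cover {v = v} b b′ x = go (inj₁ (root∈ b)) (proj₂ (connected v x))
    where
    go : ∀ {k x y} → x ∈ verts b ⊎ x ∈ verts b′ → Walk _~_ k x y → y ∈ verts b ⊎ y ∈ verts b′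
    go x∈ [] = x∈
    go (inj₁ x∈) (e ∷ w) with verts-closed b x∈ e
    ... | inj₁ y∈         = go (inj₁ y∈) w
    ... | inj₂ (_ , refl) = go (inj₂ (root∈ b′)) w
    go (inj₂ x∈) (e ∷ w) with verts-closed b′ x∈ e
    ... | inj₁ y∈         = go (inj₂ y∈) w
    ... | inj₂ (_ , refl) = go (inj₁ (root∈ b)) w

  -- Serves to locate a branch by vertex numbers: Q is a condition on numbers that an edge can break
  -- only by ending at p₀.
  verts-invariant : ∀ {p v t} (Q : Fin n → Set) {p₀} (b : Branch G p v t) → p₀ ∉ verts b →
                    (∀ {x y} → Q x → x ~ y → y ≡ p₀ ⊎ Q y) → Q v → ∀ {x} → x ∈ verts b → Q x
  verts-invariant Q (leaf _ _) _ _ qv (here refl) = qv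
  verts-invariant Q (node _ _ _ _ _ _ _) _ _ qv (here refl) = qv
  verts-invariant Q b@(node _ _ _ _ _ bl br) p₀∉ cl qv (there x∈) with ∈-++⁻ (verts bl) x∈
  ... | inj₁ x∈l with cl qv (symmetric (root~ bl))
  ...   | inj₁ refl = contradiction (there (∈-++⁺ˡ (root∈ bl))) p₀∉
  ...   | inj₂ qa   = verts-invariant Q bl (λ y∈ → p₀∉ (there (∈-++⁺ˡ y∈))) cl qa x∈l
  verts-invariant Q b@(node _ _ _ _ _ bl br) p₀∉ cl qv (there x∈) | inj₂ x∈r with cl qv (symmetric (root~ br))
  ...   | inj₁ refl = contradiction (there (∈-++⁺ʳ (verts bl) (root∈ br))) p₀∉
  ...   | inj₂ qb   = verts-invariant Q br (λ y∈ → p₀∉ (there (∈-++⁺ʳ (verts bl) y∈))) cl qb x∈r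

  -- Trail x xs: a walk without immediate reversals has arrived at x; xs lists
  -- the vertices visited before, latest first.
  data Trail : Fin n → List (Fin n) → Set where
    start : ∀ {x} → Trail x []
    first : ∀ {x y} → x ~ y → Trail y (x ∷ [])
    step  : ∀ {x y z xs} → Trail y (x ∷ xs) → y ~ z → z ≢ x → Trail z (y ∷ x ∷ xs)

  Trail-linked : ∀ {x xs} → Trail x xs → Linked _~_ (x ∷ xs)
  Trail-linked start        = [-]
  Trail-linked (first e)    = symmetric e ∷ [-]
  Trail-linked (step t e _) = symmetric e ∷ Trail-linked t

  data Neighbours (v p : Fin n) : Set where
    one   : (∀ w → v ~ w → w ≡ p) → Neighbours v p
    three : ∀ {a b} → v ~ a → v ~ b → a ≢ p → b ≢ p → a ≢ b →
            (∀ w → v ~ w → w ≡ p ⊎ w ≡ a ⊎ w ≡ b) → Neighbours v p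

  module _ (bin : IsBinaryTree) where

    private
      tree = proj₁ bin

    -- A first repetition would close a cycle, formed by the trail since the earlier visit. It has
    -- at least three vertices because there are neither loops nor immediate reversals.
    Trail-unique : ∀ {x xs} → Trail x xs → Unique (x ∷ xs)
    Trail-unique start     = [] ∷ []
    Trail-unique (first e) = unique-∷ (λ { (here refl) → loopless refl e }) ([] ∷ [])
    Trail-unique (step {x} {y} {z} {xs} t e z≢x) = unique-∷ new (Trail-unique t)
      where
      new : z ∉ y ∷ x ∷ xs
      new (here refl)          = loopless refl e
      new (there (here z≡x))   = z≢x z≡x
      new m@(there (there z∈)) = tree (segment m)
        ( s≤s (s≤s z≤n)
        , ((segment-injective (Trail-unique t) m , segment-linked (Trail-linked t) m)
        , subst (_~ y) (sym (segment-last m)) (symmetric e)))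

    -- Disjointness of branches comes from going up from x out of one branch and on down into
    -- another: the whole is one trail, so it cannot meet x again.
    Trail-up : ∀ {p v t x} (b : Branch G p v t) → x ∈ verts b → ∃ λ xs → Trail p (v ∷ xs) × x ∈ v ∷ xs
    Trail-up (leaf e _)           (here refl) = _ , first e , here refl
    Trail-up (node e _ _ _ _ _ _) (here refl) = _ , first e , here refl
    Trail-up (node e a≢p b≢p _ _ bl br) (there x∈) with ∈-++⁻ (verts bl) x∈
    ... | inj₁ x∈l = let _ , t , m = Trail-up bl x∈l in _ , step t e (a≢p ∘ sym) , there m
    ... | inj₂ x∈r = let _ , t , m = Trail-up br x∈r in _ , step t e (b≢p ∘ sym) , there m

    Trail-down : ∀ {p v t y xs} (b : Branch G p v t) → Trail v (p ∷ xs) → y ∈ verts b →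
                 ∃ λ ys → Trail y ys × (∀ {x} → x ∈ p ∷ xs → x ∈ ys)
    Trail-down (leaf _ _)           t (here refl) = _ , t , id
    Trail-down (node _ _ _ _ _ _ _) t (here refl) = _ , t , id
    Trail-down (node _ a≢p b≢p _ _ bl br) t (there y∈) with ∈-++⁻ (verts bl) y∈
    ... | inj₁ y∈l = let _ , t′ , ⊆ = Trail-down bl (step t (symmetric (root~ bl)) a≢p) y∈l in _ , t′ , ⊆ ∘ there
    ... | inj₂ y∈r = let _ , t′ , ⊆ = Trail-down br (step t (symmetric (root~ br)) b≢p) y∈r in _ , t′ , ⊆ ∘ there

    Trail-down-new : ∀ {p v t y xs} (b : Branch G p v t) → Trail v (p ∷ xs) → y ∈ verts b → y ∉ p ∷ xs
    Trail-down-new b t y∈ y∈xs = let _ , t′ , ⊆ = Trail-down b t y∈ in Unique[x∷xs]⇒x∉xs (Trail-unique t′) (⊆ y∈xs)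

    parent∉ : ∀ {p v t} (b : Branch G p v t) → p ∉ verts b
    parent∉ b p∈ = Trail-down-new b (first (symmetric (root~ b))) p∈ (here refl)

    opposite-disjoint : ∀ {p v t u} (b : Branch G p v t) (b′ : Branch G v p u) {x} → x ∈ verts b → x ∉ verts b′
    opposite-disjoint b b′ x∈ x∈′ = let _ , t , m = Trail-up b x∈ in Trail-down-new b′ t x∈′ m

    siblings-disjoint : ∀ {v a b l r} (bl : Branch G v a l) (br : Branch G v b r) → a ≢ b →
                        ∀ {x} → x ∈ verts bl → x ∉ verts br
    siblings-disjoint bl br a≢b x∈l x∈r = let _ , t , m = Trail-up bl x∈l in
      Trail-down-new br (step t (symmetric (root~ br)) (a≢b ∘ sym)) x∈r (there m)

    verts-unique : ∀ {p v t} (b : Branch G p v t) → Unique (verts b)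
    verts-unique (leaf _ _) = [] ∷ []
    verts-unique (node _ _ _ a≢b _ bl br) =
      unique-∷ (λ v∈ → [ parent∉ bl , parent∉ br ]′ (∈-++⁻ (verts bl) v∈))
        (++⁺ (verts-unique bl) (verts-unique br) (λ (x∈l , x∈r) → siblings-disjoint bl br a≢b x∈l x∈r))

    size-sum : ∀ {p v t u} → Branch G p v t → Branch G v p u → size t + size u ≡ n
    size-sum b b′ = trans (sym (trans (length-++ (verts b)) (cong₂ _+_ (length-verts b) (length-verts b′))))
      (trans (unique-length-≡ (++⁺ (verts-unique b) (verts-unique b′) (λ (x∈ , x∈′) → opposite-disjoint b b′ x∈ x∈′))
                (allFin⁺ n) (λ _ → ∈-allFin _) (λ {x} _ → [ ∈-++⁺ˡ , ∈-++⁺ʳ (verts b) ]′ (verts-cover b b′ x)))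
             (length-tabulate id))

    neighbours : ∀ {v p} → v ~ p → Neighbours v p
    neighbours {v} {p} v~p = go (filter (v ~?_) (allFin n)) refl
      where
      complete : ∀ {w xs} → filter (v ~?_) (allFin n) ≡ xs → v ~ w → w ∈ xs
      complete refl e = ∈-filter⁺ (v ~?_) (∈-allFin _) e
      sound : ∀ {w xs} → filter (v ~?_) (allFin n) ≡ xs → w ∈ xs → v ~ w
      sound refl w∈ = proj₂ (∈-filter⁻ (v ~?_) {xs = allFin n} w∈)
      unique : ∀ {xs} → filter (v ~?_) (allFin n) ≡ xs → Unique xs
      unique refl = filter⁺ (v ~?_) (allFin⁺ n)
      deg : ∀ {xs} → filter (v ~?_) (allFin n) ≡ xs → length xs ≡ 1 ⊎ length xs ≡ 3
      deg refl with length (filter (v ~?_) (allFin n)) ≟ 1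
      ... | yes d = inj₁ d
      ... | no ¬d = inj₂ (proj₂ bin v ¬d)
      pick : ∀ {a b c} → filter (v ~?_) (allFin n) ≡ a ∷ b ∷ c ∷ [] → p ∈ a ∷ b ∷ c ∷ [] → Neighbours v p
      pick e p∈ with unique e | p∈
      ... | (ab ∷ ac ∷ []) ∷ (bc ∷ []) ∷ _ | here refl =
        three (sound e (there (here refl))) (sound e (there (there (here refl)))) (ab ∘ sym) (ac ∘ sym) bc
          (λ w v~w → case₁ (complete e v~w))
        where
        case₁ : ∀ {w a b c} → w ∈ a ∷ b ∷ c ∷ [] → w ≡ a ⊎ w ≡ b ⊎ w ≡ c
        case₁ (here w≡)                 = inj₁ w≡
        case₁ (there (here w≡))         = inj₂ (inj₁ w≡)
        case₁ (there (there (here w≡))) = inj₂ (inj₂ w≡)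
      ... | (ab ∷ ac ∷ []) ∷ (bc ∷ []) ∷ _ | there (here refl) =
        three (sound e (here refl)) (sound e (there (there (here refl)))) ab (bc ∘ sym) ac
          (λ w v~w → case₂ (complete e v~w))
        where
        case₂ : ∀ {w a b c} → w ∈ a ∷ b ∷ c ∷ [] → w ≡ b ⊎ w ≡ a ⊎ w ≡ c
        case₂ (here w≡)                 = inj₂ (inj₁ w≡)
        case₂ (there (here w≡))         = inj₁ w≡
        case₂ (there (there (here w≡))) = inj₂ (inj₂ w≡)
      ... | (ab ∷ ac ∷ []) ∷ (bc ∷ []) ∷ _ | there (there (here refl)) =
        three (sound e (here refl)) (sound e (there (here refl))) ac bc ab
          (λ w v~w → case₃ (complete e v~w))
        where
        case₃ : ∀ {w a b c} → w ∈ a ∷ b ∷ c ∷ [] → w ≡ c ⊎ w ≡ a ⊎ w ≡ b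
        case₃ (here w≡)                 = inj₂ (inj₁ w≡)
        case₃ (there (here w≡))         = inj₂ (inj₂ w≡)
        case₃ (there (there (here w≡))) = inj₁ w≡
      go : ∀ xs → filter (v ~?_) (allFin n) ≡ xs → Neighbours v p
      go (_ ∷ []) e = one (λ w v~w → both (complete e v~w) (complete e v~p))
        where
        both : ∀ {x y z : Fin n} → x ∈ z ∷ [] → y ∈ z ∷ [] → x ≡ y
        both (here refl) (here refl) = refl
      go (_ ∷ _ ∷ _ ∷ []) e = pick e (complete e v~p)
      go [] e with complete e v~p
      ... | ()
      go (_ ∷ _ ∷ []) e with deg e
      ... | inj₁ ()
      ... | inj₂ ()
      go (_ ∷ _ ∷ _ ∷ _ ∷ _) e with deg e
      ... | inj₁ ()
      ... | inj₂ ()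

    -- The recursion has no structural measure. Fuel n suffices, since a trail has no repetitions
    -- and therefore at most n vertices.
    branch : ∀ {p v} → v ~ p → ∃ (Branch G p v)
    branch {p} {v} v~p = extend n (first (symmetric v~p)) (m≤m+n n _)
      where
      extend : ∀ fuel {v p xs} → Trail v (p ∷ xs) → n ≤ fuel + length (v ∷ p ∷ xs) → ∃ (Branch G p v)
      extend fuel {v} {p} {xs} t enough with neighbours (Linked.head (Trail-linked t))
      ... | one only = _ , leaf (Linked.head (Trail-linked t)) only
      ... | three {a} {b} va vb a≢p b≢p a≢b only with fuel
      ...   | zero = contradiction
                (≤-trans (s≤s enough) (≤-trans (unique-length-≤ (Trail-unique (step t va a≢p)) (λ _ → ∈-allFin _)) (≤-reflexive (length-tabulate id))))
                (<-irrefl refl)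
      ...   | suc f = let more = ≤-trans enough (≤-reflexive (sym (+-suc f _)))
                          _ , bl = extend f (step t va a≢p) more
                          _ , br = extend f (step t vb b≢p) more
                      in _ , node (Linked.head (Trail-linked t)) a≢p b≢p a≢b only bl br

-- Subtrees through a vertex

unique-map : ∀ {A B : Set} {f : A → B} {xs} → (∀ {x y} → x ∈ xs → y ∈ xs → f x ≡ f y → x ≡ y) → Unique xs → Unique (map f xs)
unique-map {xs = []}     _   _ = []
unique-map {f = f} {x ∷ xs} inj u@(_ ∷ xs!) = unique-∷ new (unique-map (λ y∈ z∈ → inj (there y∈) (there z∈)) xs!)
  where
  new : f x ∉ map f xs
  new fx∈ with ∈-map⁻ f fx∈
  ... | y , y∈ , fx≡fy = Unique[x∷xs]⇒x∉xs u (subst (_∈ xs) (sym (inj (here refl) (there y∈) fx≡fy)) y∈)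

length-cartesianProductWith : ∀ {A B C : Set} (f : A → B → C) xs ys →
                              length (cartesianProductWith f xs ys) ≡ length xs * length ys
length-cartesianProductWith f []       ys = refl
length-cartesianProductWith f (x ∷ xs) ys =
  trans (length-++ (map (f x) ys)) (cong₂ _+_ (length-map (f x) ys) (length-cartesianProductWith f xs ys))

unique-cartesianProductWith : ∀ {A B C : Set} (f : A → B → C) {xs ys} →
  (∀ {x x′ y y′} → x ∈ xs → x′ ∈ xs → y ∈ ys → y′ ∈ ys → f x y ≡ f x′ y′ → x ≡ x′ × y ≡ y′) →
  Unique xs → Unique ys → Unique (cartesianProductWith f xs ys)
unique-cartesianProductWith f {[]}     _   _            _   = []
unique-cartesianProductWith f {x ∷ xs} {ys} inj u@(_ ∷ xs!) ys! =
  ++⁺ (unique-map (λ y∈ y′∈ e → proj₂ (inj (here refl) (here refl) y∈ y′∈ e)) ys!)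
      (unique-cartesianProductWith f (λ x∈ x′∈ → inj (there x∈) (there x′∈)) xs! ys!)
      disjoint
  where
  disjoint : ∀ {z} → ¬ (z ∈ map (f x) ys × z ∈ cartesianProductWith f xs ys)
  disjoint (z∈ , z∈′) with ∈-map⁻ (f x) z∈ | ∈-cartesianProductWith⁻ f xs ys z∈′
  ... | y , y∈ , z≡ | x′ , y′ , x′∈ , y′∈ , z≡′ =
    Unique[x∷xs]⇒x∉xs u (subst (_∈ xs) (sym (proj₁ (inj (here refl) (there x′∈) y∈ y′∈ (trans (sym z≡) z≡′)))) x′∈)

unique-vecs : ∀ {A : Set} {xs : List A} → Unique xs → ∀ n → Unique (vecs xs n)
unique-vecs xs! zero    = [] ∷ []
unique-vecs xs! (suc n) = cartesianProductWith⁺ Vec._∷_ ∷-injective xs! (unique-vecs xs! n)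

unique-allSubs : ∀ n → Unique (allSubs n)
unique-allSubs n = cartesianProduct⁺ subsets! (unique-vecs subsets! n)
  where
  subsets! = unique-vecs (unique-∷ {x = true} {false ∷ []} (λ { (here ()) }) ([] ∷ [])) n

module _ {n} {R : Rel (Fin n) 0ℓ} where

  walk-map : ∀ {S : Rel (Fin n) 0ℓ} → (∀ {x y} → R x y → S x y) → ∀ {k x y} → Walk R k x y → Walk S k x y
  walk-map f []      = []
  walk-map f (e ∷ w) = f e ∷ walk-map f w

  joined-trans : ∀ {x y z} → Joined R x y → Joined R y z → Joined R x z
  joined-trans (_ , w) (_ , w′) = _ , (w ++ʷ w′)

  walk-reverse : Symmetric R → ∀ {k x y} → Walk R k x y → Walk R k y x
  walk-reverse s []              = []
  walk-reverse s {suc k} {x} {y} (e ∷ w) = subst (λ k → Walk R k y x) (+-comm k 1) (walk-reverse s w ++ʷ (s e ∷ []))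

  joined-sym : Symmetric R → ∀ {x y} → Joined R x y → Joined R y x
  joined-sym s (_ , w) = _ , walk-reverse s w

module _ {n : ℕ} where

  comprehend : {P : Pred (Fin n) 0ℓ} → Decidable P → Subset n
  comprehend P? = tabulate (does ∘ P?)

  module _ {P : Pred (Fin n) 0ℓ} (P? : Decidable P) where

    ∈-comprehend⁺ : ∀ {x} → P x → x ∈ˢ comprehend P?
    ∈-comprehend⁺ {x} px = lookup⇒[]= x _ (trans (lookup∘tabulate (does ∘ P?) x) (dec-true (P? x) px))

    ∈-comprehend⁻ : ∀ {x} → x ∈ˢ comprehend P? → P x
    ∈-comprehend⁻ {x} x∈ with P? x | trans (sym (lookup∘tabulate (does ∘ P?) x)) ([]=⇒lookup x∈)
    ... | yes px | _  = px
    ... | no _   | ()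

  attach : Fin n → Subset n → Subset n → Subset n
  attach v A B = ⁅ v ⁆ ∪ (A ∪ B)

  attach⁻ : ∀ {v A B x} → x ∈ˢ attach v A B → x ≡ v ⊎ x ∈ˢ A ⊎ x ∈ˢ B
  attach⁻ {v} {A} {B} x∈ with x∈p∪q⁻ ⁅ v ⁆ (A ∪ B) x∈
  ... | inj₁ x∈v  = inj₁ (x∈⁅y⁆⇒x≡y v x∈v)
  ... | inj₂ x∈AB = inj₂ (x∈p∪q⁻ A B x∈AB)

  attach-root : ∀ {v A B} → v ∈ˢ attach v A B
  attach-root {v} = x∈p∪q⁺ (inj₁ (x∈⁅x⁆ v))

  attach-left : ∀ {v A B x} → x ∈ˢ A → x ∈ˢ attach v A B
  attach-left x∈ = x∈p∪q⁺ (inj₂ (x∈p∪q⁺ (inj₁ x∈)))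

  attach-right : ∀ {v A B x} → x ∈ˢ B → x ∈ˢ attach v A B
  attach-right x∈ = x∈p∪q⁺ (inj₂ (x∈p∪q⁺ (inj₂ x∈)))

  attach-injective : ∀ {v A B A′ B′} {L R : Pred (Fin n) 0ℓ} → ¬ L v → ¬ R v → (∀ {x} → L x → ¬ R x) →
    (∀ {x} → x ∈ˢ A → L x) → (∀ {x} → x ∈ˢ A′ → L x) → (∀ {x} → x ∈ˢ B → R x) → (∀ {x} → x ∈ˢ B′ → R x) →
    attach v A B ≡ attach v A′ B′ → A ≡ A′ × B ≡ B′
  attach-injective {v} {L = L} {R} ¬Lv ¬Rv LR A⊆ A′⊆ B⊆ B′⊆ e =
    ⊆-antisym (left A⊆ B′⊆ e) (left A′⊆ B⊆ (sym e)) , ⊆-antisym (right B⊆ A′⊆ e) (right B′⊆ A⊆ (sym e))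
    where
    left : ∀ {A B A′ B′} → (∀ {x} → x ∈ˢ A → L x) → (∀ {x} → x ∈ˢ B′ → R x) →
           attach v A B ≡ attach v A′ B′ → A ⊆ˢ A′
    left A⊆ B′⊆ e x∈ with attach⁻ (subst (_ ∈ˢ_) e (attach-left x∈))
    ... | inj₁ refl        = contradiction (A⊆ x∈) ¬Lv
    ... | inj₂ (inj₁ x∈A′) = x∈A′
    ... | inj₂ (inj₂ x∈B′) = contradiction (B′⊆ x∈B′) (LR (A⊆ x∈))
    right : ∀ {A B A′ B′} → (∀ {x} → x ∈ˢ B → R x) → (∀ {x} → x ∈ˢ A′ → L x) →
            attach v A B ≡ attach v A′ B′ → B ⊆ˢ B′
    right B⊆ A′⊆ e x∈ with attach⁻ (subst (_ ∈ˢ_) e (attach-right x∈))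
    ... | inj₁ refl        = contradiction (B⊆ x∈) ¬Rv
    ... | inj₂ (inj₁ x∈A′) = contradiction (B⊆ x∈) (LR (A′⊆ x∈A′))
    ... | inj₂ (inj₂ x∈B′) = x∈B′

module _ {n} (G : Graph n) where
  open Graph G

  Inside : Subset n → Rel (Fin n) 0ℓ
  Inside V x y = x ∈ˢ V × y ∈ˢ V × x ~ y

  inside? : ∀ V → Decidable₂ (Inside V)
  inside? V x y = (x ∈ˢ? V) ×-dec (y ∈ˢ? V) ×-dec (x ~? y)

  inside-sym : ∀ {V} → Symmetric (Inside V)
  inside-sym (x∈ , y∈ , e) = y∈ , x∈ , symmetric e

  induced : Subset n → Edges n
  induced V = tabulate (λ x → comprehend (inside? V x))

  induced⁺ : ∀ {V x y} → Inside V x y → Adj (induced V) x y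
  induced⁺ {V} {x} {y} i = subst (y ∈ˢ_) (sym (lookup∘tabulate (λ x → comprehend (inside? V x)) x)) (∈-comprehend⁺ (inside? V x) i)

  induced⁻ : ∀ {V x y} → Adj (induced V) x y → Inside V x y
  induced⁻ {V} {x} {y} a = ∈-comprehend⁻ (inside? V x) (subst (y ∈ˢ_) (lookup∘tabulate (λ x → comprehend (inside? V x)) x) a)

  -- In a tree the edges of a subtree are determined by its vertices (`subtree-induced`), so
  -- counting subtrees through v becomes counting vertex sets connected to v.
  RootedAt : Fin n → Subset n → Set
  RootedAt v V = v ∈ˢ V × (∀ {x} → x ∈ˢ V → Joined (Inside V) x v)

  rooted⇒subtree : ∀ {v V} → RootedAt v V → IsSubtree G (V , induced V)
  rooted⇒subtree {v} {V} (v∈ , join) =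
    (λ x y a → let i = induced⁻ a in induced⁺ (inside-sym i) , proj₁ i , proj₂ (proj₂ i)) ,
    (v , v∈) ,
    λ x y x∈ y∈ → let _ , w = joined-trans (join x∈) (joined-sym inside-sym (join y∈)) in _ , walk-map induced⁺ w

  subtree-walk : ∀ {V E} → IsSubtree G (V , E) → ∀ {k x y} → Walk (Adj E) k x y → Walk (Inside V) k x y
  subtree-walk (sub , _) = walk-map λ a → let a′ , x∈ , e = sub _ _ a in x∈ , proj₁ (proj₂ (sub _ _ a′)) , e

  subtree⇒rooted : ∀ {V E v} → IsSubtree G (V , E) → v ∈ˢ V → RootedAt v V
  subtree⇒rooted {E = E} {v} s@(_ , _ , join) v∈ = v∈ , λ x∈ → let _ , w = join _ v x∈ v∈ in _ , subtree-walk {E = E} s w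

module _ {n} {G : Graph n} where
  open Graph G

  -- Mirrors the recursion of `rootSubs`: adjoining ∅ lets either child be omitted. The sets listed
  -- are nonempty, whence the `suc` in `length-rootedSubsets`.
  rootedSubsets : ∀ {p v t} → Branch G p v t → List (Subset n)
  rootedSubsets {v = v} (leaf _ _)             = ⁅ v ⁆ ∷ []
  rootedSubsets {v = v} (node _ _ _ _ _ bl br) =
    cartesianProductWith (attach v) (∅ ∷ rootedSubsets bl) (∅ ∷ rootedSubsets br)

  length-rootedSubsets : ∀ {p v t} (b : Branch G p v t) → suc (length (rootedSubsets b)) ≡ rootSubs t
  length-rootedSubsets (leaf _ _) = refl
  length-rootedSubsets {v = v} (node _ _ _ _ _ bl br) = cong suc
    (trans (length-cartesianProductWith (attach v) (∅ ∷ rootedSubsets bl) (∅ ∷ rootedSubsets br))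
           (cong₂ _*_ (length-rootedSubsets bl) (length-rootedSubsets br)))

  subsets-sound : ∀ {p v t V} (b : Branch G p v t) → V ∈ rootedSubsets b →
                  RootedAt G v V × (∀ {x} → x ∈ˢ V → x ∈ verts b)
  subsets-sound {v = v} (leaf _ _) (here refl) =
    (x∈⁅x⁆ v , λ x∈ → 0 , subst (λ y → Walk _ 0 y v) (sym (x∈⁅y⁆⇒x≡y v x∈)) []) , λ x∈ → here (x∈⁅y⁆⇒x≡y v x∈)
  subsets-sound {v = v} (node e a≢p b≢p a≢b nb bl br) V∈
    with ∈-cartesianProductWith⁻ (attach v) (∅ ∷ rootedSubsets bl) (∅ ∷ rootedSubsets br) V∈
  ... | A , B , A∈ , B∈ , refl = (attach-root {A = A} {B} , join) , within
    where
    part : ∀ {a t A x} (b : Branch G v a t) → A ∈ ∅ ∷ rootedSubsets b → ∀ {V} → v ∈ˢ V → (∀ {x} → x ∈ˢ A → x ∈ˢ V) →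
           x ∈ˢ A → x ∈ verts b × Joined (Inside G V) x v
    part b (here refl) _  _  x∈ = contradiction x∈ ∉⊥
    part b (there A∈)  v∈ ⊆V x∈ = let (a∈ , join) , within = subsets-sound b A∈ ; _ , w = join x∈ in
      within x∈ , joined-trans (_ , walk-map (λ (y∈ , z∈ , e) → ⊆V y∈ , ⊆V z∈ , e) w) (1 , (⊆V a∈ , v∈ , root~ b) ∷ [])
    join : ∀ {x} → x ∈ˢ attach v A B → Joined (Inside G (attach v A B)) x v
    join x∈ with attach⁻ {A = A} {B} x∈
    ... | inj₁ refl       = 0 , []
    ... | inj₂ (inj₁ x∈A) = proj₂ (part bl A∈ (attach-root {A = A} {B}) (attach-left {A = A} {B}) x∈A)
    ... | inj₂ (inj₂ x∈B) = proj₂ (part br B∈ (attach-root {A = A} {B}) (attach-right {A = A} {B}) x∈B)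
    within : ∀ {x} → x ∈ˢ attach v A B → x ∈ v ∷ verts bl ++ verts br
    within x∈ with attach⁻ {A = A} {B} x∈
    ... | inj₁ refl       = here refl
    ... | inj₂ (inj₁ x∈A) = there (∈-++⁺ˡ (proj₁ (part bl A∈ (attach-root {A = A} {B}) (attach-left {A = A} {B}) x∈A)))
    ... | inj₂ (inj₂ x∈B) = there (∈-++⁺ʳ (verts bl) (proj₁ (part br B∈ (attach-root {A = A} {B}) (attach-right {A = A} {B}) x∈B)))

  module _ (bin : IsBinaryTree) where

    module _ {v a t} (b : Branch G v a t) (V : Subset n) where

      private
        ∈part? : Decidable (λ x → x ∈ˢ V × x ∈ verts b)
        ∈part? x = (x ∈ˢ? V) ×-dec member? Fin._≟_ x (verts b)

      part : Subset n
      part = comprehend ∈part?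

      part⁺ : ∀ {x} → x ∈ˢ V → x ∈ verts b → x ∈ˢ part
      part⁺ x∈ x∈b = ∈-comprehend⁺ ∈part? (x∈ , x∈b)

      part⁻ : ∀ {x} → x ∈ˢ part → x ∈ˢ V × x ∈ verts b
      part⁻ = ∈-comprehend⁻ ∈part?

      -- A walk leaving the branch of a passes through a, by the edge from a to v.
      part-walk : ∀ {k x} → Walk (Inside G V) k x v → x ∈ verts b → a ∈ˢ V × Joined (Inside G part) x a
      part-walk [] v∈ = contradiction v∈ (parent∉ bin b)
      part-walk ((x∈ , y∈ , e) ∷ w) x∈b with verts-closed b x∈b e
      ... | inj₁ y∈b        = let a∈ , _ , w′ = part-walk w y∈b in a∈ , _ , (part⁺ x∈ x∈b , part⁺ y∈ y∈b , e) ∷ w′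
      ... | inj₂ (refl , _) = x∈ , 0 , []

    -- V consists of v and its parts in the two child branches. By `part-walk` a part is empty if
    -- its root is missing from V, and otherwise is itself connected to that root.
    subsets-complete : ∀ {p v t V} (b : Branch G p v t) → RootedAt G v V → (∀ {x} → x ∈ˢ V → x ∈ verts b) →
                       V ∈ rootedSubsets b
    subsets-complete {v = v} {V = V} (leaf _ _) (v∈ , _) within = here (⊆-antisym
      (λ x∈ → subst (_∈ˢ ⁅ v ⁆) (sym (single (within x∈))) (x∈⁅x⁆ v))
      (λ x∈ → subst (_∈ˢ V) (sym (x∈⁅y⁆⇒x≡y v x∈)) v∈))
      where
      single : ∀ {x} → x ∈ v ∷ [] → x ≡ v
      single (here x≡v) = x≡v
    subsets-complete {v = v} {V = V} (node _ _ _ _ _ bl br) (v∈ , join) within =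
      subst (_∈ cartesianProductWith (attach v) (∅ ∷ rootedSubsets bl) (∅ ∷ rootedSubsets br)) (sym V≡)
        (∈-cartesianProductWith⁺ (attach v) (side bl) (side br))
      where
      V≡ : V ≡ attach v (part bl V) (part br V)
      V≡ = ⊆-antisym
        (λ x∈ → case₁ x∈ (within x∈))
        (λ x∈ → [ (λ { refl → v∈ }) , [ proj₁ ∘ part⁻ bl V , proj₁ ∘ part⁻ br V ]′ ]′ (attach⁻ {A = part bl V} {part br V} x∈))
        where
        case₁ : ∀ {x} → x ∈ˢ V → x ∈ v ∷ verts bl ++ verts br → x ∈ˢ attach v (part bl V) (part br V)
        case₁ x∈ (here refl) = attach-root {A = part bl V} {part br V}
        case₁ x∈ (there x∈b) with ∈-++⁻ (verts bl) x∈b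
        ... | inj₁ x∈l = attach-left {A = part bl V} {part br V} (part⁺ bl V x∈ x∈l)
        ... | inj₂ x∈r = attach-right {A = part bl V} {part br V} (part⁺ br V x∈ x∈r)
      side : ∀ {a t} (b : Branch G v a t) → part b V ∈ ∅ ∷ rootedSubsets b
      side {a} b with a ∈ˢ? V
      ... | yes a∈ = there (subsets-complete b
              (part⁺ b V a∈ (root∈ b) , λ x∈ → let x∈V , x∈b = part⁻ b V x∈ in proj₂ (part-walk b V (proj₂ (join x∈V)) x∈b))
              (proj₂ ∘ part⁻ b V))
      ... | no a∉  = here (⊆-antisym
              (λ x∈ → let x∈V , x∈b = part⁻ b V x∈ in contradiction (proj₁ (part-walk b V (proj₂ (join x∈V)) x∈b)) a∉)
              (λ x∈ → contradiction x∈ ∉⊥))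

    subsets-unique : ∀ {p v t} (b : Branch G p v t) → Unique (rootedSubsets b)
    subsets-unique (leaf _ _) = [] ∷ []
    subsets-unique {v = v} (node _ _ _ a≢b _ bl br) = unique-cartesianProductWith (attach v)
      (λ A∈ A′∈ B∈ B′∈ → attach-injective (parent∉ bin bl) (parent∉ bin br) (siblings-disjoint bin bl br a≢b)
        (within bl A∈) (within bl A′∈) (within br B∈) (within br B′∈))
      (with-∅ bl) (with-∅ br)
      where
      within : ∀ {a t A} (b : Branch G v a t) → A ∈ ∅ ∷ rootedSubsets b → ∀ {x} → x ∈ˢ A → x ∈ verts b
      within b (here refl) x∈ = contradiction x∈ ∉⊥
      within b (there A∈)  x∈ = proj₂ (subsets-sound b A∈) x∈
      with-∅ : ∀ {a t} (b : Branch G v a t) → Unique (∅ ∷ rootedSubsets b)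
      with-∅ b = unique-∷ (λ ∅∈ → ∉⊥ (proj₁ (proj₁ (subsets-sound b ∅∈)))) (subsets-unique b)

    -- A walk in E from y to x has to leave the side of y, and the only edge of G that does so is y
    -- x itself.
    subtree-edge : ∀ {V E x y} → IsSubtree G (V , E) → x ∈ˢ V → y ∈ˢ V → x ~ y → Adj E x y
    subtree-edge {V} {E} {x} {y} (sub , _ , join) x∈ y∈ x~y =
      let _ , b = branch bin (symmetric x~y) in proj₁ (sub y x (cross b (proj₂ (join y x y∈ x∈)) (root∈ b)))
      where
      cross : ∀ {t} (b : Branch G x y t) {k z} → Walk (Adj E) k z x → z ∈ verts b → Adj E y x
      cross b [] z∈ = contradiction z∈ (parent∉ bin b)
      cross b (a ∷ w) z∈ with verts-closed b z∈ (proj₂ (proj₂ (sub _ _ a)))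
      ... | inj₁ z′∈          = cross b w z′∈
      ... | inj₂ (refl , refl) = a

    subtree-induced : ∀ {V E} → IsSubtree G (V , E) → E ≡ induced G V
    subtree-induced {V} {E} s@(sub , _) = trans (sym (tabulate∘lookup E)) (tabulate-cong λ x → ⊆-antisym
      (λ a → let a′ , x∈ , e = sub _ _ a in ∈-comprehend⁺ (inside? G V x) (x∈ , proj₁ (proj₂ (sub _ _ a′)) , e))
      (λ i → let x∈ , y∈ , e = ∈-comprehend⁻ (inside? G V x) i in subtree-edge {E = E} s x∈ y∈ e))

    stay : ∀ {V p v t k x} (b : Branch G p v t) → ¬ p ∈ˢ V → Walk (Inside G V) k x v → x ∈ˢ V → x ∈ verts b
    stay b p∉ w x∈ = go (joined-sym (inside-sym G) (_ , w))
      where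
      forward : ∀ {k x y} → Walk (Inside G _) k x y → x ∈ verts b → y ∈ verts b
      forward [] x∈ = x∈
      forward ((_ , y∈ , e) ∷ w) x∈ with verts-closed b x∈ e
      ... | inj₁ y∈b         = forward w y∈b
      ... | inj₂ (_ , refl) = contradiction y∈ p∉
      go : ∀ {x} → Joined (Inside G _) _ x → x ∈ verts b
      go (_ , w) = forward w (root∈ b)

    Avoiding : Fin n → Fin n → Pred (Sub n) 0ℓ
    Avoiding v p (V , E) = (IsSubtree G (V , E) × v ∈ˢ V) × ¬ p ∈ˢ V

    avoiding? : ∀ v p → Decidable (Avoiding v p)
    avoiding? v p (V , E) = (isSubtree? G (V , E) ×-dec (v ∈ˢ? V)) ×-dec ¬? (p ∈ˢ? V)

    -- A subtree through v that misses p cannot leave the side of v (`stay`), so it corresponds to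
    -- one of the listed vertex sets.
    count-avoiding : ∀ {p v t} → Branch G p v t → suc (length (filter (avoiding? v p) (allSubs n))) ≡ rootSubs t
    count-avoiding {p} {v} b = trans (cong suc
        (trans (unique-length-≡ (filter⁺ (avoiding? v p) (unique-allSubs n)) (map⁺ (cong proj₁) (subsets-unique b)) to from)
               (length-map sub (rootedSubsets b))))
      (length-rootedSubsets b)
      where
      sub : Subset n → Sub n
      sub V = V , induced G V
      to : ∀ {S} → S ∈ filter (avoiding? v p) (allSubs n) → S ∈ map sub (rootedSubsets b)
      to {V , E} S∈ with ∈-filter⁻ (avoiding? v p) {xs = allSubs n} S∈
      ... | _ , (s , v∈) , p∉ = let r = subtree⇒rooted G {E = E} s v∈ in
        subst (λ E′ → (V , E′) ∈ map sub (rootedSubsets b)) (sym (subtree-induced s))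
        (∈-map⁺ sub (subsets-complete b r (λ x∈ → stay b p∉ (proj₂ (proj₂ r x∈)) x∈)))
      from : ∀ {S} → S ∈ map sub (rootedSubsets b) → S ∈ filter (avoiding? v p) (allSubs n)
      from S∈ with ∈-map⁻ sub S∈
      ... | V , V∈ , refl = let r , within = subsets-sound b V∈ in
        ∈-filter⁺ (avoiding? v p) (∈-allSubs (sub V)) ((rooted⇒subtree G r , proj₁ r) , parent∉ bin b ∘ within)

    Through : Fin n → Fin n → Pred (Sub n) 0ℓ
    Through v p (V , E) = (IsSubtree G (V , E) × v ∈ˢ V) × p ∈ˢ V

    through? : ∀ v p → Decidable (Through v p)
    through? v p (V , E) = (isSubtree? G (V , E) ×-dec (v ∈ˢ? V)) ×-dec (p ∈ˢ? V)

    through-comm : ∀ v p → length (filter (through? v p) (allSubs n)) ≡ length (filter (through? p v) (allSubs n))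
    through-comm v p = unique-length-≡ (filter⁺ (through? v p) (unique-allSubs n)) (filter⁺ (through? p v) (unique-allSubs n)) flip flip
      where
      flip : ∀ {v p S} → S ∈ filter (through? v p) (allSubs n) → S ∈ filter (through? p v) (allSubs n)
      flip {v} {p} S∈ with ∈-filter⁻ (through? v p) {xs = allSubs n} S∈
      ... | S∈′ , (s , v∈) , p∈ = ∈-filter⁺ (through? p v) S∈′ ((s , p∈) , v∈)

    subtreesThrough-split : ∀ v p → subtreesThrough G v ≡
      length (filter (through? v p) (allSubs n)) + length (filter (avoiding? v p) (allSubs n))
    subtreesThrough-split v p = filter-split
      (λ (V , E) → isSubtree? G (V , E) ×-dec (v ∈ˢ? V)) (through? v p) (avoiding? v p)
      (λ {S} s → case₁ {S} s (p ∈ˢ? proj₁ S)) proj₁ proj₁ (λ (_ , p∈) (_ , p∉) → p∉ p∈) (allSubs n)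
      where
      case₁ : ∀ {S} → IsSubtree G S × v ∈ˢ proj₁ S → Dec (p ∈ˢ proj₁ S) → Through v p S ⊎ Avoiding v p S
      case₁ s (yes p∈) = inj₁ (s , p∈)
      case₁ s (no p∉)  = inj₂ (s , p∉)

    -- Both sides exceed by one the number of subtrees through v or p.
    subtreesThrough-edge : ∀ {p v t u} → Branch G p v t → Branch G v p u →
                           subtreesThrough G v + rootSubs u ≡ subtreesThrough G p + rootSubs t
    subtreesThrough-edge {p} {v} {t} {u} b b′ = begin
      subtreesThrough G v + rootSubs u        ≡⟨ cong₂ _+_ (subtreesThrough-split v p) (sym (count-avoiding b′)) ⟩
      both + onlyV + suc onlyP                ≡⟨ +-assoc both onlyV (suc onlyP) ⟩
      both + (onlyV + suc onlyP)              ≡⟨ cong₂ _+_ (through-comm v p) (trans (+-suc onlyV onlyP) (trans (cong suc (+-comm onlyV onlyP)) (sym (+-suc onlyP onlyV)))) ⟩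
      both′ + (onlyP + suc onlyV)             ≡⟨ sym (+-assoc both′ onlyP (suc onlyV)) ⟩
      both′ + onlyP + suc onlyV               ≡⟨ cong₂ _+_ (sym (subtreesThrough-split p v)) (count-avoiding b) ⟩
      subtreesThrough G p + rootSubs t        ∎
      where
      open ≡-Reasoning
      both  = length (filter (through? v p) (allSubs n))
      both′ = length (filter (through? p v) (allSubs n))
      onlyV = length (filter (avoiding? v p) (allSubs n))
      onlyP = length (filter (avoiding? p v) (allSubs n))

-- Weights, centroid and subtree core

singleton : ∀ {n} {A : Subset n} → ∣ A ∣ ≡ 1 → ∃ λ v → v ∈ˢ A × (∀ {x} → x ∈ˢ A → x ≡ v)
singleton {n} {A} ∣A∣≡1 with nonempty? A
... | no empty with trans (sym (trans (cong ∣_∣ (Empty-unique empty)) (∣⊥∣≡0 n))) ∣A∣≡1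
...   | ()
singleton {n} {A} ∣A∣≡1 | yes (v , v∈) = v , v∈ , only
  where
  only : ∀ {x} → x ∈ˢ A → x ≡ v
  only {x} x∈ with x Fin.≟ v
  ... | yes x≡v = x≡v
  ... | no  x≢v = contradiction
    (subst₂ _<_ (∣⁅x⁆∣≡1 v) ∣A∣≡1 (p⊂q⇒∣p∣<∣q∣ ((λ y∈ → subst (_∈ˢ A) (sym (x∈⁅y⁆⇒x≡y v y∈)) v∈) , x , x∈ , x≢v ∘ x∈⁅y⁆⇒x≡y v)))
    (<-irrefl refl)

module _ {n : ℕ} where

  -- `edgeCount` lists an edge with its smaller endpoint first, a branch lists it with the parent
  -- first; this translates the latter into the former.
  ordered : Fin n × Fin n → Fin n × Fin n
  ordered (x , y) with x Fin.<? y
  ... | yes _ = x , y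
  ... | no  _ = y , x

  ordered-< : ∀ {x y} → x Fin.< y → ordered (x , y) ≡ (x , y)
  ordered-< {x} {y} x<y with x Fin.<? y
  ... | yes _  = refl
  ... | no x≮y = contradiction x<y x≮y

  ordered-> : ∀ {x y} → y Fin.< x → ordered (x , y) ≡ (y , x)
  ordered-> {x} {y} y<x with x Fin.<? y
  ... | yes x<y = contradiction x<y (<-asym y<x)
  ... | no _    = refl

  ordered-injective : ∀ {x y x′ y′} → ordered (x , y) ≡ ordered (x′ , y′) →
                      (x , y) ≡ (x′ , y′) ⊎ (x , y) ≡ (y′ , x′)
  ordered-injective {x} {y} {x′} {y′} e with x Fin.<? y | x′ Fin.<? y′ | e
  ... | yes _ | yes _ | refl = inj₁ refl
  ... | yes _ | no _  | refl = inj₂ refl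
  ... | no _  | yes _ | refl = inj₂ refl
  ... | no _  | no _  | refl = inj₁ refl

module _ {n} {G : Graph n} where
  open Graph G

  -- Every vertex is paired with its parent, so the edge to p is included and there are as many
  -- edges as vertices. This fits the branches that define the weight, which contain p as a pendant
  -- vertex.
  edges : ∀ {p v t} → Branch G p v t → List (Fin n × Fin n)
  edges {p} {v} (leaf _ _)             = (p , v) ∷ []
  edges {p} {v} (node _ _ _ _ _ bl br) = (p , v) ∷ edges bl ++ edges br

  children : ∀ {p v t} (b : Branch G p v t) → map proj₂ (edges b) ≡ verts b
  children (leaf _ _) = refl
  children {v = v} (node _ _ _ _ _ bl br) =
    cong (v ∷_) (trans (map-++ proj₂ (edges bl) (edges br)) (cong₂ _++_ (children bl) (children br)))

  length-edges : ∀ {p v t} (b : Branch G p v t) → length (edges b) ≡ size t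
  length-edges b = trans (sym (length-map proj₂ (edges b))) (trans (cong length (children b)) (length-verts b))

  root-edge : ∀ {p v t} (b : Branch G p v t) → (p , v) ∈ edges b
  root-edge (leaf _ _)           = here refl
  root-edge (node _ _ _ _ _ _ _) = here refl

  edges-sound : ∀ {p v t x y} (b : Branch G p v t) → (x , y) ∈ edges b → (x ≡ p ⊎ x ∈ verts b) × y ∈ verts b × x ~ y
  edges-sound (leaf e _)           (here refl) = inj₁ refl , here refl , symmetric e
  edges-sound (node e _ _ _ _ _ _) (here refl) = inj₁ refl , here refl , symmetric e
  edges-sound (node e _ _ _ _ bl br) (there m) with ∈-++⁻ (edges bl) m
  ... | inj₁ m′ = let x∈ , y∈ , x~y = edges-sound bl m′ in
        inj₂ ([ here , there ∘ ∈-++⁺ˡ ]′ x∈) , there (∈-++⁺ˡ y∈) , x~y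
  ... | inj₂ m′ = let x∈ , y∈ , x~y = edges-sound br m′ in
        inj₂ ([ here , there ∘ ∈-++⁺ʳ (verts bl) ]′ x∈) , there (∈-++⁺ʳ (verts bl) y∈) , x~y

  edges-complete : ∀ {p v t x y} (b : Branch G p v t) → x ∈ verts b → x ~ y → (x , y) ∈ edges b ⊎ (y , x) ∈ edges b
  edges-complete (leaf _ only) (here refl) e with only _ e
  ... | refl = inj₂ (here refl)
  edges-complete (node _ _ _ _ only bl br) (here refl) e with only _ e
  ... | inj₁ refl        = inj₂ (here refl)
  ... | inj₂ (inj₁ refl) = inj₁ (there (∈-++⁺ˡ (root-edge bl)))
  ... | inj₂ (inj₂ refl) = inj₁ (there (∈-++⁺ʳ (edges bl) (root-edge br)))
  edges-complete (node _ _ _ _ _ bl br) (there x∈) e with ∈-++⁻ (verts bl) x∈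
  ... | inj₁ x∈l = [ inj₁ ∘ there ∘ ∈-++⁺ˡ , inj₂ ∘ there ∘ ∈-++⁺ˡ ]′ (edges-complete bl x∈l e)
  ... | inj₂ x∈r = [ inj₁ ∘ there ∘ ∈-++⁺ʳ (edges bl) , inj₂ ∘ there ∘ ∈-++⁺ʳ (edges bl) ]′ (edges-complete br x∈r e)

  verts-joined : ∀ {p v t V x} (b : Branch G p v t) → p ∈ˢ V → (∀ {y} → y ∈ verts b → y ∈ˢ V) →
                 x ∈ verts b → Joined (Inside G V) x p
  verts-joined (leaf e _)           p∈ ⊆V (here refl) = 1 , (⊆V (here refl) , p∈ , e) ∷ []
  verts-joined (node e _ _ _ _ _ _) p∈ ⊆V (here refl) = 1 , (⊆V (here refl) , p∈ , e) ∷ []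
  verts-joined (node e _ _ _ _ bl br) p∈ ⊆V (there x∈) with ∈-++⁻ (verts bl) x∈
  ... | inj₁ x∈l = joined-trans (verts-joined bl (⊆V (here refl)) (⊆V ∘ there ∘ ∈-++⁺ˡ) x∈l)
                     (1 , (⊆V (here refl) , p∈ , e) ∷ [])
  ... | inj₂ x∈r = joined-trans (verts-joined br (⊆V (here refl)) (⊆V ∘ there ∘ ∈-++⁺ʳ (verts bl)) x∈r)
                     (1 , (⊆V (here refl) , p∈ , e) ∷ [])

  module _ (bin : IsBinaryTree) where

    edges-unique : ∀ {p v t} (b : Branch G p v t) → Unique (edges b)
    edges-unique b = map⁻ (subst Unique (sym (children b)) (verts-unique bin b))

    edges-asym : ∀ {p v t x y} (b : Branch G p v t) → (x , y) ∈ edges b → (y , x) ∉ edges b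
    edges-asym b@(leaf _ _)           (here refl) m = parent∉ bin b (proj₁ (proj₂ (edges-sound b m)))
    edges-asym b@(node _ _ _ _ _ _ _) (here refl) m = parent∉ bin b (proj₁ (proj₂ (edges-sound b m)))
    edges-asym b@(node _ _ _ _ _ _ _) m (here refl) = parent∉ bin b (proj₁ (proj₂ (edges-sound b m)))
    edges-asym b@(node _ _ _ a≢b _ bl br) (there m) (there m′) with ∈-++⁻ (edges bl) m | ∈-++⁻ (edges bl) m′
    ... | inj₁ m₁ | inj₁ m₂ = edges-asym bl m₁ m₂
    ... | inj₂ m₁ | inj₂ m₂ = edges-asym br m₁ m₂
    ... | inj₁ m₁ | inj₂ m₂ with proj₁ (edges-sound bl m₁)
    ...   | inj₁ refl = parent∉ bin br (proj₁ (proj₂ (edges-sound br m₂)))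
    ...   | inj₂ x∈l  = siblings-disjoint bin bl br a≢b x∈l (proj₁ (proj₂ (edges-sound br m₂)))
    edges-asym b@(node _ _ _ a≢b _ bl br) (there m) (there m′) | inj₂ m₁ | inj₁ m₂ with proj₁ (edges-sound br m₁)
    ...   | inj₁ refl = parent∉ bin bl (proj₁ (proj₂ (edges-sound bl m₂)))
    ...   | inj₂ x∈r  = siblings-disjoint bin bl br a≢b (proj₁ (proj₂ (edges-sound bl m₂))) x∈r

    ordered-edges-unique : ∀ {p v t} (b : Branch G p v t) → Unique (map ordered (edges b))
    ordered-edges-unique b = unique-map inj (edges-unique b)
      where
      inj : ∀ {e e′} → e ∈ edges b → e′ ∈ edges b → ordered e ≡ ordered e′ → e ≡ e′
      inj e∈ e′∈ eq with ordered-injective eq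
      ... | inj₁ same = same
      ... | inj₂ refl = contradiction e′∈ (edges-asym b e∈)

    length-ordered-edges : ∀ {p v t} (b : Branch G p v t) → length (map ordered (edges b)) ≡ size t
    length-ordered-edges b = trans (length-map ordered (edges b)) (length-edges b)

    private
      Upward : Edges n → Pred (Fin n × Fin n) 0ℓ
      Upward E (u , v) = u Fin.< v × Adj E u v

      upward? : ∀ E → Decidable (Upward E)
      upward? E (u , v) = (u Fin.<? v) ×-dec adj? E u v

      pairs : List (Fin n × Fin n)
      pairs = cartesianProduct (allFin n) (allFin n)

    module _ {p v t} (b : Branch G p v t) where

      private
        ∈extended? : Decidable (λ x → x ≡ p ⊎ x ∈ verts b)
        ∈extended? x = (x Fin.≟ p) ⊎-dec member? Fin._≟_ x (verts b)

      extended : Subset n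
      extended = comprehend ∈extended?

      extended⁺ : ∀ {x} → x ≡ p ⊎ x ∈ verts b → x ∈ˢ extended
      extended⁺ = ∈-comprehend⁺ ∈extended?

      extended⁻ : ∀ {x} → x ∈ˢ extended → x ≡ p ⊎ x ∈ verts b
      extended⁻ = ∈-comprehend⁻ ∈extended?

      extendedSub : Sub n
      extendedSub = extended , induced G extended

      extended-subtree : IsSubtree G extendedSub
      extended-subtree = rooted⇒subtree G (extended⁺ (inj₁ refl) , λ x∈ → join (extended⁻ x∈))
        where
        join : ∀ {x} → x ≡ p ⊎ x ∈ verts b → Joined (Inside G extended) x p
        join (inj₁ refl) = 0 , []
        join (inj₂ x∈)   = verts-joined b (extended⁺ (inj₁ refl)) (extended⁺ ∘ inj₂) x∈

      extended-neighbour : ∀ {y} → y ∈ˢ extended → p ~ y → y ≡ v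
      extended-neighbour y∈ e with extended⁻ y∈
      ... | inj₁ refl = contradiction e (loopless refl)
      ... | inj₂ y∈b with verts-closed b y∈b (symmetric e)
      ...   | inj₁ p∈b       = contradiction p∈b (parent∉ bin b)
      ...   | inj₂ (y≡v , _) = y≡v

      extended-hasPendant : HasPendant G p extendedSub
      extended-hasPendant = extended-subtree , extended⁺ (inj₁ refl) , trans (cong ∣_∣ only) (∣⁅x⁆∣≡1 v)
        where
        only : lookup (induced G extended) p ≡ ⁅ v ⁆
        only = ⊆-antisym
          (λ a → let _ , y∈ , e = induced⁻ G a in subst (_∈ˢ ⁅ v ⁆) (sym (extended-neighbour y∈ e)) (x∈⁅x⁆ v))
          (λ y∈ → subst (Adj (induced G extended) p) (sym (x∈⁅y⁆⇒x≡y v y∈))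
            (induced⁺ G (extended⁺ (inj₁ refl) , extended⁺ (inj₂ (root∈ b)) , symmetric (root~ b))))

      -- The single edge at p leads to v, so a walk from p can only enter the side of v, which it
      -- can leave only through p.
      pendant-within : ∀ {V E} → HasPendant G p (V , E) → Adj E p v → ∀ {x} → x ∈ˢ V → x ≡ p ⊎ x ∈ verts b
      pendant-within {V} {E} ((sub , _ , join) , p∈ , ∣p∣≡1) p–v {x} x∈ = go (inj₁ refl) (proj₂ (join p x p∈ x∈))
        where
        go : ∀ {k x y} → x ≡ p ⊎ x ∈ verts b → Walk (Adj E) k x y → y ≡ p ⊎ y ∈ verts b
        go x∈ []                  = x∈
        go (inj₁ refl) (a ∷ w)    = let _ , _ , only = singleton ∣p∣≡1 in
          go (inj₂ (subst (_∈ verts b) (trans (only p–v) (sym (only a))) (root∈ b))) w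
        go (inj₂ x∈) (a ∷ w) with verts-closed b x∈ (proj₂ (proj₂ (sub _ _ a)))
        ... | inj₁ y∈        = go (inj₂ y∈) w
        ... | inj₂ (_ , y≡p) = go (inj₁ y≡p) w

      extended-isBranch : IsBranch G p extendedSub
      extended-isBranch = extended-hasPendant , maximal
        where
        maximal : ∀ S → HasPendant G p S → extendedSub ⊑ S → S ⊑ extendedSub
        maximal (V , E) h@((sub , _) , _) (_ , ⊆E) = ⊆extended , λ x a →
          let a′ , x∈ , e = sub _ _ a in induced⁺ G (⊆extended x∈ , ⊆extended (proj₁ (proj₂ (sub _ _ a′))) , e)
          where
          ⊆extended : ∀ {x} → x ∈ˢ V → x ∈ˢ extended
          ⊆extended x∈ = extended⁺ (pendant-within {E = E} h
            (⊆E p (induced⁺ G (extended⁺ (inj₁ refl) , extended⁺ (inj₂ (root∈ b)) , symmetric (root~ b)))) x∈)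

      size≤edgeCount : size t ≤ edgeCount extendedSub
      size≤edgeCount = ≤-trans (≤-reflexive (sym (length-ordered-edges b)))
        (unique-length-≤ (ordered-edges-unique b) present)
        where
        present : ∀ {e} → e ∈ map ordered (edges b) → e ∈ filter (upward? (induced G extended)) pairs
        present e∈ with ∈-map⁻ ordered e∈
        ... | (x , y) , xy∈ , refl with edges-sound b xy∈
        ...   | x∈ , y∈ , x~y with Fin.<-cmp x y
        ...     | tri< x<y _ _ = subst (_∈ _) (sym (ordered-< x<y))
                    (∈-filter⁺ (upward? (induced G extended)) (∈-cartesianProduct⁺ (∈-allFin x) (∈-allFin y))
                      (x<y , induced⁺ G (extended⁺ x∈ , extended⁺ (inj₂ y∈) , x~y)))
        ...     | tri> _ _ y<x = subst (_∈ _) (sym (ordered-> y<x))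
                    (∈-filter⁺ (upward? (induced G extended)) (∈-cartesianProduct⁺ (∈-allFin y) (∈-allFin x))
                      (y<x , induced⁺ G (extended⁺ (inj₂ y∈) , extended⁺ x∈ , symmetric x~y)))
        ...     | tri≈ _ x≡y _ = contradiction x~y (loopless x≡y)

      edgeCount≤size : ∀ {V E} → HasPendant G p (V , E) → Adj E p v → edgeCount (V , E) ≤ size t
      edgeCount≤size {V} {E} h@((sub , _) , _) p–v = ≤-trans
        (unique-length-≤ (filter⁺ (upward? E) (cartesianProduct⁺ (allFin⁺ n) (allFin⁺ n))) present)
        (≤-reflexive (length-ordered-edges b))
        where
        present : ∀ {e} → e ∈ filter (upward? E) pairs → e ∈ map ordered (edges b)
        present {x , y} e∈ with ∈-filter⁻ (upward? E) {xs = pairs} e∈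
        ... | _ , x<y , a with sub x y a
        ...   | a′ , x∈ , x~y with (both (pendant-within {E = E} h p–v x∈) (pendant-within {E = E} h p–v (proj₁ (proj₂ (sub y x a′)))))
          where
          both : x ≡ p ⊎ x ∈ verts b → y ≡ p ⊎ y ∈ verts b → (x , y) ∈ edges b ⊎ (y , x) ∈ edges b
          both (inj₂ x∈) _ = edges-complete b x∈ x~y
          both _ (inj₂ y∈) = [ inj₂ , inj₁ ]′ (edges-complete b y∈ (symmetric x~y))
          both (inj₁ refl) (inj₁ refl) = contradiction x~y (loopless refl)
        ...     | inj₁ m = subst (_∈ _) (ordered-< x<y) (∈-map⁺ ordered m)
        ...     | inj₂ m = subst (_∈ _) (ordered-> x<y) (∈-map⁺ ordered m)

      size≤weight : size t ≤ weight G p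
      size≤weight = v≤max⁺ 0 (map edgeCount (filter (isBranch? G p) (allSubs n)))
        (inj₂ (Any.map (λ { refl → size≤edgeCount }) (∈-map⁺ edgeCount (∈-filter⁺ (isBranch? G p) (∈-allSubs extendedSub) extended-isBranch))))

    -- Each branch at p starts with an edge to one neighbour v and by `edgeCount≤size` has no more
    -- edges than the side of v has vertices.
    weight≤ : ∀ {p M} → (∀ {v t} → Branch G p v t → size t ≤ M) → weight G p ≤ M
    weight≤ {p} {M} small = max≤v⁺ z≤n (All.tabulate bound)
      where
      bound : ∀ {k} → k ∈ map edgeCount (filter (isBranch? G p) (allSubs n)) → k ≤ M
      bound k∈ with ∈-map⁻ edgeCount k∈
      ... | (V , E) , S∈ , refl with ∈-filter⁻ (isBranch? G p) {xs = allSubs n} S∈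
      ...   | _ , h@((sub , _) , _ , ∣p∣≡1) , _ with singleton ∣p∣≡1
      ...     | v , p–v , _ = let _ , b = branch bin (symmetric (proj₂ (proj₂ (sub p v p–v)))) in
                  ≤-trans (edgeCount≤size b {E = E} h p–v) (small b)

    size-unique : ∀ {p v t u} → Branch G p v t → Branch G p v u → size t ≡ size u
    size-unique {t = t} {u} b b′ = let w , o = branch bin (symmetric (root~ b)) in
      +-cancelʳ-≡ (size w) (size t) (size u) (trans (size-sum bin b o) (sym (size-sum bin b′ o)))

    -- The sides seen from w are the far side u and the children of t, and each child has fewer
    -- vertices than t.
    weight-root≤ : ∀ {q w t u M} → Branch G q w t → Branch G w q u → size u ≤ M → size t ≤ suc M → weight G w ≤ M
    weight-root≤ (leaf _ only) o u≤ t≤ = weight≤ λ b → case₁ b (only _ (symmetric (root~ b)))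
      where
      case₁ : ∀ {v t} → Branch G _ v t → v ≡ _ → size t ≤ _
      case₁ b refl = ≤-trans (≤-reflexive (size-unique b o)) u≤
    weight-root≤ (node {l = l} {r} _ _ _ _ only bl br) o u≤ (s≤s t≤) = weight≤ λ b → case₁ b (only _ (symmetric (root~ b)))
      where
      case₁ : ∀ {v t} → Branch G _ v t → v ≡ _ ⊎ v ≡ _ ⊎ v ≡ _ → size t ≤ _
      case₁ b (inj₁ refl)        = ≤-trans (≤-reflexive (size-unique b o)) u≤
      case₁ b (inj₂ (inj₁ refl)) = ≤-trans (≤-reflexive (size-unique b bl)) (≤-trans (m≤m+n (size l) (size r)) t≤)
      case₁ b (inj₂ (inj₂ refl)) = ≤-trans (≤-reflexive (size-unique b br)) (≤-trans (m≤n+m (size r) (size l)) t≤)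

    module _ {p v a b l r u} (v~p : v ~ p) (a≢p : a ≢ p) (b≢p : b ≢ p) (a≢b : a ≢ b)
             (only : ∀ w → v ~ w → w ≡ p ⊎ w ≡ a ⊎ w ≡ b)
             (bl : Branch G v a l) (br : Branch G v b r) (o : Branch G v p u) where

      -- Moving across the edge v a: seen from a, the far side has root v, and its children are the
      -- old far side u and the sibling of a.
      turn-left : Branch G a v (node u r)
      turn-left = node (symmetric (root~ bl)) (a≢p ∘ sym) (a≢b ∘ sym) (b≢p ∘ sym)
        (λ w e → [ inj₂ ∘ inj₁ , [ inj₁ , inj₂ ∘ inj₂ ]′ ]′ (only w e)) o br

      turn-right : Branch G b v (node u l)
      turn-right = node (symmetric (root~ br)) (b≢p ∘ sym) a≢b (a≢p ∘ sym)
        (λ w e → [ inj₂ ∘ inj₁ , [ inj₂ ∘ inj₂ , inj₁ ]′ ]′ (only w e)) o bl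

    -- On the way from q down to z the far side only gains vertices, so all of t lies in one branch
    -- at z.
    size≤weight-below : ∀ {w q t u z} (b : Branch G w q u) → Branch G q w t → z ∈ verts b → size t ≤ weight G z
    size≤weight-below (leaf _ _)           o (here refl) = size≤weight o
    size≤weight-below (node _ _ _ _ _ _ _) o (here refl) = size≤weight o
    size≤weight-below {t = t} (node {l = l} {r} e ap bp ab only bl br) o (there z∈) with ∈-++⁻ (verts bl) z∈
    ... | inj₁ z∈l = ≤-trans (≤-trans (m≤m+n (size t) (size r)) (n≤1+n _))
                       (size≤weight-below bl (turn-left e ap bp ab only bl br o) z∈l)
    ... | inj₂ z∈r = ≤-trans (≤-trans (m≤m+n (size t) (size l)) (n≤1+n _))
                       (size≤weight-below br (turn-right e ap bp ab only bl br o) z∈r)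

    -- Stepping across to w leaves only sides of order less than that of t, whereas z still has all
    -- of t on one side.
    ¬centroid-below : ∀ {w q t u z} (b : Branch G w q u) → Branch G q w t → size u < size t → z ∈ verts b → ¬ Centroid G z
    ¬centroid-below {w} {t = t} {u} {z} b o u<t z∈ central with size t in t≡ | u<t
    ... | suc M | s≤s u≤M = <-irrefl refl (≤-trans (≤-reflexive (sym t≡)) (≤-trans (size≤weight-below b o z∈)
            (≤-trans (central w) (weight-root≤ o b u≤M (≤-reflexive t≡)))))

    centroid-edge : ∀ {x y t u} → Branch G x y t → Branch G y x u → Centroid G x → ¬ Centroid G y → size t < size u
    centroid-edge {x} {y} {t} {u} b o cx ¬cy with size u ≤? size t
    ... | no u≰t  = ≰⇒> u≰t
    ... | yes u≤t = contradiction
      (λ z → ≤-trans (≤-trans (weight-root≤ b o u≤t (n≤1+n _)) (size≤weight b)) (cx z)) ¬cy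

    core-edge : ∀ {x y t u} → Branch G x y t → Branch G y x u → SubtreeCore G y → ¬ SubtreeCore G x → rootSubs u < rootSubs t
    core-edge {x} {y} {t} {u} b o cy ¬cx with subtreesThrough G y ≤? subtreesThrough G x
    ... | yes y≤x = contradiction (λ z → ≤-trans (cy z) y≤x) ¬cx
    ... | no y≰x  = +-cancelˡ-< (subtreesThrough G x) (rootSubs u) (rootSubs t)
      (≤-trans (+-monoˡ-< (rootSubs u) (≰⇒> y≰x)) (≤-reflexive (subtreesThrough-edge bin b o)))

    ¬core-root : ∀ {p v t u} → Branch G p v t → Branch G v p u → rootSubs t < rootSubs u → ¬ SubtreeCore G v
    ¬core-root {p} b o t<u core = <-irrefl (subtreesThrough-edge bin o b) (+-mono-≤-< (core p) t<u)

    -- On the way down the near side loses root-containing subtrees and the far side gains them, so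
    -- the inequality persists at every edge.
    ¬core-below : ∀ {p v t u z} (b : Branch G p v t) → Branch G v p u → rootSubs t < rootSubs u → z ∈ verts b → ¬ SubtreeCore G z
    ¬core-below b@(leaf _ _)           o t<u (here refl) = ¬core-root b o t<u
    ¬core-below b@(node _ _ _ _ _ _ _) o t<u (here refl) = ¬core-root b o t<u
    ¬core-below {u = u} (node {l = l} {r} e ap bp ab only bl br) o t<u (there z∈) with ∈-++⁻ (verts bl) z∈
    ... | inj₁ z∈l = ¬core-below bl (turn-left e ap bp ab only bl br o)
                       (<-trans (rootSubs-left l r) (<-trans t<u (rootSubs-left u r))) z∈l
    ... | inj₂ z∈r = ¬core-below br (turn-right e ap bp ab only bl br o)
                       (<-trans (rootSubs-right l r) (<-trans t<u (rootSubs-left u l))) z∈r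

-- Trees given by parents

half-even : ∀ i → ⌊ i + i /2⌋ ≡ i
half-even i = sym (n≡⌊n+n/2⌋ i)

half-odd : ∀ i → ⌊ suc (i + i) /2⌋ ≡ i
half-odd zero    = refl
half-odd (suc i) = cong suc (trans (cong ⌊_/2⌋ (+-suc i i)) (half-odd i))

half-cases : ∀ k → k ≡ ⌊ k /2⌋ + ⌊ k /2⌋ ⊎ k ≡ suc (⌊ k /2⌋ + ⌊ k /2⌋)
half-cases zero          = inj₁ refl
half-cases (suc zero)    = inj₂ refl
half-cases (suc (suc k)) = Sum.map
  (λ e → cong suc (trans (cong suc e) (sym (+-suc ⌊ k /2⌋ ⌊ k /2⌋))))
  (λ e → cong suc (trans (cong suc e) (cong suc (sym (+-suc ⌊ k /2⌋ ⌊ k /2⌋)))))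
  (half-cases k)

module _ {n} (G : Graph n) where
  open Graph G

  dist-walk : ∀ x y → Walk _~_ (dist x y) x y
  dist-walk x y = proj₁ (proj₂ (shortest x y))

  dist-≤ : ∀ {k x y} → Walk _~_ k x y → dist x y ≤ k
  dist-≤ {k} {x} {y} = proj₂ (proj₂ (shortest x y)) k

  -- The source of all lower bounds on distances: a label that grows by at most one along an edge
  -- bounds the length of every walk.
  walk-lipschitz : ∀ (φ : Fin n → ℕ) → (∀ {x y} → x ~ y → φ y ≤ suc (φ x)) →
                   ∀ {k x y} → Walk _~_ k x y → φ y ≤ k + φ x
  walk-lipschitz φ lip []                = ≤-refl
  walk-lipschitz φ lip {suc k} (e ∷ w) =
    ≤-trans (walk-lipschitz φ lip w) (≤-trans (+-monoʳ-≤ k (lip e)) (≤-reflexive (+-suc k _)))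

  degree-≡ : ∀ v xs → Unique xs → (∀ {w} → w ∈ xs → v ~ w) → (∀ {w} → v ~ w → w ∈ xs) → degree v ≡ length xs
  degree-≡ v xs xs! sound complete = unique-length-≡ (filter⁺ (v ~?_) (allFin⁺ n)) xs!
    (λ w∈ → complete (proj₂ (∈-filter⁻ (v ~?_) {xs = allFin n} w∈)))
    (λ w∈ → ∈-filter⁺ (v ~?_) (∈-allFin _) (sound w∈))

  degree-one : ∀ {v p} → v ~ p → (∀ w → v ~ w → w ≡ p) → degree v ≡ 1
  degree-one {v} {p} e only = degree-≡ v (p ∷ []) ([] ∷ []) (λ { (here refl) → e }) (λ e′ → here (only _ e′))

  degree-two : ∀ {v a b} → v ~ a → v ~ b → a ≢ b → (∀ w → v ~ w → w ≡ a ⊎ w ≡ b) → degree v ≡ 2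
  degree-two {v} {a} {b} va vb a≢b only = degree-≡ v (a ∷ b ∷ []) ((a≢b ∷ []) ∷ [] ∷ [])
    (λ { (here refl) → va ; (there (here refl)) → vb }) (λ e → [ here , there ∘ here ]′ (only _ e))

  degree-three : ∀ {v p a b} → v ~ p → v ~ a → v ~ b → a ≢ p → b ≢ p → a ≢ b →
                 (∀ w → v ~ w → w ≡ p ⊎ w ≡ a ⊎ w ≡ b) → degree v ≡ 3
  degree-three {v} {p} {a} {b} vp va vb a≢p b≢p a≢b only =
    degree-≡ v (p ∷ a ∷ b ∷ []) ((a≢p ∘ sym ∷ b≢p ∘ sym ∷ []) ∷ (a≢b ∷ []) ∷ [] ∷ [])
      (λ { (here refl) → vp ; (there (here refl)) → va ; (there (there (here refl))) → vb })
      (λ e → [ here , [ there ∘ here , there ∘ there ∘ here ]′ ]′ (only _ e))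

-- Vertex suc k of the tree described by π has parent π k; vertex 0 has none.
Parent : (ℕ → ℕ) → ℕ → ℕ → Set
Parent π zero    j = ⊥
Parent π (suc k) j = π k ≡ j

parent? : ∀ π → Decidable₂ (Parent π)
parent? π zero    j = no id
parent? π (suc k) j = π k ≟ j

parent-functional : ∀ π {i j j′} → Parent π i j → Parent π i j′ → j ≡ j′
parent-functional π {suc k} refl e = e

module _ (n : ℕ) (0<n : 0 < n) (π : ℕ → ℕ) (π≤ : ∀ k → π k ≤ k) where

  parent-< : ∀ {i j} → Parent π i j → j < i
  parent-< {suc k} refl = s≤s (π≤ k)

  private
    _—_ : Rel (Fin n) 0ℓ
    u — v = Parent π (toℕ u) (toℕ v) ⊎ Parent π (toℕ v) (toℕ u)

    root : Fin n
    root = fromℕ< 0<n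

    climb : ∀ m (v : Fin n) → toℕ v ≤ m → Joined _—_ v root
    climb m v v≤m with toℕ v in v≡ | m
    ... | zero  | _     = 0 , subst (Walk _—_ 0 v) (toℕ-injective (trans v≡ (sym (toℕ-fromℕ< 0<n)))) []
    climb _ v v≤m | suc k | zero with v≤m
    ... | ()
    climb _ v v≤m | suc k | suc m =
      let p<n = <-trans (s≤s (π≤ k)) (subst (_< n) v≡ (toℕ<n v))
          _ , w = climb m (fromℕ< p<n) (≤-trans (≤-reflexive (toℕ-fromℕ< p<n)) (≤-trans (π≤ k) (≤-pred v≤m)))
      in _ , inj₁ (subst₂ (Parent π) (sym v≡) (sym (toℕ-fromℕ< p<n)) refl) ∷ w

  parentGraph : Graph n
  parentGraph = record
    { nonZero   = >-nonZero 0<n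
    ; _~_       = _—_
    ; _~?_      = λ u v → parent? π (toℕ u) (toℕ v) ⊎-dec parent? π (toℕ v) (toℕ u)
    ; symmetric = swap
    ; loopless  = λ { refl (inj₁ p) → <-irrefl refl (parent-< p) ; refl (inj₂ p) → <-irrefl refl (parent-< p) }
    ; connected = λ u v → joined-trans (climb _ u ≤-refl) (joined-sym swap (climb _ v ≤-refl))
    }

  open Graph parentGraph using (_~_; degree; symmetric; IsTree)

  -- The largest vertex of a cycle would have both its neighbours as parent.
  parentGraph-tree : IsTree
  parentGraph-tree {k} p (2≤k , (inj , adjacent) , close) =
    no-top 2≤k (view top) (λ i → All.lookup (f[xs]≤f[argmax] {f = toℕ ∘ p} zero (allFin (suc k))) (∈-allFin i))
    where
    top : Fin (suc k)
    top = argmax (toℕ ∘ p) zero (allFin (suc k))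

    same : ∀ {t} → (∀ i → toℕ (p i) ≤ toℕ (p t)) → ∀ i j → p t ~ p i → p t ~ p j → i ≡ j
    same {t} max i j e e′ = inj (toℕ-injective (parent-functional π (up i e) (up j e′)))
      where
      up : ∀ i → p t ~ p i → Parent π (toℕ (p t)) (toℕ (p i))
      up i (inj₁ q) = q
      up i (inj₂ q) = contradiction (≤-trans (parent-< q) (max i)) (<-irrefl refl)

    -- Which positions are next to the largest vertex on the cycle depends on whether it stands
    -- last, first or in between; 2 ≤ k keeps the two positions distinct.
    no-top : 2 ≤ k → ∀ {t} → View t → (∀ i → toℕ (p i) ≤ toℕ (p t)) → ⊥
    no-top (s≤s (s≤s {n = m} _)) ‵fromℕ max
      with same max (inject₁ (fromℕ (suc m))) zero (symmetric (adjacent (fromℕ (suc m)))) close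
    ... | ()
    no-top (s≤s (s≤s {n = m} _)) (‵inj₁ {i = zero} _) max
      with same max (suc zero) (fromℕ (suc (suc m))) (adjacent zero) (symmetric close)
    ... | ()
    no-top (s≤s (s≤s _)) (‵inj₁ {i = suc j} _) max = <-irrefl
      (trans (sym (trans (toℕ-inject₁ (inject₁ j)) (toℕ-inject₁ j)))
        (cong toℕ (same max (inject₁ (inject₁ j)) (suc (suc j)) (symmetric (adjacent (inject₁ j))) (adjacent (suc j)))))
      (s≤s (n≤1+n (toℕ j)))

  has-parent : ∀ (v : Fin n) → 0 < toℕ v → ∃ λ p → Parent π (toℕ v) (toℕ p)
  has-parent v 0<v with toℕ v | 0<v | toℕ<n v
  ... | suc k | _ | 1+k<n = fromℕ< p<n , sym (toℕ-fromℕ< p<n)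
    where
    p<n : π k < n
    p<n = <-trans (s≤s (π≤ k)) 1+k<n

  only-parent : ∀ {v p w : Fin n} → Parent π (toℕ v) (toℕ p) → Parent π (toℕ v) (toℕ w) → w ≡ p
  only-parent q q′ = toℕ-injective (parent-functional π q′ q)

  pendant-degree : ∀ {v p} → Parent π (toℕ v) (toℕ p) → (∀ w → ¬ Parent π (toℕ w) (toℕ v)) → degree v ≡ 1
  pendant-degree q none = degree-one parentGraph (inj₁ q)
    λ { w (inj₁ q′) → only-parent q q′ ; w (inj₂ q′) → contradiction q′ (none w) }

  grandparent≢ : ∀ {v p a : Fin n} → Parent π (toℕ v) (toℕ p) → Parent π (toℕ a) (toℕ v) → a ≢ p
  grandparent≢ q r refl = <-asym (parent-< q) (parent-< r)

  inner-degree : ∀ {v p a b} → Parent π (toℕ v) (toℕ p) → Parent π (toℕ a) (toℕ v) → Parent π (toℕ b) (toℕ v) → a ≢ b →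
                 (∀ w → Parent π (toℕ w) (toℕ v) → w ≡ a ⊎ w ≡ b) → degree v ≡ 3
  inner-degree q qa qb a≢b only = degree-three parentGraph (inj₁ q) (inj₂ qa) (inj₂ qb)
    (grandparent≢ q qa) (grandparent≢ q qb) a≢b
    λ { w (inj₁ q′) → inj₁ (only-parent q q′) ; w (inj₂ q′) → inj₂ (only w q′) }

-- The rgood tree

double-< : ∀ {i j} → i < j → suc (i + i) < j + j
double-< {i} {j} i<j = ≤-trans (≤-reflexive (cong suc (sym (+-suc i i)))) (+-mono-≤ i<j i<j)

half-< : ∀ {c k} → k < c + c → ⌊ k /2⌋ < c
half-< {c} {k} k< = ≰⇒> λ c≤ → <⇒≱ k< (≤-trans (+-mono-≤ c≤ c≤)
  ([ (λ e → ≤-reflexive (sym e)) , (λ e → ≤-trans (n≤1+n _) (≤-reflexive (sym e))) ]′ (half-cases k)))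

heap-child : ∀ {w v} → Parent ⌊_/2⌋ w v → w ≡ suc (v + v) ⊎ w ≡ suc (suc (v + v))
heap-child {suc k} refl = [ inj₁ ∘ cong suc , inj₂ ∘ cong suc ]′ (half-cases k)

heap-childless : ∀ {c v w} → c ≤ v → w < suc (c + c) → ¬ Parent ⌊_/2⌋ w v
heap-childless {c} {v} c≤v w< q with heap-child q
... | inj₁ refl = <-irrefl refl (≤-trans (≤-pred w<) (+-mono-≤ c≤v c≤v))
... | inj₂ refl = <-irrefl refl (≤-trans (≤-pred w<) (≤-trans (+-mono-≤ c≤v c≤v) (n≤1+n _)))

heap-mono : ∀ {i j x y} → Parent ⌊_/2⌋ x i → Parent ⌊_/2⌋ y j → i < j → x < y
heap-mono {x = suc k} {suc m} refl refl i<j = s≤s (≰⇒> λ m≤k → <-irrefl refl (≤-trans i<j (⌊n/2⌋-mono m≤k)))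

heap-anti : ∀ {i j x y} → Parent ⌊_/2⌋ x i → Parent ⌊_/2⌋ y j → x < y → i ≤ j
heap-anti {x = suc k} {suc m} refl refl x<y = ⌊n/2⌋-mono (≤-pred (<⇒≤ x<y))

module Depth (π : ℕ → ℕ) (π≤ : ∀ k → π k ≤ k) where

  -- The first argument bounds the recursion; it is immaterial once it is at least the vertex.
  ascend : ℕ → ℕ → ℕ
  ascend zero    _       = 0
  ascend (suc f) zero    = 0
  ascend (suc f) (suc k) = suc (ascend f (π k))

  ascend-fuel : ∀ f f′ {i} → i ≤ f → i ≤ f′ → ascend f i ≡ ascend f′ i
  ascend-fuel zero    zero     {zero}  _ _ = refl
  ascend-fuel zero    (suc f′) {zero}  _ _ = refl
  ascend-fuel (suc f) zero     {zero}  _ _ = refl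
  ascend-fuel (suc f) (suc f′) {zero}  _ _ = refl
  ascend-fuel (suc f) (suc f′) {suc k} (s≤s i≤f) (s≤s i≤f′) =
    cong suc (ascend-fuel f f′ (≤-trans (π≤ k) i≤f) (≤-trans (π≤ k) i≤f′))

  depth : ℕ → ℕ
  depth i = ascend i i

  depth-parent : ∀ {i j} → Parent π i j → depth i ≡ suc (depth j)
  depth-parent {suc k} refl = cong suc (ascend-fuel k (π k) (π≤ k) ≤-refl)

  depth-mono : (∀ {i j} → i ≤ j → π i ≤ π j) → ∀ {i j} → i ≤ j → depth i ≤ depth j
  depth-mono π-mono {i} {j} i≤j = ≤-trans (≤-reflexive (ascend-fuel i j ≤-refl i≤j)) (go j i≤j)
    where
    go : ∀ f {i j} → i ≤ j → ascend f i ≤ ascend f j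
    go zero    _         = z≤n
    go (suc f) z≤n       = z≤n
    go (suc f) (s≤s i≤j) = s≤s (go f (π-mono i≤j))

  module _ (n : ℕ) (0<n : 0 < n) where

    private
      G = parentGraph n 0<n π π≤
      root = fromℕ< 0<n

    open Graph G using (_~_; dist; symmetric)

    height≡depth : ∀ v → dist root v ≡ depth (toℕ v)
    height≡depth v = ≤-antisym (dist-≤ G (descend _ v ≤-refl))
      (≤-trans (walk-lipschitz G (depth ∘ toℕ) lipschitz (dist-walk G root v))
        (≤-reflexive (trans (cong (λ i → dist root v + depth i) (toℕ-fromℕ< 0<n)) (+-identityʳ _))))
      where
      lipschitz : ∀ {x y} → x ~ y → depth (toℕ y) ≤ suc (depth (toℕ x))
      lipschitz (inj₁ q) = ≤-trans (≤-trans (n≤1+n _) (≤-reflexive (sym (depth-parent q)))) (n≤1+n _)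
      lipschitz (inj₂ q) = ≤-reflexive (depth-parent q)
      descend : ∀ m v → toℕ v ≤ m → Walk _~_ (depth (toℕ v)) root v
      descend m v v≤m with toℕ v ≟ 0
      ... | yes v≡0 = subst₂ (λ d u → Walk _~_ d root u) (cong depth (sym v≡0))
                        (toℕ-injective (trans (toℕ-fromℕ< 0<n) (sym v≡0))) []
      descend zero    v v≤m | no v≢0 = contradiction (n≤0⇒n≡0 v≤m) v≢0
      descend (suc m) v v≤m | no v≢0 =
        let p , q = has-parent n 0<n π π≤ v (n≢0⇒n>0 v≢0)
            w = descend m p (≤-pred (≤-trans (parent-< n 0<n π π≤ q) v≤m))
        in subst (λ d → Walk _~_ d root v) (trans (+-comm _ 1) (sym (depth-parent q))) (w ++ʷ (inj₂ q ∷ []))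

-- The heap numbering: vertex i has the children 2 i + 1 and 2 i + 2. Of the 2 c + 1 vertices
-- exactly those below c have children.
module RGood (c l : ℕ) (0<c : 0 < c) (l≡ : l ≡ suc (c + c)) where

  0<l : 0 < l
  0<l = subst (0 <_) (sym l≡) (s≤s z≤n)

  R : Graph l
  R = parentGraph l 0<l ⌊_/2⌋ ⌊n/2⌋≤n

  root : Fin l
  root = fromℕ< 0<l

  open Graph R
  open Depth ⌊_/2⌋ ⌊n/2⌋≤n

  root≡ : ∀ {v} → toℕ v ≡ 0 → v ≡ root
  root≡ v≡0 = toℕ-injective (trans v≡0 (sym (toℕ-fromℕ< 0<l)))

  vertex : ∀ {i} → i < suc (c + c) → ∃ λ (v : Fin l) → toℕ v ≡ i
  vertex {i} i< = fromℕ< i<l , toℕ-fromℕ< i<l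
    where
    i<l : i < l
    i<l = subst (i <_) (sym l≡) i<

  bounded : ∀ (v : Fin l) → toℕ v < suc (c + c)
  bounded v = subst (toℕ v <_) l≡ (toℕ<n v)

  children-of : ∀ (v : Fin l) → toℕ v < c → ∃₂ λ (a b : Fin l) → Parent ⌊_/2⌋ (toℕ a) (toℕ v) × Parent ⌊_/2⌋ (toℕ b) (toℕ v) × a ≢ b ×
                (∀ w → Parent ⌊_/2⌋ (toℕ w) (toℕ v) → w ≡ a ⊎ w ≡ b)
  children-of v v<c =
    let a , a≡ = vertex (s≤s (<⇒≤ (double-< v<c)))
        b , b≡ = vertex (s≤s (double-< v<c))
        i = toℕ v
    in a , b , subst (λ x → Parent ⌊_/2⌋ x i) (sym a≡) (half-even i) , subst (λ x → Parent ⌊_/2⌋ x i) (sym b≡) (half-odd i) ,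
       (λ a≡b → <-irrefl (trans (sym a≡) (trans (cong toℕ a≡b) b≡)) ≤-refl) ,
       λ w q → [ (λ e → inj₁ (toℕ-injective (trans e (sym a≡)))) , (λ e → inj₂ (toℕ-injective (trans e (sym b≡)))) ]′ (heap-child q)

  degree-leaf : ∀ v → c ≤ toℕ v → degree v ≡ 1
  degree-leaf v c≤v = let p , q = has-parent l 0<l ⌊_/2⌋ ⌊n/2⌋≤n v (≤-trans 0<c c≤v) in
    pendant-degree l 0<l ⌊_/2⌋ ⌊n/2⌋≤n q (λ w → heap-childless c≤v (bounded w))

  degree-inner : ∀ v → 0 < toℕ v → toℕ v < c → degree v ≡ 3
  degree-inner v 0<v v<c =
    let p , q = has-parent l 0<l ⌊_/2⌋ ⌊n/2⌋≤n v 0<v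
        a , b , qa , qb , a≢b , only = children-of v v<c
    in inner-degree l 0<l ⌊_/2⌋ ⌊n/2⌋≤n q qa qb a≢b only

  degree-root : degree root ≡ 2
  degree-root =
    let a , b , qa , qb , a≢b , only = children-of root (subst (_< c) (sym (toℕ-fromℕ< 0<l)) 0<c)
    in degree-two R (inj₂ qa) (inj₂ qb) a≢b
         λ { w (inj₁ q) → contradiction (subst (λ i → Parent ⌊_/2⌋ i (toℕ w)) (toℕ-fromℕ< 0<l) q) id ; w (inj₂ q) → only w q }

  pendant⇒leaf : ∀ v → Pendant v → c ≤ toℕ v
  pendant⇒leaf v pend with c ≤? toℕ v | toℕ v ≟ 0
  ... | yes c≤v | _ = c≤v
  ... | no  _   | yes v≡0 with trans (sym pend) (trans (cong degree (root≡ v≡0)) degree-root)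
  ...   | ()
  pendant⇒leaf v pend | no c≰v | no v≢0 with trans (sym pend) (degree-inner v (n≢0⇒n>0 v≢0) (≰⇒> c≰v))
  ...   | ()

  rooted-binary : IsRootedBinaryTree R root
  rooted-binary = parentGraph-tree l 0<l ⌊_/2⌋ ⌊n/2⌋≤n , inj₂ (degree-root , other)
    where
    other : ∀ v → v ≢ root → degree v ≡ 1 ⊎ degree v ≡ 3
    other v v≢root with c ≤? toℕ v
    ... | yes c≤v = inj₁ (degree-leaf v c≤v)
    ... | no c≰v  = inj₂ (degree-inner v (n≢0⇒n>0 (v≢root ∘ root≡)) (≰⇒> c≰v))

  heights : ∀ v → height R root v ≡ depth (toℕ v)
  heights = height≡depth l 0<l

  -- Depth is monotone in the number, and the parent of u has a number below c, while the pendant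
  -- vertex v has a number at least c.
  pendant-heights : ∀ u v → Pendant u → Pendant v → height R root u ≤ suc (height R root v)
  pendant-heights u v _ pv rewrite heights u | heights v with toℕ u in u≡
  ... | zero  = z≤n
  ... | suc k = ≤-trans (≤-reflexive (depth-parent {suc k} refl))
    (s≤s (depth-mono ⌊n/2⌋-mono (<⇒≤ (≤-trans (half-< (≤-pred (subst (_< suc (c + c)) u≡ (bounded u)))) (pendant⇒leaf v pv)))))

  -- Decreasing numbers: the heap numbering fills the last level from its smallest parents on, and
  -- these have to form a final segment.
  _≻_ : Rel (Fin l) 0ℓ
  u ≻ w = toℕ w < toℕ u

  parent-link : ∀ {u x} → IsParentOf R root u x → Parent ⌊_/2⌋ (toℕ x) (toℕ u)
  parent-link (inj₂ q , _) = q
  parent-link {u} {x} (inj₁ q , h) = contradiction (s≤s (n≤1+n (depth (toℕ x)))) (<-irrefl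
    (trans (sym (heights x)) (trans h (cong suc (trans (heights u) (depth-parent q))))))

  ordering : IsOrdering R root _≻_
  ordering =
    (λ h _ → On.isStrictTotalOrder proj₁ (Flip.isStrictTotalOrder Fin.<-isStrictTotalOrder)) ,
    λ {u} {w} {x} {y} _ _ u≢w ux wy → mk⇔
      (λ w<u → heap-mono (parent-link wy) (parent-link ux) w<u)
      (λ y<x → ≤∧≢⇒< (heap-anti (parent-link wy) (parent-link ux) y<x) (λ e → u≢w (toℕ-injective (sym e))))

  -- Having a smaller number than u, which has children, w has children as well. They are as high as
  -- v; were one not pendant, its own child would be higher than v.
  final-segment : ∀ u w → ParentOfTopPendant R root u → height R root u ≡ height R root w → u ≻ w → ParentOfTopPendant R root w
  final-segment u w (v , (_ , top) , uv) hu≡hw w<u = a , (pendant , λ x → ≤-trans (top x) (≤-reflexive v≡a)) , inj₂ qa , ha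
    where
    w<c : toℕ w < c
    w<c = <-trans w<u (≰⇒> λ c≤u → heap-childless c≤u (bounded v) (parent-link uv))
    kids = children-of w w<c
    a : Fin l
    a = proj₁ kids
    qa : Parent ⌊_/2⌋ (toℕ a) (toℕ w)
    qa = proj₁ (proj₂ (proj₂ kids))
    ha : height R root a ≡ suc (height R root w)
    ha = trans (heights a) (trans (depth-parent qa) (cong suc (sym (heights w))))
    v≡a : height R root v ≡ height R root a
    v≡a = trans (proj₂ uv) (trans (cong suc hu≡hw) (sym ha))
    pendant : Pendant a
    pendant with c ≤? toℕ a
    ... | yes c≤a = degree-leaf a c≤a
    ... | no c≰a  = let x , _ , qx , _ = children-of a (≰⇒> c≰a) in contradiction
      (≤-trans (≤-reflexive (trans (sym (depth-parent qx)) (sym (heights x)))) (≤-trans (top x) (≤-reflexive (trans v≡a (heights a)))))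
      (<-irrefl refl)

  rgood : IsRGood R root
  rgood = rooted-binary , pendant-heights , _≻_ , ordering , final-segment

-- The binary caterpillar

-- Vertex 0 is a pendant end, the odd vertices form the spine, and 2 j + 2 is
-- the pendant vertex attached to the spine vertex 2 j + 1.
catParent : ℕ → ℕ
catParent zero    = 0
catParent (suc k) = suc (⌊ k /2⌋ + ⌊ k /2⌋)

catParent≤ : ∀ k → catParent k ≤ k
catParent≤ zero    = z≤n
catParent≤ (suc k) = s≤s ([ (λ e → ≤-reflexive (sym e)) , (λ e → ≤-trans (n≤1+n _) (≤-reflexive (sym e))) ]′ (half-cases k))

odd≢even : ∀ i j → suc (i + i) ≢ j + j
odd≢even i j e with trans (sym (half-odd i)) (trans (cong ⌊_/2⌋ e) (half-even j))
... | refl = 1+n≢n e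

double-≤-cancel : ∀ {i j} → i + i ≤ j + j → i ≤ j
double-≤-cancel {i} {j} le = subst₂ _≤_ (half-even i) (half-even j) (⌊n/2⌋-mono le)

double-<-cancel : ∀ {i j} → i + i < j + j → i < j
double-<-cancel {i} {j} lt = ≰⇒> λ j≤i → <⇒≱ lt (+-mono-≤ j≤i j≤i)

spine-child : ∀ {w} j → Parent catParent w (suc (j + j)) → w ≡ 2 + (j + j) ⊎ w ≡ 3 + (j + j)
spine-child {suc (suc k)} j q with double-injective {⌊ k /2⌋} {j} (suc-injective q)
... | refl = [ inj₁ ∘ cong (2 +_) , inj₂ ∘ cong (2 +_) ]′ (half-cases k)

spine-child₁ : ∀ j → Parent catParent (2 + (j + j)) (suc (j + j))
spine-child₁ j = cong (λ h → suc (h + h)) (half-even j)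

spine-child₂ : ∀ j → Parent catParent (3 + (j + j)) (suc (j + j))
spine-child₂ j = cong (λ h → suc (h + h)) (half-odd j)

leaf-childless : ∀ {w} j → ¬ Parent catParent w (2 + (j + j))
leaf-childless {suc (suc k)} j q = odd≢even j ⌊ k /2⌋ (sym (suc-injective q))

last-childless : ∀ {w} e → w < 2 + (e + e) → ¬ Parent catParent w (suc (e + e))
last-childless e w< q with spine-child e q
... | inj₁ refl = <-irrefl refl w<
... | inj₂ refl = <-asym w< (n<1+n _)

zero-child : ∀ {w} → Parent catParent w 0 → w ≡ 1
zero-child {suc zero} _ = refl

data CatVertex (e : ℕ) : ℕ → Set where
  end   : CatVertex e 0
  spine : ∀ j → j ≤ e → CatVertex e (suc (j + j))
  hung  : ∀ j → j < e → CatVertex e (2 + (j + j))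

catVertex : ∀ e i → i < 2 + (e + e) → CatVertex e i
catVertex e zero    _ = end
catVertex e (suc k) k< with half-cases k
... | inj₁ k≡ = subst (CatVertex e ∘ suc) (sym k≡)
      (spine ⌊ k /2⌋ (≤-pred (double-<-cancel (≤-trans (s≤s (≤-reflexive (sym k≡))) (≤-trans (≤-pred k<) (≤-trans (n≤1+n _) (≤-reflexive (cong suc (sym (+-suc e e))))))))))
... | inj₂ k≡ = subst (CatVertex e ∘ suc) (sym k≡)
      (hung ⌊ k /2⌋ (double-<-cancel (≤-trans (≤-reflexive (sym k≡)) (≤-pred (≤-pred k<)))))

-- The distance from the tip for the spine. A hanging vertex gets the value of its spine vertex,
-- less than its true distance, which is enough for a lower bound.
catDepth : ℕ → ℕ
catDepth zero    = 0
catDepth (suc j) = suc ⌊ j /2⌋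

catDepth-lipschitz : ∀ {x y} → Parent catParent x y → catDepth x ≤ suc (catDepth y) × catDepth y ≤ suc (catDepth x)
catDepth-lipschitz {suc zero}    refl = ≤-refl , z≤n
catDepth-lipschitz {suc (suc k)} refl =
  s≤s (≤-trans (⌊n/2⌋-mono (n≤1+n (suc k))) (s≤s (≤-reflexive (sym (half-even ⌊ k /2⌋))))) ,
  s≤s (≤-trans (≤-reflexive (half-even ⌊ k /2⌋)) (≤-trans (⌊n/2⌋-mono (n≤1+n k)) (n≤1+n _)))

module Caterpillar (e m : ℕ) (m≡ : m ≡ 2 + (e + e)) where

  0<m : 0 < m
  0<m = subst (0 <_) (sym m≡) (s≤s z≤n)

  C : Graph m
  C = parentGraph m 0<m catParent catParent≤

  tip : Fin m
  tip = fromℕ< 0<m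

  open Graph C

  private
    tree = parentGraph-tree m 0<m catParent catParent≤

  vertex : ∀ {i} → i < 2 + (e + e) → ∃ λ (v : Fin m) → toℕ v ≡ i
  vertex {i} i< = fromℕ< i<m , toℕ-fromℕ< i<m
    where
    i<m : i < m
    i<m = subst (i <_) (sym m≡) i<

  bounded : ∀ (v : Fin m) → toℕ v < 2 + (e + e)
  bounded v = subst (toℕ v <_) m≡ (toℕ<n v)

  parent-at : ∀ {x y : Fin m} {i j} → toℕ x ≡ i → toℕ y ≡ j → Parent catParent i j → Parent catParent (toℕ x) (toℕ y)
  parent-at refl refl q = q

  binary : IsBinaryTree
  binary = tree , λ v ¬pendant → deg v ¬pendant (catVertex e (toℕ v) (bounded v)) refl
    where
    pendant : ∀ v → 0 < toℕ v → (∀ w → ¬ Parent catParent (toℕ w) (toℕ v)) → degree v ≡ 1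
    pendant v 0<v none = let _ , q = has-parent m 0<m catParent catParent≤ v 0<v in
      pendant-degree m 0<m catParent catParent≤ q none
    deg : ∀ v → ¬ Pendant v → ∀ {i} → CatVertex e i → toℕ v ≡ i → degree v ≡ 3
    deg v ¬p end v≡ = contradiction (degree-one C (inj₂ (parent-at {x = proj₁ next} (proj₂ next) v≡ refl)) only) ¬p
      where
      next = vertex {1} (s≤s (s≤s z≤n))
      only : ∀ w → v ~ w → w ≡ proj₁ next
      only w (inj₁ q) = contradiction (subst (λ i → Parent catParent i (toℕ w)) v≡ q) id
      only w (inj₂ q) = toℕ-injective (trans (zero-child (subst (Parent catParent (toℕ w)) v≡ q)) (sym (proj₂ next)))
    deg v ¬p (hung j _) v≡ = contradiction
      (pendant v (subst (0 <_) (sym v≡) (s≤s z≤n)) (λ w q → leaf-childless j (subst (Parent catParent (toℕ w)) v≡ q))) ¬p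
    deg v ¬p (spine j j≤e) v≡ with m≤n⇒m<n∨m≡n j≤e
    ... | inj₂ refl = contradiction
      (pendant v (subst (0 <_) (sym v≡) (s≤s z≤n)) (λ w q → last-childless e (bounded w) (subst (Parent catParent (toℕ w)) v≡ q))) ¬p
    ... | inj₁ j<e =
      let _ , q  = has-parent m 0<m catParent catParent≤ v (subst (0 <_) (sym v≡) (s≤s z≤n))
          a , a≡ = vertex {2 + (j + j)} (s≤s (s≤s (<⇒≤ (double-< j<e))))
          b , b≡ = vertex {3 + (j + j)} (s≤s (s≤s (double-< j<e)))
      in inner-degree m 0<m catParent catParent≤ q (parent-at a≡ v≡ (spine-child₁ j)) (parent-at b≡ v≡ (spine-child₂ j))
           (λ a≡b → <-irrefl (trans (sym a≡) (trans (cong toℕ a≡b) b≡)) ≤-refl)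
           (λ w r → [ (λ w≡ → inj₁ (toℕ-injective (trans w≡ (sym a≡)))) , (λ w≡ → inj₂ (toℕ-injective (trans w≡ (sym b≡)))) ]′
             (spine-child j (subst (Parent catParent (toℕ w)) v≡ r)))

  spine< : ∀ {j} → j ≤ e → suc (j + j) < 2 + (e + e)
  spine< j≤e = s≤s (s≤s (+-mono-≤ j≤e j≤e))

  spine-edge : ∀ j {x y : Fin m} → toℕ x ≡ suc (j + j) → toℕ y ≡ suc (suc j + suc j) → x ~ y
  spine-edge j x≡ y≡ = inj₂ (parent-at (trans y≡ (cong (λ k → 2 + k) (+-suc j j))) x≡ (spine-child₂ j))

  backbone : Fin (suc e) → Fin m
  backbone i = proj₁ (vertex (spine< (≤-pred (toℕ<n i))))

  backbone≡ : ∀ i → toℕ (backbone i) ≡ suc (toℕ i + toℕ i)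
  backbone≡ i = proj₂ (vertex (spine< (≤-pred (toℕ<n i))))

  backbone-path : IsPath backbone
  backbone-path =
    (λ {i} {j} eq → toℕ-injective (double-injective (suc-injective (trans (sym (backbone≡ i)) (trans (cong toℕ eq) (backbone≡ j)))))) ,
    λ i → spine-edge (toℕ i) (trans (backbone≡ (inject₁ i)) (cong (λ k → suc (k + k)) (toℕ-inject₁ i))) (backbone≡ (suc i))

  caterpillar : IsBinaryCaterpillar
  caterpillar = binary , e , backbone , backbone-path , λ v off → attached v off (catVertex e (toℕ v) (bounded v)) refl
    where
    on : ∀ j (j≤e : j ≤ e) → ∃ λ i → toℕ (backbone i) ≡ suc (j + j)
    on j j≤e = fromℕ< (s≤s j≤e) , trans (backbone≡ (fromℕ< (s≤s j≤e))) (cong (λ k → suc (k + k)) (toℕ-fromℕ< (s≤s j≤e)))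
    attached : ∀ v → (∀ i → backbone i ≢ v) → ∀ {i} → CatVertex e i → toℕ v ≡ i → ∃ λ i → v ~ backbone i
    attached v off end v≡ = let i , i≡ = on 0 z≤n in i , inj₂ (parent-at i≡ v≡ refl)
    attached v off (spine j j≤e) v≡ = let i , i≡ = on j j≤e in contradiction (toℕ-injective (trans i≡ (sym v≡))) (off i)
    attached v off (hung j j<e) v≡ = let i , i≡ = on j (<⇒≤ j<e) in i , inj₁ (parent-at v≡ i≡ (spine-child₁ j))

  spine-walk : ∀ d a {x y} → toℕ x ≡ suc (a + a) → toℕ y ≡ suc ((a + d) + (a + d)) → Walk _~_ d x y
  spine-walk zero a {x} x≡ y≡ =
    subst (Walk _~_ 0 x) (toℕ-injective (trans x≡ (trans (cong (λ k → suc (k + k)) (sym (+-identityʳ a))) (sym y≡)))) []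
  spine-walk (suc d) a {x} {y} x≡ y≡ =
    let z , z≡ = vertex {suc (suc a + suc a)} (≤-trans (s≤s (≤-trans (s≤s (+-mono-≤ 1+a≤ 1+a≤)) (≤-reflexive (sym y≡)))) (bounded y))
    in spine-edge a x≡ z≡ ∷ spine-walk d (suc a) z≡ (trans y≡ (cong (λ k → suc (k + k)) (+-suc a d)))
    where
    1+a≤ : suc a ≤ a + suc d
    1+a≤ = ≤-trans (s≤s (m≤m+n a d)) (≤-reflexive (sym (+-suc a d)))

  -- The vertex x is δ steps from spine vertex a. Every vertex but the tip satisfies a + δ ≤ e, so
  -- for a ≤ b the route has length δ + (b - a) + ε ≤ 1 + e. The tip, with a = 0 and δ = 1, is kept
  -- apart because it breaks this bound when e = 0.
  record Near (x : Fin m) (a δ : ℕ) : Set where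
    field
      δ≤1      : δ ≤ 1
      foot     : Fin m
      foot≡    : toℕ foot ≡ suc (a + a)
      approach : Walk _~_ δ x foot

  near : ∀ x → Near x 0 1 × x ≡ tip ⊎ ∃₂ λ a δ → Near x a δ × a + δ ≤ e
  near x with toℕ x in x≡ | catVertex e (toℕ x) (bounded x)
  ... | _ | end =
    let s , s≡ = vertex {1} (s≤s (s≤s z≤n)) in
    inj₁ (record { δ≤1 = ≤-refl ; foot = s ; foot≡ = s≡ ; approach = inj₂ (parent-at s≡ x≡ refl) ∷ [] } ,
          toℕ-injective (trans x≡ (sym (toℕ-fromℕ< 0<m))))
  ... | _ | spine a a≤e = inj₂ (a , 0 , record { δ≤1 = z≤n ; foot = x ; foot≡ = x≡ ; approach = [] } , ≤-trans (≤-reflexive (+-identityʳ a)) a≤e)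
  ... | _ | hung a a<e =
    let s , s≡ = vertex (spine< (<⇒≤ a<e)) in
    inj₂ (a , 1 , record { δ≤1 = ≤-refl ; foot = s ; foot≡ = s≡ ; approach = inj₁ (parent-at x≡ s≡ (spine-child₁ a)) ∷ [] } ,
          ≤-trans (≤-reflexive (+-comm a 1)) a<e)

  Within : Fin m → Fin m → Set
  Within x y = ∃ λ k → k ≤ suc e × Walk _~_ k x y

  within-sym : ∀ {x y} → Within x y → Within y x
  within-sym (k , k≤ , w) = k , k≤ , walk-reverse symmetric w

  join-near : ∀ {x y a δ b ε} → Near x a δ → Near y b ε → a ≤ b → b + ε ≤ e → Within x y
  join-near {x} {y} {a} {δ} {b} {ε} nx ny a≤b b+ε≤e with m≤n⇒∃[o]m+o≡n a≤b
  ... | d , refl = δ + (d + ε) , +-mono-≤ X.δ≤1 (≤-trans (+-monoˡ-≤ ε (m≤n+m d a)) b+ε≤e) ,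
    (X.approach ++ʷ (spine-walk d a X.foot≡ Y.foot≡ ++ʷ walk-reverse symmetric Y.approach))
    where
    module X = Near nx
    module Y = Near ny

  within : ∀ x y → Within x y
  within x y with near x | near y
  ... | inj₁ (_ , refl) | inj₁ (_ , refl) = 0 , z≤n , []
  ... | inj₁ (nx , _) | inj₂ (_ , _ , ny , y≤) = join-near nx ny z≤n y≤
  ... | inj₂ (_ , _ , nx , x≤) | inj₁ (ny , _) = within-sym (join-near ny nx z≤n x≤)
  ... | inj₂ (a , _ , nx , x≤) | inj₂ (b , _ , ny , y≤) with ≤-total a b
  ...   | inj₁ a≤b = join-near nx ny a≤b y≤
  ...   | inj₂ b≤a = within-sym (join-near ny nx b≤a x≤)

  ecc≤ : ∀ x → ecc x ≤ suc e
  ecc≤ x = max≤v⁺ z≤n (All.tabulate bound)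
    where
    bound : ∀ {d} → d ∈ map (dist x) (allFin m) → d ≤ suc e
    bound d∈ with ∈-map⁻ (dist x) d∈
    ... | y , _ , refl = let _ , k≤ , w = within x y in ≤-trans (dist-≤ C w) k≤

  ≤ecc-tip : suc e ≤ ecc tip
  ≤ecc-tip = v≤max⁺ 0 (map (dist tip) (allFin m)) (inj₂ (Any.map (λ { refl → far }) (∈-map⁺ (dist tip) (∈-allFin last))))
    where
    open Σ (vertex (spine< ≤-refl)) renaming (proj₁ to last; proj₂ to last≡)
    lipschitz : ∀ {x y} → x ~ y → catDepth (toℕ y) ≤ suc (catDepth (toℕ x))
    lipschitz (inj₁ q) = proj₂ (catDepth-lipschitz q)
    lipschitz (inj₂ q) = proj₁ (catDepth-lipschitz q)
    far : suc e ≤ dist tip last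
    far = ≤-trans (≤-reflexive (sym (trans (cong catDepth last≡) (cong suc (half-even e)))))
      (≤-trans (walk-lipschitz C (catDepth ∘ toℕ) lipschitz (dist-walk C tip last))
        (≤-reflexive (trans (cong (λ i → dist tip last + catDepth i) (toℕ-fromℕ< 0<m)) (+-identityʳ _))))

  tip-eccentric : MaxEccentricity tip
  tip-eccentric x = ≤-trans (ecc≤ x) ≤ecc-tip

-- The crg tree

module Crg (c e n : ℕ) (0<c : 0 < c) (n≡ : n ≡ suc (c + c) + suc (e + e)) where

  l : ℕ
  l = suc (c + c)

  -- Vertex i < l is vertex i of the rgood tree and vertex l + k is vertex k + 1
  -- of the caterpillar, whose vertex 0 is identified with the root.
  glue : ℕ → ℕ
  glue zero    = 0
  glue (suc k) = l + k

  glue-injective : ∀ {i j} → glue i ≡ glue j → i ≡ j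
  glue-injective {zero}  {zero}  _  = refl
  glue-injective {suc i} {suc j} eq = cong suc (+-cancelˡ-≡ l i j eq)

  glue<l : ∀ {i} → glue i < l → i ≡ 0
  glue<l {zero}  _  = refl
  glue<l {suc i} lt = contradiction (m≤m+n l i) (<⇒≱ lt)

  crgParent : ℕ → ℕ
  crgParent k with suc k <? l
  ... | yes _ = ⌊ k /2⌋
  ... | no  _ = glue (catParent (suc k ∸ l))

  heap⇒crg : ∀ {w v} → w < l → Parent ⌊_/2⌋ w v → Parent crgParent w v
  heap⇒crg {suc k} w<l q with suc k <? l
  ... | yes _  = q
  ... | no w≮l = contradiction w<l w≮l

  crg⇒heap : ∀ {w v} → w < l → Parent crgParent w v → Parent ⌊_/2⌋ w v
  crg⇒heap {suc k} w<l q with suc k <? l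
  ... | yes _  = q
  ... | no w≮l = contradiction w<l w≮l

  cat⇒crg : ∀ j → Parent crgParent (l + j) (glue (catParent j))
  cat⇒crg j with suc (c + c + j) <? l
  ... | yes w<l = contradiction (m≤m+n l j) (<⇒≱ w<l)
  ... | no  _   = cong (glue ∘ catParent) (m+n∸m≡n (c + c) j)

  crg⇒cat : ∀ j {v} → Parent crgParent (l + j) v → v ≡ glue (catParent j)
  crg⇒cat j q = parent-functional crgParent q (cat⇒crg j)

  crgParent≤ : ∀ k → crgParent k ≤ k
  crgParent≤ k with suc k <? l
  ... | yes _  = ⌊n/2⌋≤n k
  ... | no k≮l with catParent (suc k ∸ l) in eq
  ...   | zero  = z≤n
  ...   | suc x = ≤-pred (≤-trans (≤-reflexive (cong suc (sym (+-suc (c + c) x))))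
                    (≤-trans (+-monoʳ-≤ l (≤-trans (≤-reflexive (sym eq)) (catParent≤ (suc k ∸ l)))) (≤-reflexive (m+[n∸m]≡n (≮⇒≥ k≮l)))))

  data CrgVertex : ℕ → Set where
    in-heap : ∀ {i} → i < l → CrgVertex i
    in-cat  : ∀ j → CrgVertex (l + j)

  crgVertex : ∀ i → CrgVertex i
  crgVertex i with i <? l
  ... | yes i<l = in-heap i<l
  ... | no i≮l  = subst CrgVertex (m+[n∸m]≡n (≮⇒≥ i≮l)) (in-cat (i ∸ l))

  Adjacent : ℕ → ℕ → Set
  Adjacent i j = Parent crgParent i j ⊎ Parent crgParent j i

  -- The neighbour of a vertex of the rgood tree on the side of vertex l.
  upper : ℕ → ℕ
  upper zero    = l
  upper (suc k) = ⌊ k /2⌋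

  upper-adjacent : ∀ {i} → i < l → Adjacent i (upper i)
  upper-adjacent {zero}  _   = inj₂ (subst (λ x → Parent crgParent x 0) (+-identityʳ l) (cat⇒crg 0))
  upper-adjacent {suc k} i<l = inj₁ (heap⇒crg i<l refl)

  heap-adjacent : ∀ {i w} → i < l → Adjacent i w → w ≡ upper i ⊎ (w < l × Parent ⌊_/2⌋ w i)
  heap-adjacent {suc k} i<l (inj₁ q) = inj₁ (sym (crg⇒heap i<l q))
  heap-adjacent {i} {w} i<l (inj₂ q) with crgVertex w
  ... | in-heap w<l = inj₂ (w<l , crg⇒heap w<l q)
  ... | in-cat j    = inj₁ (top j (crg⇒cat j q))
    where
    top : ∀ j → i ≡ glue (catParent j) → l + j ≡ upper i
    top zero    refl = +-identityʳ l
    top (suc j) i≡ with glue<l {catParent (suc j)} (subst (_< l) i≡ i<l)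
    ... | ()

  cat-adjacent : ∀ {k w} → Adjacent (l + k) w → w ≡ glue (catParent k) ⊎ ∃ λ w′ → w ≡ glue w′ × Parent catParent w′ (suc k)
  cat-adjacent {k} (inj₁ q) = inj₁ (crg⇒cat k q)
  cat-adjacent {k} {w} (inj₂ q) with crgVertex w
  ... | in-cat j    = inj₂ (suc j , refl , sym (glue-injective {suc k} (crg⇒cat j q)))
  ... | in-heap w<l = contradiction (small w w<l q) (λ lt → <⇒≱ lt (m≤m+n l k))
    where
    small : ∀ w → w < l → Parent crgParent w (l + k) → l + k < l
    small (suc w) w<l q = ≤-trans (s≤s (≤-trans (≤-reflexive (sym (crg⇒heap w<l q))) (⌊n/2⌋≤n w))) (<⇒≤ w<l)

  0<n : 0 < n
  0<n = subst (0 <_) (sym n≡) (s≤s z≤n)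

  T : Graph n
  T = parentGraph n 0<n crgParent crgParent≤

  open Graph T

  vertex : ∀ {i} → i < l + suc (e + e) → ∃ λ (v : Fin n) → toℕ v ≡ i
  vertex {i} i< = fromℕ< i<n , toℕ-fromℕ< i<n
    where
    i<n : i < n
    i<n = subst (i <_) (sym n≡) i<

  bounded : ∀ (v : Fin n) → toℕ v < l + suc (e + e)
  bounded v = subst (toℕ v <_) n≡ (toℕ<n v)

  adjacent-at : ∀ {x y : Fin n} {i j} → toℕ x ≡ i → toℕ y ≡ j → Adjacent i j → x ~ y
  adjacent-at refl refl q = q

  heap-leaf-only : ∀ {v p} → c ≤ toℕ v → toℕ v < l → toℕ p ≡ upper (toℕ v) → ∀ w → v ~ w → w ≡ p
  heap-leaf-only c≤v v<l p≡ w e with heap-adjacent v<l e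
  ... | inj₁ w≡         = toℕ-injective (trans w≡ (sym p≡))
  ... | inj₂ (w<l , q) = contradiction q (heap-childless c≤v w<l)

  heap-leaf : ∀ {v p} → c ≤ toℕ v → toℕ v < l → toℕ p ≡ upper (toℕ v) → Branch T p v leaf
  heap-leaf c≤v v<l p≡ = leaf (adjacent-at refl p≡ (upper-adjacent v<l)) (heap-leaf-only c≤v v<l p≡)

  record Inner (v p : Fin n) : Set where
    field
      a b : Fin n
      v~p : v ~ p
      v~a : v ~ a
      v~b : v ~ b
      a≢p : a ≢ p
      b≢p : b ≢ p
      a≢b : a ≢ b
      only : ∀ w → v ~ w → w ≡ p ⊎ w ≡ a ⊎ w ≡ b

  inner-deg : ∀ {v p} → Inner v p → degree v ≡ 3
  inner-deg i = degree-three T v~p v~a v~b a≢p b≢p a≢b only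
    where open Inner i

  heap-inner : ∀ {v p} → toℕ v < c → toℕ p ≡ upper (toℕ v) → Σ (Inner v p) λ i →
               toℕ (Inner.a i) ≡ suc (toℕ v + toℕ v) × toℕ (Inner.b i) ≡ suc (suc (toℕ v + toℕ v))
  heap-inner {v} {p} v<c p≡ = record
    { a = a ; b = b
    ; v~p = adjacent-at refl p≡ (upper-adjacent v<l)
    ; v~a = adjacent-at refl a≡ (inj₂ (heap⇒crg a<l (half-even i)))
    ; v~b = adjacent-at refl b≡ (inj₂ (heap⇒crg b<l (half-odd i)))
    ; a≢p = λ a≡p → upper≢ (s≤s (m≤m+n i i)) a<l (trans (sym p≡) (trans (cong toℕ (sym a≡p)) a≡))
    ; b≢p = λ b≡p → upper≢ (s≤s (≤-trans (m≤m+n i i) (n≤1+n _))) b<l (trans (sym p≡) (trans (cong toℕ (sym b≡p)) b≡))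
    ; a≢b = λ a≡b → <-irrefl (trans (sym a≡) (trans (cong toℕ a≡b) b≡)) ≤-refl
    ; only = only
    } , a≡ , b≡
    where
    i = toℕ v
    v<l : i < l
    v<l = <-trans v<c (s≤s (m≤m+n c c))
    a<l : suc (i + i) < l
    a<l = s≤s (<⇒≤ (double-< v<c))
    b<l : suc (suc (i + i)) < l
    b<l = s≤s (double-< v<c)
    open Σ (vertex (≤-trans a<l (m≤m+n l _))) renaming (proj₁ to a; proj₂ to a≡)
    open Σ (vertex (≤-trans b<l (m≤m+n l _))) renaming (proj₁ to b; proj₂ to b≡)
    upper≢ : ∀ {i x} → i < x → x < l → upper i ≢ x
    upper≢ {zero}  _   x<l refl = <-irrefl refl x<l
    upper≢ {suc k} i<x _   refl = <⇒≱ i<x (≤-trans (⌊n/2⌋≤n k) (n≤1+n k))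
    only : ∀ w → v ~ w → w ≡ p ⊎ w ≡ a ⊎ w ≡ b
    only w v~w with heap-adjacent v<l v~w
    ... | inj₁ w≡ = inj₁ (toℕ-injective (trans w≡ (sym p≡)))
    ... | inj₂ (_ , q) = inj₂ ([ (λ w≡ → inj₁ (toℕ-injective (trans w≡ (sym a≡)))) , (λ w≡ → inj₂ (toℕ-injective (trans w≡ (sym b≡)))) ]′ (heap-child q))

  cat-leaf : ∀ {v p} k → toℕ v ≡ l + k → toℕ p ≡ glue (catParent k) →
             (∀ {w} → w < 2 + (e + e) → ¬ Parent catParent w (suc k)) → Branch T p v leaf
  cat-leaf {v} {p} k v≡ p≡ none = leaf (adjacent-at v≡ p≡ (inj₁ (cat⇒crg k))) only
    where
    only : ∀ w → v ~ w → w ≡ p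
    only w v~w with cat-adjacent (subst (λ i → Adjacent i (toℕ w)) v≡ v~w)
    ... | inj₁ w≡ = toℕ-injective (trans w≡ (sym p≡))
    ... | inj₂ (suc w′ , w≡ , q) =
      contradiction q (none (s≤s (+-cancelˡ-< l w′ (suc (e + e)) (subst (_< l + suc (e + e)) w≡ (bounded w)))))

  cat-inner : ∀ {v p} j → j < e → toℕ v ≡ l + (j + j) → toℕ p ≡ glue (catParent (j + j)) → Σ (Inner v p) λ i →
              toℕ (Inner.a i) ≡ l + suc (j + j) × toℕ (Inner.b i) ≡ l + (suc j + suc j)
  cat-inner {v} {p} j j<e v≡ p≡ = record
    { a = a ; b = b
    ; v~p = adjacent-at v≡ p≡ (inj₁ (cat⇒crg (j + j)))
    ; v~a = adjacent-at v≡ a≡ (inj₂ (subst (Parent crgParent (l + suc (j + j))) (cong glue (spine-child₁ j)) (cat⇒crg (suc (j + j)))))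
    ; v~b = adjacent-at v≡ b≡ (inj₂ (subst (Parent crgParent (l + (suc j + suc j)))
              (cong glue (trans (cong catParent (cong suc (+-suc j j))) (spine-child₂ j))) (cat⇒crg (suc j + suc j))))
    ; a≢p = λ a≡p → <-irrefl (trans (sym p≡) (trans (cong toℕ (sym a≡p)) a≡)) (≤-trans (s≤s up≤) (≤-reflexive (sym (+-suc l (j + j)))))
    ; b≢p = λ b≡p → <-irrefl (trans (sym p≡) (trans (cong toℕ (sym b≡p)) b≡)) (≤-trans (s≤s up≤) (+-monoʳ-< l (s≤s (+-monoʳ-≤ j (n≤1+n j)))))
    ; a≢b = λ a≡b → <-irrefl (trans (sym a≡) (trans (cong toℕ a≡b) b≡)) (+-monoʳ-< l (s≤s (≤-reflexive (sym (+-suc j j)))))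
    ; only = only
    } , a≡ , b≡
    where
    open Σ (vertex (+-monoʳ-< l (s≤s (<⇒≤ (double-< j<e))))) renaming (proj₁ to a; proj₂ to a≡)
    open Σ (vertex (+-monoʳ-< l (s≤s (+-mono-≤ j<e j<e)))) renaming (proj₁ to b; proj₂ to b≡)
    up≤ : glue (catParent (j + j)) ≤ l + (j + j)
    up≤ with catParent (j + j) | catParent≤ (j + j)
    ... | zero  | _  = z≤n
    ... | suc x | x< = +-monoʳ-≤ l (<⇒≤ x<)
    only : ∀ w → v ~ w → w ≡ p ⊎ w ≡ a ⊎ w ≡ b
    only w v~w with cat-adjacent (subst (λ i → Adjacent i (toℕ w)) v≡ v~w)
    ... | inj₁ w≡ = inj₁ (toℕ-injective (trans w≡ (sym p≡)))
    ... | inj₂ (w′ , w≡ , q) with spine-child j q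
    ...   | inj₁ refl = inj₂ (inj₁ (toℕ-injective (trans w≡ (sym a≡))))
    ...   | inj₂ refl = inj₂ (inj₂ (toℕ-injective (trans w≡ (trans (cong (l +_) (cong suc (sym (+-suc j j)))) (sym b≡)))))

  cat-branch : ∀ d j → j + d ≡ e → ∀ {v p} → toℕ v ≡ l + (j + j) → toℕ p ≡ glue (catParent (j + j)) → Branch T p v (cat d)
  cat-branch zero    j eq v≡ p≡ = cat-leaf (j + j) v≡ p≡
    λ {w} w< q → last-childless e w< (subst (λ i → Parent catParent w (suc (i + i))) (trans (sym (+-identityʳ j)) eq) q)
  cat-branch (suc d) j eq v≡ p≡ =
    node v~p a≢p b≢p a≢b only
      (cat-leaf (suc (j + j)) a≡ (trans v≡ (cong glue (sym (spine-child₁ j)))) (λ _ → leaf-childless j))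
      (cat-branch d (suc j) (trans (sym (+-suc j d)) eq) b≡ (trans v≡ (cong glue (sym (trans (cong catParent (cong suc (+-suc j j))) (spine-child₂ j))))))
    where
    branching = cat-inner j (≤-trans (s≤s (m≤m+n j d)) (≤-reflexive (trans (sym (+-suc j d)) eq))) v≡ p≡
    open Inner (proj₁ branching)
    a≡ = proj₁ (proj₂ branching)
    b≡ = proj₂ (proj₂ branching)

  -- Whether the descendants of vertex i form a perfect tree or a heap of height h is
  -- read off l + 1 = N: those h levels below i are (i + 1) 2 ^ h − 1, …, (i + 2) 2 ^ h − 2.
  N : ℕ
  N = suc c + suc c

  inner-bound : ∀ i h → (2 + i) * 2 ^ suc h ≤ N → i < c
  inner-bound i h le = ≤-pred (double-≤-cancel (≤-trans (≤-trans (≤-reflexive (ring i)) (*-monoʳ-≤ (2 + i) (*-monoʳ-≤ 2 (0<2^ h)))) le))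
    where
    ring : ∀ i → (2 + i) + (2 + i) ≡ (2 + i) * (2 * 1)
    ring = solve-∀

  leaf-bound : ∀ i → N ≤ suc i * 2 → c ≤ i
  leaf-bound i le = ≤-pred (double-≤-cancel (≤-trans le (≤-reflexive (ring i))))
    where
    ring : ∀ i → suc i * 2 ≡ suc i + suc i
    ring = solve-∀

  private
    step₁ : ∀ i x → (3 + (i + i)) * x ≤ (2 + i) * (2 * x)
    step₁ i x = ≤-trans (m≤n+m _ x) (≤-reflexive (ring i x))
      where
      ring : ∀ i x → x + (3 + (i + i)) * x ≡ (2 + i) * (2 * x)
      ring = solve-∀
    step₂ : ∀ i x → (4 + (i + i)) * x ≡ (2 + i) * (2 * x)
    step₂ = solve-∀
    step₃ : ∀ i x → suc i * (2 * x) ≡ (2 + (i + i)) * x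
    step₃ = solve-∀
    step₄ : ∀ i x → suc i * (2 * x) ≤ (3 + (i + i)) * x
    step₄ i x = ≤-trans (≤-reflexive (step₃ i x)) (*-monoˡ-≤ x (n≤1+n (2 + (i + i))))

  child-upper₁ : ∀ {i x y} → x ≡ i → y ≡ suc (i + i) → x ≡ upper y
  child-upper₁ {i} refl refl = sym (half-even i)

  child-upper₂ : ∀ {i x y} → x ≡ i → y ≡ suc (suc (i + i)) → x ≡ upper y
  child-upper₂ {i} refl refl = sym (half-odd i)

  child<l₁ : ∀ {i x} → i < c → x ≡ suc (i + i) → x < l
  child<l₁ i<c refl = s≤s (<⇒≤ (double-< i<c))

  child<l₂ : ∀ {i x} → i < c → x ≡ suc (suc (i + i)) → x < l
  child<l₂ i<c refl = s≤s (double-< i<c)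

  -- The first inequality says that level h below i is complete, the second that level h + 1 is not
  -- reached. In `heap-branch` the second says instead that nothing lies beyond level h + 1.
  perfect-branch : ∀ h i {v p} → toℕ v ≡ i → toℕ v < l → toℕ p ≡ upper (toℕ v) →
                   (2 + i) * 2 ^ h ≤ N → N ≤ suc i * 2 ^ suc h → ∃ λ t → Branch T p v t × Perfect h t
  perfect-branch zero i refl v<l p≡ _ ≤r = leaf , heap-leaf (leaf-bound i ≤r) v<l p≡ , leaf
  perfect-branch (suc h) i {v} refl v<l p≡ l≤ ≤r =
    let i<c = inner-bound i h l≤
        k , a≡ , b≡ = heap-inner i<c p≡
        open Inner k
        _ , bl , pl = perfect-branch h (suc (i + i)) a≡ (child<l₁ i<c a≡) (child-upper₁ {i} refl a≡)
          (≤-trans (step₁ i (2 ^ h)) l≤) (≤-trans ≤r (≤-reflexive (step₃ i (2 ^ suc h))))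
        _ , br , pr = perfect-branch h (suc (suc (i + i))) b≡ (child<l₂ i<c b≡) (child-upper₂ {i} refl b≡)
          (≤-trans (≤-reflexive (step₂ i (2 ^ h))) l≤) (≤-trans ≤r (step₄ i (2 ^ suc h)))
    in _ , node v~p a≢p b≢p a≢b only bl br , node pl pr

  heap-branch : ∀ h i {v p} → toℕ v ≡ i → toℕ v < l → toℕ p ≡ upper (toℕ v) →
                (2 + i) * 2 ^ h ≤ N → N ≤ (2 + i) * 2 ^ suc h → ∃ λ t → Branch T p v t × Heap h t
  heap-branch zero i refl v<l p≡ _ ≤r with c ≤? i
  ... | yes c≤i = leaf , heap-leaf c≤i v<l p≡ , leaf
  ... | no c≰i  =
    let i<c = ≰⇒> c≰i
        k , a≡ , b≡ = heap-inner i<c p≡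
        open Inner k
        c≤ = ≤-trans (leaf-bound (suc i) ≤r) (s≤s (m≤m+n i i))
    in _ , node v~p a≢p b≢p a≢b only
             (heap-leaf (≤-trans c≤ (≤-reflexive (sym a≡))) (child<l₁ i<c a≡) (child-upper₁ {i} refl a≡))
             (heap-leaf (≤-trans c≤ (≤-trans (n≤1+n _) (≤-reflexive (sym b≡)))) (child<l₂ i<c b≡) (child-upper₂ {i} refl b≡)) ,
       cherry
  -- The threshold marks the end of the deepest level below the first child 2 i + 1; it decides
  -- which child is perfect.
  heap-branch (suc h) i refl v<l p≡ l≤ ≤r with inner-bound i h l≤ | ≤-total N ((3 + (i + i)) * 2 ^ suc h)
  ... | i<c | inj₁ N≤ =
    let k , a≡ , b≡ = heap-inner i<c p≡
        open Inner k
        _ , bl , hl = heap-branch h (suc (i + i)) a≡ (child<l₁ i<c a≡) (child-upper₁ {i} refl a≡)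
          (≤-trans (step₁ i (2 ^ h)) l≤) N≤
        _ , br , pr = perfect-branch h (suc (suc (i + i))) b≡ (child<l₂ i<c b≡) (child-upper₂ {i} refl b≡)
          (≤-trans (≤-reflexive (step₂ i (2 ^ h))) l≤) N≤
    in _ , node v~p a≢p b≢p a≢b only bl br , fill-left hl pr
  ... | i<c | inj₂ ≤N =
    let k , a≡ , b≡ = heap-inner i<c p≡
        open Inner k
        _ , bl , pl = perfect-branch (suc h) (suc (i + i)) a≡ (child<l₁ i<c a≡) (child-upper₁ {i} refl a≡)
          ≤N (≤-trans ≤r (*-monoˡ-≤ (2 ^ suc (suc h)) (s≤s (s≤s (m≤m+n i i)))))
        _ , br , hr = heap-branch h (suc (suc (i + i))) b≡ (child<l₂ i<c b≡) (child-upper₂ {i} refl b≡)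
          (≤-trans (≤-reflexive (step₂ i (2 ^ h))) l≤) (≤-trans ≤r (≤-reflexive (sym (step₂ i (2 ^ suc h)))))
    in _ , node v~p a≢p b≢p a≢b only bl br , fill-right pl hr

  binaryTree : IsBinaryTree
  binaryTree = parentGraph-tree n 0<n crgParent crgParent≤ , λ v ¬p → deg v ¬p (crgVertex (toℕ v)) refl
    where
    branch-degree : ∀ {v p} → Branch T p v leaf → degree v ≡ 1
    branch-degree (leaf e only) = degree-one T e only
    upper< : ∀ {i} → i < l → upper i < l + suc (e + e)
    upper< {zero}  _   = ≤-trans (≤-reflexive (cong suc (sym (+-identityʳ l)))) (≤-trans (≤-reflexive (sym (+-suc l 0))) (+-monoʳ-≤ l (s≤s z≤n)))
    upper< {suc k} i<l = ≤-trans (s≤s (≤-trans (⌊n/2⌋≤n k) (n≤1+n k))) (≤-trans i<l (m≤m+n l _))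
    glue< : ∀ {k} → k < suc (e + e) → glue (catParent k) < l + suc (e + e)
    glue< {k} k< with catParent k | catParent≤ k
    ... | zero  | _  = s≤s z≤n
    ... | suc x | x< = +-monoʳ-< l (≤-trans x< (<⇒≤ k<))
    deg : ∀ v → ¬ Pendant v → ∀ {i} → CrgVertex i → toℕ v ≡ i → degree v ≡ 3
    deg v ¬p (in-heap v<l) refl with c ≤? toℕ v
    ... | yes c≤v = contradiction (branch-degree (heap-leaf c≤v v<l (proj₂ (vertex (upper< v<l))))) ¬p
    ... | no c≰v  = inner-deg (proj₁ (heap-inner (≰⇒> c≰v) (proj₂ (vertex (upper< v<l)))))
    deg v ¬p (in-cat k) v≡ = cat-deg (catVertex e (suc k) (s≤s k<)) refl
      where
      k< : k < suc (e + e)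
      k< = +-cancelˡ-< l k (suc (e + e)) (subst (_< l + suc (e + e)) v≡ (bounded v))
      p≡ = proj₂ (vertex (glue< k<))
      cat-deg : ∀ {i} → CatVertex e i → i ≡ suc k → degree v ≡ 3
      cat-deg (hung j _) refl = contradiction (branch-degree (cat-leaf k v≡ p≡ (λ _ → leaf-childless j))) ¬p
      cat-deg (spine j j≤e) refl with m≤n⇒m<n∨m≡n j≤e
      ... | inj₁ j<e  = inner-deg (proj₁ (cat-inner j j<e v≡ p≡))
      ... | inj₂ refl = contradiction (branch-degree (cat-leaf k v≡ p≡ (last-childless e))) ¬p

  l<n : l < n
  l<n = ≤-trans (≤-reflexive (+-comm 1 l)) (≤-trans (+-monoʳ-≤ l (s≤s z≤n)) (≤-reflexive (sym n≡)))

  m≡ : suc (n ∸ l) ≡ 2 + (e + e)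
  m≡ = cong suc (trans (cong (_∸ l) n≡) (m+n∸m≡n l (suc (e + e))))

  open RGood c l 0<c refl using (R; root; rgood)
  open Caterpillar e (suc (n ∸ l)) m≡ using (C; tip; caterpillar; tip-eccentric)

  identification : IsIdentification R root C tip T
  identification = record
    { ι           = ι
    ; κ           = κ
    ; ι-injective = λ {x} {y} eq → toℕ-injective (trans (sym (ι≡ x)) (trans (cong toℕ eq) (ι≡ y)))
    ; κ-injective = λ {x} {y} eq → toℕ-injective (glue-injective (trans (sym (κ≡ x)) (trans (cong toℕ eq) (κ≡ y))))
    ; covers      = covers
    ; glued       = λ u v → mk⇔ (split-glue u v) (λ { (refl , refl) → toℕ-injective (trans (trans (ι≡ root) root≡0) (sym (trans (κ≡ tip) (cong glue tip≡0)))) })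
    ; adjacency   = λ x y → mk⇔ to from
    }
    where
    ι : Fin l → Fin n
    ι u = fromℕ< (<-trans (toℕ<n u) l<n)
    ι≡ : ∀ u → toℕ (ι u) ≡ toℕ u
    ι≡ u = toℕ-fromℕ< (<-trans (toℕ<n u) l<n)
    root≡0 : toℕ root ≡ 0
    root≡0 = refl
    tip≡0 : toℕ tip ≡ 0
    tip≡0 = refl
    glue<n : ∀ {k} → k < suc (n ∸ l) → glue k < n
    glue<n {zero}  _        = 0<n
    glue<n {suc k} (s≤s k<) = ≤-trans (+-monoʳ-< l k<) (≤-reflexive (m+[n∸m]≡n (<⇒≤ l<n)))
    κ : Fin (suc (n ∸ l)) → Fin n
    κ v = fromℕ< (glue<n (toℕ<n v))
    κ≡ : ∀ v → toℕ (κ v) ≡ glue (toℕ v)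
    κ≡ v = toℕ-fromℕ< (glue<n (toℕ<n v))
    from-ι : ∀ {i} → i < l → ∃ λ u → toℕ u ≡ i
    from-ι i<l = fromℕ< i<l , toℕ-fromℕ< i<l
    from-κ : ∀ {k} → glue k < n → ∃ λ v → toℕ v ≡ k
    from-κ {zero}  _ = zero , refl
    from-κ {suc k} lt = fromℕ< k< , toℕ-fromℕ< k<
      where
      k< : suc k < suc (n ∸ l)
      k< = s≤s (+-cancelˡ-< l k (n ∸ l) (≤-trans lt (≤-reflexive (sym (m+[n∸m]≡n (<⇒≤ l<n))))))
    in-ι : ∀ x {i} → i < l → toℕ x ≡ i → ∃ λ u → ι u ≡ x × toℕ u ≡ i
    in-ι x i<l x≡ = let u , u≡ = from-ι i<l in u , toℕ-injective (trans (ι≡ u) (trans u≡ (sym x≡))) , u≡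
    in-κ : ∀ x {k} → toℕ x ≡ glue k → ∃ λ v → κ v ≡ x × toℕ v ≡ k
    in-κ x {k} x≡ = let v , v≡ = from-κ {k} (subst (_< n) x≡ (toℕ<n x)) in
      v , toℕ-injective (trans (κ≡ v) (trans (cong glue v≡) (sym x≡))) , v≡
    covers : ∀ x → (∃ λ u → ι u ≡ x) ⊎ (∃ λ v → κ v ≡ x)
    covers x with toℕ x in x≡ | crgVertex (toℕ x)
    ... | _ | in-heap i<l = let u , eq , _ = in-ι x i<l x≡ in inj₁ (u , eq)
    ... | _ | in-cat j    = let v , eq , _ = in-κ x {suc j} x≡ in inj₂ (v , eq)
    split-glue : ∀ u v → ι u ≡ κ v → u ≡ root × v ≡ tip
    split-glue u v eq = toℕ-injective (trans u≡ (trans (cong glue v≡0) (sym root≡0))) , toℕ-injective (trans v≡0 (sym tip≡0))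
      where
      u≡ : toℕ u ≡ glue (toℕ v)
      u≡ = trans (sym (ι≡ u)) (trans (cong toℕ eq) (κ≡ v))
      v≡0 : toℕ v ≡ 0
      v≡0 = glue<l (subst (_< l) u≡ (toℕ<n u))
    Images : Rel (Fin n) 0ℓ
    Images x y = (∃₂ λ u v → ι u ≡ x × ι v ≡ y × Graph._~_ R u v) ⊎ (∃₂ λ u v → κ u ≡ x × κ v ≡ y × Graph._~_ C u v)
    images-sym : ∀ {x y} → Images x y → Images y x
    images-sym (inj₁ (u , v , u≡ , v≡ , e)) = inj₁ (v , u , v≡ , u≡ , Graph.symmetric R e)
    images-sym (inj₂ (u , v , u≡ , v≡ , e)) = inj₂ (v , u , v≡ , u≡ , Graph.symmetric C e)
    parent-image : ∀ {x y} → Parent crgParent (toℕ x) (toℕ y) → Images x y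
    parent-image {x} {y} q with toℕ x in x≡ | crgVertex (toℕ x)
    ... | i | in-heap i<l =
      let q′ = crg⇒heap i<l q
          u , u↦ , u≡ = in-ι x i<l x≡
          v , v↦ , v≡ = in-ι y (<-trans (parent-< l z<s ⌊_/2⌋ ⌊n/2⌋≤n q′) i<l) refl
      in inj₁ (u , v , u↦ , v↦ , inj₁ (subst₂ (Parent ⌊_/2⌋) (sym u≡) (sym v≡) q′))
    ... | _ | in-cat j =
      let u , u↦ , u≡ = in-κ x {suc j} x≡
          v , v↦ , v≡ = in-κ y (crg⇒cat j q)
      in inj₂ (u , v , u↦ , v↦ , inj₁ (subst₂ (Parent catParent) (sym u≡) (sym v≡) refl))
    to : ∀ {x y} → x ~ y → Images x y
    to (inj₁ q) = parent-image q
    to (inj₂ q) = images-sym (parent-image q)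
    ι-parent : ∀ {u v} → Parent ⌊_/2⌋ (toℕ u) (toℕ v) → ι u ~ ι v
    ι-parent {u} {v} q = inj₁ (subst₂ (Parent crgParent) (sym (ι≡ u)) (sym (ι≡ v)) (heap⇒crg (toℕ<n u) q))
    κ-parent : ∀ {u v} → Parent catParent (toℕ u) (toℕ v) → κ u ~ κ v
    κ-parent {suc u} {v} q = inj₁ (subst₂ (Parent crgParent) (sym (κ≡ (suc u))) (trans (cong glue q) (sym (κ≡ v))) (cat⇒crg (toℕ u)))
    from : ∀ {x y} → Images x y → x ~ y
    from (inj₁ (u , v , refl , refl , inj₁ q)) = ι-parent q
    from (inj₁ (u , v , refl , refl , inj₂ q)) = symmetric (ι-parent q)
    from (inj₂ (u , v , refl , refl , inj₁ q)) = κ-parent q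
    from (inj₂ (u , v , refl , refl , inj₂ q)) = symmetric (κ-parent q)

  isCrg : 2 ∣ n → 4 ≤ n → IsCrg T
  isCrg 2∣n 4≤n = l , 2∣n , 4≤n , odd , s≤s (+-mono-≤ 0<c 0<c) , l<n ,
    R , root , C , tip , rgood , caterpillar , tip-eccentric , identification
    where
    odd : 2 ∤ l
    odd (divides q l≡) = odd≢even c q (trans l≡ (trans (*-comm q 2) (cong (q +_) (+-identityʳ q))))

  private
    base : ∃ λ (v : Fin n) → toℕ v ≡ 0
    base = fromℕ< 0<n , toℕ-fromℕ< 0<n

    first-spine : ∃ λ (v : Fin n) → toℕ v ≡ l + 0
    first-spine = vertex (+-monoʳ-< l (s≤s z≤n))

  cat-side : Branch T (proj₁ base) (proj₁ first-spine) (cat e)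
  cat-side = cat-branch e 0 refl (proj₂ first-spine) (proj₂ base)

  heap-side : ∃₂ λ h t → Branch T (proj₁ first-spine) (proj₁ base) t × Heap h t
  -- The rgood part has c + 1 pendant vertices, and the leading bit of that number gives the height
  -- of the last complete level.
  heap-side with leading-bit c
  ... | h , r , r< , c≡ = h , heap-branch h 0 (proj₂ base) (subst (_< l) (sym (proj₂ base)) (s≤s z≤n))
          (trans (proj₂ first-spine) (trans (+-identityʳ l) (cong upper (sym (proj₂ base)))))
          (≤-trans (≤-reflexive (2^suc h)) (+-mono-≤ q≤ q≤))
          (≤-trans (+-mono-≤ ≤2q ≤2q) (≤-reflexive (sym (2^suc (suc h)))))
    where
    q≤ : 2 ^ h ≤ suc c
    q≤ = ≤-trans (m≤m+n (2 ^ h) r) (≤-reflexive (sym c≡))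
    ≤2q : suc c ≤ 2 ^ suc h
    ≤2q = ≤-trans (≤-reflexive c≡) (2^-double h ≤-refl (<⇒≤ r<))

-- The distance between centroid and subtree core

module _ {P : Pred ℕ 0ℓ} (P? : Decidable P) (k : ℕ) (p : P k) where

  least-holds : ∀ {m} → m ≡ proj₁ (least P? k p) → P m
  least-holds refl = proj₁ (proj₂ (least P? k p))

  least-minimal : ∀ {m} → m ≡ proj₁ (least P? k p) → ∀ {j} → P j → m ≤ j
  least-minimal refl {j} = proj₂ (proj₂ (least P? k p)) j

module _ {n} (G : Graph n) where
  open Graph G

  module _ {X Y : Pred (Fin n) 0ℓ} (X? : Decidable X) (Y? : Decidable Y) (ex : ∃ X) (ey : ∃ Y) where

    private
      Attained : Pred ℕ 0ℓ
      Attained k = ∃₂ λ x y → X x × Y y × dist x y ≡ k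

      initial : Attained (dist (proj₁ ex) (proj₁ ey))
      initial = proj₁ ex , proj₁ ey , proj₂ ex , proj₂ ey , refl

    setDist-attained : Attained (setDist X? Y? ex ey)
    setDist-attained = least-holds {Attained} _ (dist (proj₁ ex) (proj₁ ey)) initial refl

    setDist-≤ : ∀ {k x y} → X x → Y y → Walk _~_ k x y → setDist X? Y? ex ey ≤ k
    setDist-≤ {k} {x} {y} xX yY w =
      ≤-trans (least-minimal {Attained} _ (dist (proj₁ ex) (proj₁ ey)) initial refl (x , y , xX , yY , refl)) (dist-≤ G w)

-- centroidCoreDist, protected from unfolding: its normal form is enormous.
abstract

  gap : ∀ {n} → Graph n → ℕ
  gap = centroidCoreDist

  gap≡ : ∀ {n} (G : Graph n) → gap G ≡ centroidCoreDist G
  gap≡ G = refl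

  gap-attained : ∀ {n} (G : Graph n) → ∃₂ λ x y → Centroid G x × SubtreeCore G y × Graph.dist G x y ≡ gap G
  gap-attained G = setDist-attained G (centroid? G) (subtreeCore? G) (centroid-nonempty G) (subtreeCore-nonempty G)

  gap-≤ : ∀ {n} (G : Graph n) {k x y} → Centroid G x → SubtreeCore G y → Walk (Graph._~_ G) k x y → gap G ≤ k
  gap-≤ G = setDist-≤ G (centroid? G) (subtreeCore? G) (centroid-nonempty G) (subtreeCore-nonempty G)

-- tA and tB are to be the two sides of the last edge of a shortest walk, of
-- length suc j, from the centroid to the subtree core.
Witness : ℕ → ℕ → BinTree → BinTree → Set
Witness n j tA tB = rootSubs tB < rootSubs tA × size tA + size tB ≡ n × size tA + (j + j) + (size tA + (j + j)) < n

module _ {n} {G : Graph n} (bin : Graph.IsBinaryTree G) where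
  open Graph G

  1≤size : ∀ t → 1 ≤ size t
  1≤size t = ≤-trans (s≤s z≤n) (≤-reflexive (sym (size≡ t)))

  two-more : ∀ {a s r} k → a + (k + k) ≤ s → 1 ≤ r → a + (suc k + suc k) ≤ suc (s + r)
  two-more {a} {s} {r} k le 1≤r = begin
    a + (suc k + suc k)   ≡⟨ ring a k ⟩
    suc (a + (k + k) + 1) ≤⟨ s≤s (+-mono-≤ le 1≤r) ⟩
    suc (s + r)           ∎
    where
    open ≤-Reasoning
    ring : ∀ a k → a + (suc k + suc k) ≡ suc (a + (k + k) + 1)
    ring = solve-∀

  -- Every vertex of a shortest walk through a branch has a child off the walk.
  follow : ∀ {p v t k y} → Branch G p v t → (∀ {j} → Walk _~_ j p y → suc k ≤ j) → Walk _~_ k v y →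
           ∃₂ λ q u → Branch G q y u × Walk _~_ k p q × size u + (k + k) ≤ size t
  follow {p} {t = t} b short [] = p , t , b , [] , ≤-reflexive (+-identityʳ (size t))
  follow {p} (leaf _ only) short (e ∷ w) with only _ e
  ... | refl = contradiction (short w) (<⇒≱ (s≤s (n≤1+n _)))
  follow {p} {v} {k = suc k} {y} (node {l = l} {r} v~p _ _ _ only bl br) short (e ∷ w) with only _ e
  ... | inj₁ refl = contradiction (short w) (<⇒≱ (s≤s (n≤1+n _)))
  ... | inj₂ (inj₁ refl) =
    let q , u , b , w′ , le = follow bl (λ w″ → ≤-pred (short (symmetric v~p ∷ w″))) w
    in q , u , b , symmetric v~p ∷ w′ , two-more k le (1≤size r)
  ... | inj₂ (inj₂ refl) =
    let q , u , b , w′ , le = follow br (λ w″ → ≤-pred (short (symmetric v~p ∷ w″))) w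
    in q , u , b , symmetric v~p ∷ w′ , ≤-trans (two-more k le (1≤size l)) (≤-reflexive (cong suc (+-comm (size r) (size l))))

  shortest-witness : ∀ {j x y} → Centroid G x → SubtreeCore G y →
                     (∀ {k x y} → Centroid G x → SubtreeCore G y → Walk _~_ k x y → suc j ≤ k) →
                     Walk _~_ (suc j) x y → ∃₂ (Witness n j)
  shortest-witness cx cy short (e ∷ w) =
    let t , b = branch bin (symmetric e)
        s , o = branch bin e
        q , tA , bA , wq , le = follow b (short cx cy) w
        tB , bB = branch bin (symmetric (root~ bA))
        -- A centroid vertex second on the walk, or a core vertex last but one, would leave a walk
        -- of length j between the two sets; this makes both inequalities strict.
        t<s = centroid-edge bin b o cx (λ cv → 1+n≰n (short cv cy w))
    in tA , tB ,
       core-edge bin bA bB cy (λ cq → 1+n≰n (short cx cq wq)) ,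
       size-sum bin bA bB ,
       ≤-trans (s≤s (+-mono-≤ le le)) (≤-trans (+-monoʳ-< (size t) t<s) (≤-reflexive (size-sum bin b o)))

  witness : ∀ {j} → gap G ≡ suc j → ∃₂ (Witness n j)
  witness {j} d≡ = let x , y , cx , cy , xy = gap-attained G in
    shortest-witness cx cy
      (λ cx′ cy′ w → ≤-trans (≤-reflexive (sym d≡)) (gap-≤ G cx′ cy′ w))
      (subst (λ k → Walk _~_ k x y) (trans xy d≡) (dist-walk G x y))

-- A lower bound for the distance in a crg tree

module CrgDistance (c e n : ℕ) (0<c : 0 < c) (n≡ : n ≡ suc (c + c) + suc (e + e)) where
  open Crg c e n 0<c n≡
  open Graph T

  -- The distance from the rgood part.
  beyond : ℕ → ℕ
  beyond i with i <? l
  ... | yes _ = 0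
  ... | no _  = catDepth (suc (i ∸ l))

  beyond-heap : ∀ {i} → i < l → beyond i ≡ 0
  beyond-heap {i} i<l with i <? l
  ... | yes _  = refl
  ... | no i≮l = contradiction i<l i≮l

  beyond-glue : ∀ k → beyond (glue k) ≡ catDepth k
  beyond-glue zero    = refl
  beyond-glue (suc k) with l + k <? l
  ... | yes lt = contradiction (m≤m+n l k) (<⇒≱ lt)
  ... | no _   = cong (catDepth ∘ suc) (m+n∸m≡n l k)

  beyond-lipschitz : ∀ {i j} → Parent crgParent i j → beyond i ≤ suc (beyond j) × beyond j ≤ suc (beyond i)
  beyond-lipschitz {i} q with crgVertex i
  ... | in-heap i<l rewrite beyond-heap i<l | beyond-heap (<-trans (parent-< n 0<n crgParent crgParent≤ q) i<l) = z≤n , z≤n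
  ... | in-cat k rewrite crg⇒cat k q | beyond-glue (suc k) | beyond-glue (catParent k) = catDepth-lipschitz {suc k} refl

  beyond-spine : ∀ {i} j → l + (j + j) ≤ i → suc j ≤ beyond i
  beyond-spine {i} j le with m≤n⇒∃[o]m+o≡n le
  ... | o , refl = ≤-trans (s≤s (≤-trans (≤-reflexive (sym (half-even j))) (⌊n/2⌋-mono (m≤m+n (j + j) o))))
    (≤-reflexive (sym (trans (cong beyond (+-assoc l (j + j) o)) (beyond-glue (suc (j + j + o))))))

  separation : ∀ {x y} j → l + (j + j) ≤ toℕ x → toℕ y < l → suc j ≤ dist x y
  separation {x} {y} j x≥ y<l = ≤-trans (beyond-spine j x≥)
    (≤-trans (walk-lipschitz T (beyond ∘ toℕ) lipschitz (walk-reverse symmetric (dist-walk T x y)))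
      (≤-reflexive (trans (cong (dist x y +_) (beyond-heap y<l)) (+-identityʳ _))))
    where
    lipschitz : ∀ {x y} → x ~ y → beyond (toℕ y) ≤ suc (beyond (toℕ x))
    lipschitz (inj₁ q) = proj₂ (beyond-lipschitz q)
    lipschitz (inj₂ q) = proj₁ (beyond-lipschitz q)

  heapTree : BinTree
  heapTree = proj₁ (proj₂ heap-side)

  heapBranch = proj₁ (proj₂ (proj₂ heap-side))

  size-heapTree : size heapTree ≡ l
  size-heapTree = +-cancelˡ-≡ (suc (e + e)) (size heapTree) l
    (trans (cong (_+ size heapTree) (sym (size-cat e)))
      (trans (size-sum binaryTree cat-side heapBranch) (trans n≡ (+-comm l (suc (e + e))))))

  inner-heapTree : inner heapTree ≡ c
  inner-heapTree = double-injective (suc-injective (trans (sym (size≡ heapTree)) size-heapTree))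

  heapTree-maximal : ∀ t → inner t ≡ c → rootSubs t ≤ rootSubs heapTree
  heapTree-maximal t t≡ = Heap-maximal (proj₂ (proj₂ (proj₂ heap-side))) t (trans t≡ (sym inner-heapTree))

  -- `¬core-below` rules out the caterpillar side of the edge. On the other side adjacency leads out
  -- of the numbers below l only to vertex l, the far end of that edge.
  core-in-heap : rootSubs (cat e) < rootSubs heapTree → ∀ {z} → SubtreeCore T z → toℕ z < l
  core-in-heap lt {z} core with verts-cover cat-side heapBranch z
  ... | inj₁ z∈ = contradiction core (¬core-below binaryTree cat-side heapBranch lt z∈)
  ... | inj₂ z∈ = verts-invariant (λ x → toℕ x < l) heapBranch (parent∉ binaryTree heapBranch) closed
                    (subst (_< l) (sym (toℕ-fromℕ< 0<n)) z<s) z∈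
    where
    upper< : ∀ i {w} → i < l → w ≡ upper i → w ≡ l + 0 ⊎ w < l
    upper< zero    _   w≡ = inj₁ (trans w≡ (sym (+-identityʳ l)))
    upper< (suc k) i<l w≡ = inj₂ (≤-trans (s≤s (≤-trans (≤-reflexive w≡) (≤-trans (⌊n/2⌋≤n k) (n≤1+n k)))) i<l)
    closed : ∀ {x y} → toℕ x < l → x ~ y → y ≡ _ ⊎ toℕ y < l
    closed {x} x<l e with heap-adjacent x<l e
    ... | inj₂ (y<l , _) = inj₂ y<l
    ... | inj₁ y≡ with upper< (toℕ x) x<l y≡
    ...   | inj₁ y≡l = inj₁ (toℕ-injective (trans y≡l (sym (toℕ-fromℕ< _))))
    ...   | inj₂ y<l = inj₂ y<l

  glue<bound : ∀ {k} → k ≤ e + e → glue (catParent k) < l + suc (e + e)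
  glue<bound {k} k≤ with catParent k | catParent≤ k
  ... | zero  | _  = z<s
  ... | suc x | x< = +-monoʳ-< l (≤-trans x< (≤-trans k≤ (n≤1+n _)))

  -- The edge from spine vertex l + 2 j towards the rgood part cuts off exactly the l + 2 j smaller
  -- numbers. That is less than half of all vertices, so `¬centroid-below` excludes them.
  centroid-beyond : ∀ j → l + (j + j) + (l + (j + j)) < n → ∀ {z} → Centroid T z → l + (j + j) ≤ toℕ z
  centroid-beyond j small {z} central = go (m≤n⇒∃[o]m+o≡n j≤e)
    where
    near = l + (j + j)
    j≤e : j ≤ e
    j≤e = double-≤-cancel (≤-pred (+-cancelˡ-< l (j + j) (suc (e + e))
      (≤-trans (s≤s (m≤m+n near near)) (≤-trans small (≤-reflexive n≡)))))
    closed : ∀ {p x y : Fin n} → toℕ p ≡ glue (catParent (j + j)) → near ≤ toℕ x → x ~ y → y ≡ p ⊎ near ≤ toℕ y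
    closed {p} {x} {y} p≡ x≥ x~y with m≤n⇒∃[o]m+o≡n x≥
    ... | o , x≡ with cat-adjacent {j + j + o} (subst (λ i → Adjacent i (toℕ y)) (trans (sym x≡) (+-assoc l (j + j) o)) x~y)
    ...   | inj₂ (suc w , y≡ , q) = inj₂ (≤-trans (+-monoʳ-≤ l (≤-trans (m≤m+n (j + j) o) (<⇒≤ (≤-pred (parent-< n 0<n catParent catParent≤ q))))) (≤-reflexive (sym y≡)))
    ...   | inj₁ y≡ with o
    ...     | zero   = inj₁ (toℕ-injective (trans y≡ (trans (cong (glue ∘ catParent) (+-identityʳ (j + j))) (sym p≡))))
    ...     | suc o′ = inj₂ (≤-trans (+-monoʳ-≤ l (≤-trans (≤-reflexive (cong (λ h → h + h) (sym (half-even j)))) (+-mono-≤ half≤ half≤)))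
                         (≤-reflexive (sym (trans y≡ (cong (glue ∘ catParent) (+-suc (j + j) o′))))))
      where
      half≤ : ⌊ j + j /2⌋ ≤ ⌊ j + j + o′ /2⌋
      half≤ = ⌊n/2⌋-mono (m≤m+n (j + j) o′)
    go : (∃ λ d → j + d ≡ e) → near ≤ toℕ z
    go (d , refl) = side (verts-cover b o z)
      where
      v = vertex (+-monoʳ-< l (s≤s (+-mono-≤ j≤e j≤e)))
      p = vertex (glue<bound (+-mono-≤ j≤e j≤e))
      b : Branch T (proj₁ p) (proj₁ v) (cat d)
      b = cat-branch d j refl (proj₂ v) (proj₂ p)
      opposite : ∃ (Branch T (proj₁ v) (proj₁ p))
      opposite = branch binaryTree (symmetric (root~ b))
      o = proj₂ opposite
      total : size (cat d) + size (proj₁ opposite) ≡ size (cat d) + near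
      total = trans (size-sum binaryTree b o) (trans n≡ (trans (ring l j d) (cong (_+ near) (sym (size-cat d)))))
        where
        ring : ∀ l j d → l + suc (j + d + (j + d)) ≡ suc (d + d) + (l + (j + j))
        ring = solve-∀
      lighter : size (proj₁ opposite) < size (cat d)
      lighter = +-cancelʳ-< near (size (proj₁ opposite)) (size (cat d))
        (≤-trans (s≤s (≤-reflexive (cong (_+ near) (+-cancelˡ-≡ (size (cat d)) _ _ total))))
          (≤-trans small (≤-reflexive (trans (sym (size-sum binaryTree b o)) total))))
      side : z ∈ verts b ⊎ z ∈ verts o → near ≤ toℕ z
      side (inj₁ z∈) = verts-invariant (λ x → near ≤ toℕ x) b (parent∉ binaryTree b) (closed (proj₂ p)) (≤-reflexive (sym (proj₂ v))) z∈
      side (inj₂ z∈) = contradiction central (¬centroid-below binaryTree o b lighter z∈)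

  far-apart : ∀ j → rootSubs (cat e) < rootSubs heapTree → l + (j + j) + (l + (j + j)) < n → suc j ≤ gap T
  far-apart j lt small = let x , y , cx , cy , xy = gap-attained T in
    ≤-trans (separation j (centroid-beyond j small cx) (core-in-heap lt cy)) (≤-reflexive xy)

  dominates : ∀ j tA tB → inner tA ≡ c → inner tB ≡ e → rootSubs tB < rootSubs tA →
              size tA + (j + j) + (size tA + (j + j)) < n → suc j ≤ gap T
  dominates j tA tB refl refl lt small =
    far-apart j (≤-trans (s≤s (cat-minimal tB)) (≤-trans lt (heapTree-maximal tA refl)))
      (subst (λ s → s + (j + j) + (s + (j + j)) < n) (size≡ tA) small)

-- The best crg tree

maximum : ∀ {M} (f : Fin (suc M) → ℕ) → ∃ λ i → ∀ j → f j ≤ f i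
maximum {M} f = argmax f zero (allFin (suc M)) ,
  λ j → All.lookup (f[xs]≤f[argmax] {f = f} zero (allFin (suc M))) (∈-allFin j)

module _ (M : ℕ) where

  -- With n = 4 + 2 M, candidate i has c = i + 1 and e = M - i; thus l = 2 i + 3 runs through all
  -- odd numbers from 3 to n - 1.
  order : ℕ
  order = 4 + (M + M)

  order≡ : ∀ i → i ≤ M → order ≡ suc (suc i + suc i) + suc (M ∸ i + (M ∸ i))
  order≡ i i≤M = trans (cong (λ k → 4 + (k + k)) (sym (m+[n∸m]≡n i≤M))) (ring i (M ∸ i))
    where
    ring : ∀ i k → 4 + (i + k + (i + k)) ≡ suc (suc i + suc i) + suc (k + k)
    ring = solve-∀

  candidate : Fin (suc M) → Graph order
  candidate i = Crg.T (suc (toℕ i)) (M ∸ toℕ i) order z<s (order≡ (toℕ i) (≤-pred (toℕ<n i)))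

  candidate-isCrg : 2 ∣ order → ∀ i → IsCrg (candidate i)
  candidate-isCrg 2∣ i = Crg.isCrg (suc (toℕ i)) (M ∸ toℕ i) order z<s (order≡ (toℕ i) (≤-pred (toℕ<n i))) 2∣ (m≤m+n 4 (M + M))

  candidate-dominates : ∀ {j} → ∃₂ (Witness order j) → ∃ λ i → suc j ≤ gap (candidate i)
  -- A single vertex has the least possible value 2, so the side of the core vertex has at least
  -- three vertices, as l requires.
  candidate-dominates (leaf , tB , lt , _) = contradiction (2≤rootSubs tB) (<⇒≱ lt)
  candidate-dominates {j} (tA@(node l r) , tB , lt , sum , small) = i ,
    CrgDistance.dominates (suc (toℕ i)) (M ∸ toℕ i) order z<s (order≡ (toℕ i) (≤-pred (toℕ<n i)))
      j tA tB (cong suc (sym i≡)) tB≡ lt small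
    where
    k = inner l + inner r
    k+tB : k + inner tB ≡ M
    k+tB = double-injective (+-cancelˡ-≡ 4 _ _ (trans (ring k (inner tB)) (trans (cong₂ _+_ (sym (size≡ tA)) (sym (size≡ tB))) sum)))
      where
      ring : ∀ a b → 4 + (a + b + (a + b)) ≡ suc (suc a + suc a) + suc (b + b)
      ring = solve-∀
    k< : k < suc M
    k< = s≤s (≤-trans (m≤m+n k (inner tB)) (≤-reflexive k+tB))
    i : Fin (suc M)
    i = fromℕ< k<
    i≡ : toℕ i ≡ k
    i≡ = toℕ-fromℕ< k<
    tB≡ : inner tB ≡ M ∸ toℕ i
    tB≡ = trans (sym (m+n∸m≡n k (inner tB))) (cong₂ _∸_ k+tB (sym i≡))

  best-optimal : ∀ i → (∀ j → gap (candidate j) ≤ gap (candidate i)) →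
                 ∀ G → Graph.IsBinaryTree G → gap G ≤ gap (candidate i)
  best-optimal i best G bin = bound (gap G) refl
    where
    bound : ∀ d → gap G ≡ d → gap G ≤ gap (candidate i)
    bound zero    d≡ = ≤-trans (≤-reflexive d≡) z≤n
    bound (suc d) d≡ = let j , le = candidate-dominates (witness bin d≡) in
      ≤-trans (≤-reflexive d≡) (≤-trans le (best j))

  optimal : 2 ∣ order → (∃ λ i → ∀ j → gap (candidate j) ≤ gap (candidate i)) →
            Σ[ T* ∈ Graph order ] (IsCrg T* × ((T : Graph order) → Graph.IsBinaryTree T → gap T ≤ gap T*))
  optimal 2∣ (i , best) = candidate i , candidate-isCrg 2∣ i , best-optimal i best

even-order : ∀ {n} → 12 ≤ n → 2 ∣ n → ∃ λ M → n ≡ order M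
even-order 12≤n (divides (suc (suc M)) refl) = M , ring M
  where
  ring : ∀ M → (2 + M) * 2 ≡ 4 + (M + M)
  ring = solve-∀
even-order (s≤s (s≤s ())) (divides 1 refl)

theorem3p11 : (n : ℕ) → 12 ≤ n → 2 ∣ n →
    Σ[ T* ∈ Graph n ] (IsCrg T* ×
    ((T : Graph n) → Graph.IsBinaryTree T → centroidCoreDist T ≤ centroidCoreDist T*))
theorem3p11 n 12≤n 2∣n = conclude (optimum (even-order 12≤n 2∣n))
  where
  Optimum : Graph n → Set₁
  Optimum T* = IsCrg T* × (∀ T → Graph.IsBinaryTree T → gap T ≤ gap T*)
  optimum : (∃ λ M → n ≡ order M) → Σ[ T* ∈ Graph n ] Optimum T*
  optimum (M , refl) = optimal M 2∣n (maximum (λ i → gap (candidate M i)))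
  conclude : (Σ[ T* ∈ Graph n ] Optimum T*) → _
  conclude (T* , crg , opt) = T* , crg , λ T bin → subst₂ _≤_ (gap≡ T) (gap≡ T*) (opt T bin)
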